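{- Let $N=\binom{n}{2}$ and let $(e_{1,1},\dots,e_{N,1})$ and $(e_{1,2},\dots,e_{N,2})$ be two independent uniformly random orderings of the edge set of the complete graph $K_n$. For $I\subseteq [N]$ let $E_{I,j}=\{e_{i,j}:i\in I\}$, $j=1,2$. Call $I\subseteq[N]$ a MultiTree if both $E_{I,1}$ and $E_{I,2}$ form spanning trees of $K_n$. Let $m^*$ be the smallest $m$ such that $[m]$ contains a MultiTree. For $j=1,2$ let $\Gamma_{j,m}$ be the graph $([n],E_{[m],j})$ and let $m_j=\min\{m:\Gamma_{j,m}\text{ is connected}\}$. Then with high probability $m^*=\max\{m_1,m_2\}$.
   Context: With high probability means with probability tending to 1 as $n\to\infty$. -}

module Defs where

open import Data.Nat using (ℕ; zero; suc; _*_; _≤_; _⊔_; _∸_)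
open import Data.Nat.Combinatorics using (_C_)
open import Data.Bool using (Bool; true; false; _∧_; _∨_; not; if_then_else_)
open import Data.Fin using (Fin; _<?_; _≟_)
open import Data.Bool.ListAction using (any; all)
open import Data.List using (List; []; _∷_; _++_; map; concatMap; allFin;
  filterᵇ; length; cartesianProduct; take; upTo)
open import Data.Maybe using (Maybe; just; nothing)
open import Data.Product using (_×_; _,_; proj₁; proj₂)
open import Relation.Nullary.Decidable using (isYes)
import Data.Nat as ℕ

-- Edges of K_n: unordered pairs {i,j} represented as (i , j) with i < j.
Edge : ℕ → Set
Edge n = Fin n × Fin n

edgesK : (n : ℕ) → List (Edge n)
edgesK n = concatMap (λ i → concatMap (λ j → if isYes (i <? j) then (i , j) ∷ [] else [])
                                        (allFin n))
                     (allFin n)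

Nn : ℕ → ℕ
Nn n = n C 2

insertAll : {A : Set} → A → List A → List (List A)
insertAll x []       = (x ∷ []) ∷ []
insertAll x (y ∷ ys) = (x ∷ y ∷ ys) ∷ map (y ∷_) (insertAll x ys)

perms : {A : Set} → List A → List (List A)
perms []       = [] ∷ []
perms (x ∷ xs) = concatMap (insertAll x) (perms xs)

-- An ordering (e_1,…,e_N) of E(K_n); the uniform distribution is uniform on this list
-- (edges are distinct, so each ordering occurs exactly once).
orderings : (n : ℕ) → List (List (Edge n))
orderings n = perms (edgesK n)

_==_ : {n : ℕ} → Fin n → Fin n → Bool
i == j = isYes (i ≟ j)

reach : {n : ℕ} → ℕ → List (Edge n) → Fin n → Fin n → Bool
reach zero    E u v = u == v
reach (suc k) E u v = reach k E u v ∨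
  any (λ e → ((proj₁ e == u) ∧ reach k E (proj₂ e) v) ∨
             ((proj₂ e == u) ∧ reach k E (proj₁ e) v)) E

connected : {n : ℕ} → List (Edge n) → Bool
connected {n} E = all (λ u → all (λ v → reach n E u v) (allFin n)) (allFin n)

dropAt : {A : Set} → ℕ → List A → List A
dropAt _       []       = []
dropAt zero    (x ∷ xs) = xs
dropAt (suc p) (x ∷ xs) = x ∷ dropAt p xs

-- acyclic: every edge is a bridge (its endpoints are disconnected once it is removed)
acyclic : {n : ℕ} → List (Edge n) → Bool
acyclic {n} E = all (λ p → go p E) (upTo (length E))
  where
  go : ℕ → List (Edge n) → Bool
  go p E' = goAt p E'
    where
    lookupE : ℕ → List (Edge n) → Maybe (Edge n)
    lookupE _ [] = nothing
    lookupE zero (x ∷ _) = just x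
    lookupE (suc q) (_ ∷ xs) = lookupE q xs
    goAt : ℕ → List (Edge n) → Bool
    goAt q F with lookupE q F
    ... | nothing = true
    ... | just (a , b) = not (reach n (dropAt q F) a b)

spanningTree : {n : ℕ} → List (Edge n) → Bool
spanningTree E = connected E ∧ acyclic E

subsets : ℕ → List (List Bool)
subsets zero    = [] ∷ []
subsets (suc m) = concatMap (λ s → (true ∷ s) ∷ (false ∷ s) ∷ []) (subsets m)

select : {A : Set} → List Bool → List A → List A
select []          _        = []
select (_ ∷ _)     []       = []
select (true ∷ b)  (x ∷ xs) = x ∷ select b xs
select (false ∷ b) (x ∷ xs) = select b xs

multiTree : {n : ℕ} → List (Edge n) → List (Edge n) → List Bool → Bool
multiTree σ₁ σ₂ I = spanningTree (select I σ₁) ∧ spanningTree (select I σ₂)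

containsMT : {n : ℕ} → List (Edge n) → List (Edge n) → ℕ → Bool
containsMT σ₁ σ₂ m = any (multiTree σ₁ σ₂) (subsets m)

firstFrom : ℕ → ℕ → (ℕ → Bool) → Maybe ℕ
firstFrom zero    m p = if p m then just m else nothing
firstFrom (suc k) m p = if p m then just m else firstFrom k (suc m) p

minM : ℕ → (ℕ → Bool) → Maybe ℕ
minM N p = firstFrom N 0 p

mStar : (n : ℕ) → List (Edge n) → List (Edge n) → Maybe ℕ
mStar n σ₁ σ₂ = minM (Nn n) (containsMT σ₁ σ₂)

mConn : (n : ℕ) → List (Edge n) → Maybe ℕ
mConn n σ = minM (Nn n) (λ m → connected (take m σ))

goodEvent : (n : ℕ) → List (Edge n) → List (Edge n) → Bool
goodEvent n σ₁ σ₂ with mStar n σ₁ σ₂ | mConn n σ₁ | mConn n σ₂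
... | just s | just a | just b = isYes (s ℕ.≟ (a ⊔ b))
... | _      | _      | _      = false

samples : (n : ℕ) → List (List (Edge n) × List (Edge n))
samples n = cartesianProduct (orderings n) (orderings n)

totalCount : ℕ → ℕ
totalCount n = length (samples n)

badCount : ℕ → ℕ
badCount n = length (filterᵇ (λ s → not (goodEvent n (proj₁ s) (proj₂ s))) (samples n))

{-# OPTIONS --safe #-}
module Submission where

-- Let M = max(m₁, m₂). If [M] contains no MultiTree, the matroid intersection theorem for the
-- two graphic matroids gives A ⊆ [M] with r₁(A) + r₂([M]∖A) ≤ n - 2, and by symmetry
-- r = r₁(A) ≤ n/2. An index in A has its first edge inside a component of (A, first graph);
-- an index outside A has its second edge inside a component of ([M]∖A, second graph), and the
-- latter graph has at least r + 2 components.
--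
-- Let U be a union of components of the second graph that contains at most 3n/4 vertices. The
-- n - r representatives of the components of the first graph lie in different components, so
-- no index has its first edge between two representatives and its second edge leaving U. If U
-- can be chosen with |U| > n/Y for a small power Y of n, a union bound over U and over the set
-- of the r other vertices excludes this. Otherwise all but one component of the second graph
-- have at most n/Y vertices in total, and sets of that size span few edges. Let L be the
-- complement of the 10K-core of the second graph at an early time m₀ ≤ M, and J the set of
-- indices whose second edge touches L. It is so small that the first edges of J form a
-- matching. Removing from the second graph only A∖J still leaves more than r - |A∩J| small
-- components, each of which meets the core, so that |A∖J| is a large multiple of
-- r - |A∩J| + 1. After contracting the matching A∩J of the first graph, however, A∖J has rank
-- r - |A∩J| and hence only O(r - |A∩J|) edges: a contradiction.
--
-- All tail bounds for a uniform ordering σ follow from Maclaurin's inequality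
-- E ∏_{i∈I} g(σᵢ) ≤ (mean of g)^|I|. The second moment of the number of isolated vertices at
-- time m₀ gives m₀ ≤ M.

open import Defs
open import Data.Nat using (ℕ; zero; suc; _+_; _*_; _∸_; _^_; _≤_; _<_; _⊔_; _≤ᵇ_; _≤?_; _<?_; z≤n; s≤s; NonZero; _!)
open import Data.Nat.Properties hiding (_≟_)
open import Data.Nat.Tactic.RingSolver using (solve-∀)
open import Data.Bool using (Bool; true; false; _∧_; _∨_; not; if_then_else_; _xor_)
open import Data.Bool.ListAction using (any; all)
open import Data.Bool.Properties using (T-≡; ∧-comm)
open import Data.Fin using (Fin; toℕ)
open import Data.Fin.Properties using (toℕ-injective; toℕ<n) renaming (_≟_ to _≟F_)
open import Data.List using (List; []; _∷_; _++_; map; concatMap; length; filterᵇ; allFin; take; upTo; cartesianProduct; replicate; tabulate)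
open import Data.List.Relation.Unary.All using (All; []; _∷_)
open import Data.List.Relation.Unary.Any using (Any; here; there)
open import Data.List.Membership.Propositional using (_∈_)
open import Data.List.Relation.Binary.Permutation.Propositional using (_↭_; ↭-refl; ↭-sym; ↭-trans)
open import Data.Maybe using (Maybe; just; nothing)
open import Data.Vec using (Vec; []; _∷_; lookup; toList)
open import Data.Product using (_×_; _,_; proj₁; proj₂; ∃-syntax)
open import Data.Sum using (_⊎_; inj₁; inj₂)
open import Data.Empty using (⊥; ⊥-elim)
open import Data.Unit using (tt)
open import Function using (_∘_; id; Equivalence)
open import Relation.Nullary using (¬_; yes; no; contradiction)
open import Relation.Nullary.Decidable using (isYes)
open import Relation.Binary.PropositionalEquality
open import Relation.Binary.Definitions using (tri<; tri≈; tri>)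
import Data.Fin as Fin
import Data.List.Membership.Propositional.Properties as Mem
import Data.List.Properties as List
import Data.List.Relation.Binary.Permutation.Propositional as Perm
import Data.List.Relation.Binary.Permutation.Propositional.Properties as Perm
import Data.List.Relation.Unary.All as All
import Data.List.Relation.Unary.All.Properties as All
import Data.Nat as ℕ
import Data.Nat.Combinatorics as Comb
import Data.Nat.DivMod as Div
import Data.Sum as Sum
import Data.Vec as Vec
import Data.Vec.Properties as Vec

-- Finite sums

-- No probabilities are formed: an event is rare if `s` times its count is at most the count of all
-- outcomes, with `s` about `n^(1/P)`. Only lengths M from m₀ to m₁ = ns matter, but the argument
-- must work for all of them and for all A at once. So L is read off one ordering at time m₀,
-- independently of A and M, which leaves the other ordering uniform once L is known.
--
-- A union bound alone cannot treat small U: the choice of the two sets costs about (n/|U|)^(3|U|),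
-- while the probability is n^(-c|U|) with a small c. Hence the cut at n/Y.
--
-- The exponents are squeezed from several sides. For the first edges of J to form a matching, |L|
-- must be below √n, so ω > P/2, where s^P ≈ n and |L| ≤ 8s^(P-ω). Excluding the candidates for L by
-- a union bound needs 8ω < 7a, where (1 - 2/n)^m₀ ≈ s^(-a). Isolated vertices at time m₀ need a <
-- P. So a/P lies between 4/7 and 1; it is 3/4 in the end.

infixr 7 _⟨×⟩_

𝟙 : Bool → ℕ
𝟙 true  = 1
𝟙 false = 0

𝟙≤1 : ∀ b → 𝟙 b ≤ 1
𝟙≤1 true  = ≤-refl
𝟙≤1 false = z≤n

𝟙-mono : ∀ {a b} → (a ≡ true → b ≡ true) → 𝟙 a ≤ 𝟙 b
𝟙-mono {false} _ = z≤n
𝟙-mono {true}  h rewrite h refl = ≤-refl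

𝟙-∨ : ∀ a b → 𝟙 (a ∨ b) ≤ 𝟙 a + 𝟙 b
𝟙-∨ true  b = s≤s z≤n
𝟙-∨ false b = ≤-refl

𝟙-∧ : ∀ a b → 𝟙 (a ∧ b) ≡ 𝟙 a * 𝟙 b
𝟙-∧ true  b = sym (+-identityʳ _)
𝟙-∧ false b = refl

bool-cases : ∀ b → b ≡ true ⊎ b ≡ false
bool-cases true  = inj₁ refl
bool-cases false = inj₂ refl

true≢false : ∀ {A : Set} {b} → b ≡ true → b ≡ false → A
true≢false refl ()

∧-true : ∀ {a b} → a ∧ b ≡ true → a ≡ true × b ≡ true
∧-true {true} {true} _ = refl , refl

∨-false : ∀ {a b} → a ∨ b ≡ false → a ≡ false × b ≡ false
∨-false {false} {false} _ = refl , refl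

∨-true : ∀ {a b} → a ∨ b ≡ true → a ≡ true ⊎ b ≡ true
∨-true {true}  _ = inj₁ refl
∨-true {false} h = inj₂ h

≤ᵇ-true : ∀ {m n} → m ≤ n → (m ≤ᵇ n) ≡ true
≤ᵇ-true h = Equivalence.to T-≡ (≤⇒≤ᵇ h)

≤ᵇ-true⁻ : ∀ m n → (m ≤ᵇ n) ≡ true → m ≤ n
≤ᵇ-true⁻ m n h = ≤ᵇ⇒≤ m n (Equivalence.from T-≡ h)

≤ᵇ-false⁻ : ∀ m n → (m ≤ᵇ n) ≡ false → n < m
≤ᵇ-false⁻ m n h with m ≤? n
... | yes p = true≢false (≤ᵇ-true p) h
... | no ¬p = ≰⇒> ¬p

∑ : {A : Set} → List A → (A → ℕ) → ℕ
∑ []       f = 0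
∑ (x ∷ xs) f = f x + ∑ xs f

∏ : {A : Set} → List A → (A → ℕ) → ℕ
∏ []       f = 1
∏ (x ∷ xs) f = f x * ∏ xs f

module _ {A : Set} where

  ∑-cong : ∀ (xs : List A) {f g} → (∀ x → f x ≡ g x) → ∑ xs f ≡ ∑ xs g
  ∑-cong []       h = refl
  ∑-cong (x ∷ xs) h = cong₂ _+_ (h x) (∑-cong xs h)

  ∑-mono : ∀ (xs : List A) {f g} → (∀ x → f x ≤ g x) → ∑ xs f ≤ ∑ xs g
  ∑-mono []       h = z≤n
  ∑-mono (x ∷ xs) h = +-mono-≤ (h x) (∑-mono xs h)

  ∑-mono-All : ∀ {xs : List A} {f g} → All (λ x → f x ≤ g x) xs → ∑ xs f ≤ ∑ xs g
  ∑-mono-All []       = z≤n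
  ∑-mono-All (p ∷ ps) = +-mono-≤ p (∑-mono-All ps)

  ∑-cong-All : ∀ {xs : List A} {f g} → All (λ x → f x ≡ g x) xs → ∑ xs f ≡ ∑ xs g
  ∑-cong-All []       = refl
  ∑-cong-All (p ∷ ps) = cong₂ _+_ p (∑-cong-All ps)

  ∑-+ : ∀ (xs : List A) f g → ∑ xs (λ x → f x + g x) ≡ ∑ xs f + ∑ xs g
  ∑-+ []       f g = refl
  ∑-+ (x ∷ xs) f g rewrite ∑-+ xs f g = lemma (f x) (g x) (∑ xs f) (∑ xs g)
    where
    lemma : ∀ a b c d → a + b + (c + d) ≡ a + c + (b + d)
    lemma = solve-∀

  ∑-*ˡ : ∀ (xs : List A) c f → ∑ xs (λ x → c * f x) ≡ c * ∑ xs f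
  ∑-*ˡ []       c f = sym (*-zeroʳ c)
  ∑-*ˡ (x ∷ xs) c f rewrite ∑-*ˡ xs c f = sym (*-distribˡ-+ c (f x) (∑ xs f))

  ∑-*ʳ : ∀ (xs : List A) c f → ∑ xs (λ x → f x * c) ≡ ∑ xs f * c
  ∑-*ʳ xs c f = trans (∑-cong xs (λ x → *-comm (f x) c)) (trans (∑-*ˡ xs c f) (*-comm c _))

  ∑-const : ∀ (xs : List A) c → ∑ xs (λ _ → c) ≡ length xs * c
  ∑-const []       c = refl
  ∑-const (x ∷ xs) c = cong (c +_) (∑-const xs c)

  ∑-zero : ∀ (xs : List A) → ∑ xs (λ _ → 0) ≡ 0
  ∑-zero []       = refl
  ∑-zero (x ∷ xs) = ∑-zero xs

  ∑-++ : ∀ (xs ys : List A) f → ∑ (xs ++ ys) f ≡ ∑ xs f + ∑ ys f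
  ∑-++ []       ys f = refl
  ∑-++ (x ∷ xs) ys f rewrite ∑-++ xs ys f = sym (+-assoc (f x) _ _)

  ∑-∈ : ∀ {xs : List A} {x} f → x ∈ xs → f x ≤ ∑ xs f
  ∑-∈ f (here refl) = m≤m+n _ _
  ∑-∈ {y ∷ _} f (there p) = ≤-trans (∑-∈ f p) (m≤n+m _ (f y))

  ∑-map : ∀ {B : Set} (g : B → A) xs f → ∑ (map g xs) f ≡ ∑ xs (f ∘ g)
  ∑-map g []       f = refl
  ∑-map g (x ∷ xs) f = cong (f (g x) +_) (∑-map g xs f)

  ∑-concatMap : ∀ {B : Set} (g : B → List A) xs f →
    ∑ (concatMap g xs) f ≡ ∑ xs (λ x → ∑ (g x) f)
  ∑-concatMap g []       f = refl
  ∑-concatMap g (x ∷ xs) f =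
    trans (∑-++ (g x) _ f) (cong (∑ (g x) f +_) (∑-concatMap g xs f))

  filterᵇ-∑ : ∀ (p : A → Bool) xs → length (filterᵇ p xs) ≡ ∑ xs (𝟙 ∘ p)
  filterᵇ-∑ p []       = refl
  filterᵇ-∑ p (x ∷ xs) with p x
  ... | true  = cong suc (filterᵇ-∑ p xs)
  ... | false = filterᵇ-∑ p xs

  ∑-filterᵇ : ∀ (p : A → Bool) xs f → ∑ (filterᵇ p xs) f ≡ ∑ xs (λ x → 𝟙 (p x) * f x)
  ∑-filterᵇ p []       f = refl
  ∑-filterᵇ p (x ∷ xs) f with p x
  ... | true  = cong₂ _+_ (sym (+-identityʳ _)) (∑-filterᵇ p xs f)
  ... | false = ∑-filterᵇ p xs f

  𝟙-any : ∀ (p : A → Bool) xs → 𝟙 (any p xs) ≤ ∑ xs (𝟙 ∘ p)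
  𝟙-any p []       = z≤n
  𝟙-any p (x ∷ xs) = ≤-trans (𝟙-∨ (p x) _) (+-monoʳ-≤ (𝟙 (p x)) (𝟙-any p xs))

  any-false : ∀ (p : A → Bool) xs → any p xs ≡ false → ∀ {x} → x ∈ xs → p x ≡ false
  any-false p (x ∷ xs) h (here refl) = proj₁ (∨-false h)
  any-false p (x ∷ xs) h (there q)   = any-false p xs (proj₂ (∨-false {p x} h)) q

  any-true : ∀ (p : A → Bool) xs {x} → x ∈ xs → p x ≡ true → any p xs ≡ true
  any-true p (x ∷ xs) (here refl) h rewrite h = refl
  any-true p (x ∷ xs) (there q) h with p x
  ... | true  = refl
  ... | false = any-true p xs q h

  any-true⁻ : ∀ (p : A → Bool) xs → any p xs ≡ true → ∃[ x ] x ∈ xs × p x ≡ true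
  any-true⁻ p (x ∷ xs) h with p x in eq
  ... | true  = x , here refl , eq
  ... | false with any-true⁻ p xs h
  ...   | y , m , q = y , there m , q

  all-true : ∀ (p : A → Bool) xs → (∀ {x} → x ∈ xs → p x ≡ true) → all p xs ≡ true
  all-true p []       h = refl
  all-true p (x ∷ xs) h rewrite h (here refl) = all-true p xs (h ∘ there)

  all-true⁻ : ∀ (p : A → Bool) xs → all p xs ≡ true → ∀ {x} → x ∈ xs → p x ≡ true
  all-true⁻ p (x ∷ xs) h (here refl) = proj₁ (∧-true h)
  all-true⁻ p (x ∷ xs) h (there q)   = all-true⁻ p xs (proj₂ (∧-true {p x} h)) q

∑-swap : ∀ {A B : Set} (xs : List A) (ys : List B) (f : A → B → ℕ) →
  ∑ xs (λ x → ∑ ys (f x)) ≡ ∑ ys (λ y → ∑ xs (λ x → f x y))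
∑-swap []       ys f = sym (∑-zero ys)
∑-swap (x ∷ xs) ys f =
  trans (cong (∑ ys (f x) +_) (∑-swap xs ys f)) (sym (∑-+ ys (f x) _))

_⟨×⟩_ : {A B : Set} → List A → List B → (A → B → ℕ) → ℕ
(xs ⟨×⟩ ys) f = ∑ xs (λ x → ∑ ys (f x))

∑-cartesianProduct : ∀ {A B : Set} (xs : List A) (ys : List B) f →
  ∑ (cartesianProduct xs ys) f ≡ (xs ⟨×⟩ ys) (λ x y → f (x , y))
∑-cartesianProduct []       ys f = refl
∑-cartesianProduct (x ∷ xs) ys f =
  trans (∑-++ (map (x ,_) ys) _ f)
        (cong₂ _+_ (∑-map (x ,_) ys f) (∑-cartesianProduct xs ys f))

-- Uniform random orderings and Maclaurin's inequality

picks : {A : Set} → List A → List (A × List A)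
picks []       = []
picks (x ∷ xs) = (x , xs) ∷ map (λ p → proj₁ p , x ∷ proj₂ p) (picks xs)

module _ {A : Set} where

  ∑-picks-∷ : ∀ x (xs : List A) f →
    ∑ (picks (x ∷ xs)) f ≡ f (x , xs) + ∑ (picks xs) (λ p → f (proj₁ p , x ∷ proj₂ p))
  ∑-picks-∷ x xs f = cong (f (x , xs) +_) (∑-map _ (picks xs) f)

  ∑-picks-proj₁ : ∀ (xs : List A) f → ∑ (picks xs) (f ∘ proj₁) ≡ ∑ xs f
  ∑-picks-proj₁ []       f = refl
  ∑-picks-proj₁ (x ∷ xs) f =
    trans (∑-picks-∷ x xs (f ∘ proj₁)) (cong (f x +_) (∑-picks-proj₁ xs f))

  picks-length : ∀ (xs : List A) → All (λ p → length xs ≡ suc (length (proj₂ p))) (picks xs)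
  picks-length []       = []
  picks-length (x ∷ xs) = refl ∷ All.map⁺ (All.map (cong suc) (picks-length xs))

  picks-∑ : ∀ (xs : List A) f → All (λ p → ∑ xs f ≡ f (proj₁ p) + ∑ (proj₂ p) f) (picks xs)
  picks-∑ []       f = []
  picks-∑ (x ∷ xs) f = refl ∷ All.map⁺ (All.map (λ {p} e →
      trans (cong (f x +_) e) (lemma (f x) (f (proj₁ p)) _)) (picks-∑ xs f))
    where
    lemma : ∀ a b c → a + (b + c) ≡ b + (a + c)
    lemma = solve-∀

  -- The first two entries of a random ordering are exchangeable. Splitting off the head `x` leaves
  -- the cases that it is the first pick, the second pick or neither, and the swap exchanges the
  -- former two.
  ∑-picks-swap : ∀ (xs : List A) (f : A → A → List A → ℕ) →
    ∑ (picks xs) (λ p → ∑ (picks (proj₂ p)) (λ q → f (proj₁ p) (proj₁ q) (proj₂ q))) ≡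
    ∑ (picks xs) (λ p → ∑ (picks (proj₂ p)) (λ q → f (proj₁ q) (proj₁ p) (proj₂ q)))
  ∑-picks-swap []       f = refl
  ∑-picks-swap (x ∷ xs) f = trans (expand f) (trans middle (sym (expand (λ a b → f b a))))
    where
    g h : (A → A → List A → ℕ) → ℕ
    g f = ∑ (picks xs) (λ q → f x (proj₁ q) (proj₂ q))
    h f = ∑ (picks xs) (λ p → f (proj₁ p) x (proj₂ p))
    k : (A → A → List A → ℕ) → ℕ
    k f = ∑ (picks xs) (λ p → ∑ (picks (proj₂ p)) (λ q → f (proj₁ p) (proj₁ q) (x ∷ proj₂ q)))
    expand : ∀ f →
      ∑ (picks (x ∷ xs)) (λ p → ∑ (picks (proj₂ p)) (λ q → f (proj₁ p) (proj₁ q) (proj₂ q)))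
      ≡ g f + (h f + k f)
    expand f = trans (∑-picks-∷ x xs _) (cong (g f +_)
      (trans (∑-cong (picks xs) (λ p → ∑-picks-∷ x (proj₂ p) _)) (∑-+ (picks xs) _ _)))
    lemma : ∀ a b c → a + (b + c) ≡ b + (a + c)
    lemma = solve-∀
    middle : g f + (h f + k f) ≡ h f + (g f + k (λ a b → f b a))
    middle = trans (lemma (g f) (h f) (k f))
      (cong (λ z → h f + (g f + z)) (∑-picks-swap xs (λ a b l → f a b (x ∷ l))))

  -- `perms` inserts the head of the list into the orderings of the tail, while the counts below fix
  -- the first entry of an ordering and recurse on what is left. This is the passage between the
  -- two.
  ∑-perms : ∀ x (xs : List A) Φ →
    ∑ (perms (x ∷ xs)) Φ ≡ ∑ (picks (x ∷ xs)) (λ p → ∑ (perms (proj₂ p)) (λ σ → Φ (proj₁ p ∷ σ)))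
  ∑-perms x []       Φ = lemma (Φ (x ∷ []))
    where
    lemma : ∀ a → a + 0 ≡ a + 0 + 0
    lemma = solve-∀
  ∑-perms x (y ∷ ys) Φ =
    trans (∑-concatMap (insertAll x) (perms xs) Φ)
    (trans (∑-cong (perms xs) split)
    (trans (∑-+ (perms xs) _ _)
    (trans (cong (∑ (perms xs) (λ σ → Φ (x ∷ σ)) +_)
        (trans (∑-perms y ys tail)
          (∑-cong (picks xs) (λ p → trans
            (∑-cong (perms (proj₂ p)) (λ σ → ∑-map (proj₁ p ∷_) (insertAll x σ) Φ))
            (sym (∑-concatMap (insertAll x) (perms (proj₂ p)) _))))))
      (sym (∑-picks-∷ x xs (λ p → ∑ (perms (proj₂ p)) (λ σ → Φ (proj₁ p ∷ σ))))))))
    where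
    xs = y ∷ ys
    tail : List A → ℕ
    tail []      = 0
    tail (z ∷ σ) = ∑ (map (z ∷_) (insertAll x σ)) Φ
    split : ∀ σ → ∑ (insertAll x σ) Φ ≡ Φ (x ∷ σ) + tail σ
    split []      = refl
    split (z ∷ σ) = refl

  ∑-perms-const : ∀ (xs : List A) c → ∑ (perms xs) (λ _ → c) ≡ length xs ! * c
  ∑-perms-const xs c = by-length (length xs) xs refl
    where
    open ≡-Reasoning
    by-length : ∀ k xs → length xs ≡ k → ∑ (perms xs) (λ _ → c) ≡ k ! * c
    by-length zero    []       e = refl
    by-length (suc k) (x ∷ xs) e = begin
      ∑ (perms (x ∷ xs)) (λ _ → c)
        ≡⟨ ∑-perms x xs (λ _ → c) ⟩
      ∑ (picks (x ∷ xs)) (λ p → ∑ (perms (proj₂ p)) (λ _ → c))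
        ≡⟨ ∑-cong-All (All.map (λ {p} e′ → by-length k (proj₂ p) (suc-injective (trans (sym e′) e)))
             (picks-length (x ∷ xs))) ⟩
      ∑ (picks (x ∷ xs)) (λ p → k ! * c)
        ≡⟨ ∑-picks-proj₁ (x ∷ xs) (λ _ → k ! * c) ⟩
      ∑ (x ∷ xs) (λ _ → k ! * c)
        ≡⟨ ∑-const (x ∷ xs) _ ⟩
      suc (length xs) * (k ! * c)
        ≡⟨ cong (_* (k ! * c)) e ⟩
      suc k * (k ! * c)
        ≡⟨ *-assoc (suc k) (k !) c ⟨
      suc k ! * c ∎

trues : List Bool → ℕ
trues b = ∑ b 𝟙

trues≤ : ∀ b → trues b ≤ length b
trues≤ []      = z≤n
trues≤ (c ∷ b) = +-mono-≤ (𝟙≤1 c) (trues≤ b)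

∸-suc : ∀ {m n} → m < n → n ∸ m ≡ suc (n ∸ suc m)
∸-suc {m} (s≤s h) = +-∸-assoc 1 h

2ab≤a²+b² : ∀ a b → a * b + a * b ≤ a * a + b * b
2ab≤a²+b² a b with ≤-total a b
... | inj₁ h with m≤n⇒∃[o]m+o≡n h
...   | d , refl = subst (a * (a + d) + a * (a + d) ≤_) (sym (lemma a d)) (m≤m+n _ (d * d))
  where
  lemma : ∀ a d → a * a + (a + d) * (a + d) ≡ a * (a + d) + a * (a + d) + d * d
  lemma = solve-∀
2ab≤a²+b² a b | inj₂ h with m≤n⇒∃[o]m+o≡n h
...   | d , refl = subst ((b + d) * b + (b + d) * b ≤_) (sym (lemma b d)) (m≤m+n _ (d * d))
  where
  lemma : ∀ b d → (b + d) * (b + d) + b * b ≡ (b + d) * b + (b + d) * b + d * d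
  lemma = solve-∀

-- The sum of g(x₁)⋯g(x_k) over all injective k-sequences of positions of the list.
falling∑ : {A : Set} → (A → ℕ) → ℕ → List A → ℕ
falling∑ g zero    xs = 1
falling∑ g (suc k) xs = ∑ (picks xs) (λ p → g (proj₁ p) * falling∑ g k (proj₂ p))

module _ {A : Set} (g : A → ℕ) where

  private
    F : ℕ → List A → ℕ
    F = falling∑ g

  -- Double counting: an injective `k`-sequence leaves `length xs ∸ k` positions free, and each of
  -- them can be the one that was removed beforehand.
  ∑-picks-falling∑ : ∀ k (xs : List A) →
    ∑ (picks xs) (λ p → F k (proj₂ p)) ≡ (length xs ∸ k) * F k xs
  ∑-picks-falling∑ zero xs =
    trans (∑-picks-proj₁ xs (λ _ → 1)) (∑-const xs 1)
  ∑-picks-falling∑ (suc k) xs = begin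
    ∑ (picks xs) (λ p → ∑ (picks (proj₂ p)) (λ q → g (proj₁ q) * F k (proj₂ q)))
      ≡⟨ ∑-picks-swap xs (λ _ b l → g b * F k l) ⟩
    ∑ (picks xs) (λ p → ∑ (picks (proj₂ p)) (λ q → g (proj₁ p) * F k (proj₂ q)))
      ≡⟨ ∑-cong-All (All.map (λ {p} e → step p e) (picks-length xs)) ⟩
    ∑ (picks xs) (λ p → (length xs ∸ suc k) * (g (proj₁ p) * F k (proj₂ p)))
      ≡⟨ ∑-*ˡ (picks xs) (length xs ∸ suc k) _ ⟩
    (length xs ∸ suc k) * F (suc k) xs ∎
    where
    open ≡-Reasoning
    lemma : ∀ a b c → a * (b * c) ≡ b * (a * c)
    lemma = solve-∀
    step : ∀ p → length xs ≡ suc (length (proj₂ p)) →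
      ∑ (picks (proj₂ p)) (λ q → g (proj₁ p) * F k (proj₂ q)) ≡
      (length xs ∸ suc k) * (g (proj₁ p) * F k (proj₂ p))
    step p e rewrite e =
      trans (∑-*ˡ (picks (proj₂ p)) (g (proj₁ p)) _)
      (trans (cong (g (proj₁ p) *_) (∑-picks-falling∑ k (proj₂ p)))
             (lemma (g (proj₁ p)) (length (proj₂ p) ∸ k) _))

  -- The joint law of the entries at the marked positions depends only on the number of marks: an
  -- unmarked position merely discards a pick, which `∑-picks-falling∑` accounts for.
  ∑-perms-select : ∀ (b : List Bool) (xs : List A) → length b ≤ length xs →
    ∑ (perms xs) (λ σ → ∏ (select b σ) g) ≡ F (trues b) xs * (length xs ∸ trues b) !
  ∑-perms-select []      xs       _ = trans (∑-perms-const xs 1)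
    (trans (*-identityʳ _) (sym (*-identityˡ _)))
  ∑-perms-select (true ∷ b) (x ∷ xs) (s≤s h) = begin
    ∑ (perms (x ∷ xs)) (λ σ → ∏ (select (true ∷ b) σ) g)
      ≡⟨ ∑-perms x xs (λ σ → ∏ (select (true ∷ b) σ) g) ⟩
    ∑ (picks (x ∷ xs)) (λ p → ∑ (perms (proj₂ p)) (λ σ → g (proj₁ p) * ∏ (select b σ) g))
      ≡⟨ ∑-cong-All (All.map (λ {p} e → step p e) (picks-length (x ∷ xs))) ⟩
    ∑ (picks (x ∷ xs)) (λ p → g (proj₁ p) * F (trues b) (proj₂ p) * (length xs ∸ trues b) !)
      ≡⟨ ∑-*ʳ (picks (x ∷ xs)) ((length xs ∸ trues b) !) (λ p → g (proj₁ p) * F (trues b) (proj₂ p)) ⟩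
    F (suc (trues b)) (x ∷ xs) * (length xs ∸ trues b) ! ∎
    where
    open ≡-Reasoning
    step : ∀ p → length (x ∷ xs) ≡ suc (length (proj₂ p)) →
      ∑ (perms (proj₂ p)) (λ σ → g (proj₁ p) * ∏ (select b σ) g) ≡
      g (proj₁ p) * F (trues b) (proj₂ p) * (length xs ∸ trues b) !
    step p e = trans (∑-*ˡ (perms (proj₂ p)) (g (proj₁ p)) _)
      (trans (cong (g (proj₁ p) *_) (∑-perms-select b (proj₂ p) (subst (length b ≤_) (suc-injective e) h)))
      (trans (sym (*-assoc (g (proj₁ p)) _ _))
        (cong (λ k → g (proj₁ p) * F (trues b) (proj₂ p) * (k ∸ trues b) !) (sym (suc-injective e)))))
  ∑-perms-select (false ∷ b) (x ∷ xs) (s≤s h) = begin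
    ∑ (perms (x ∷ xs)) (λ σ → ∏ (select (false ∷ b) σ) g)
      ≡⟨ ∑-perms x xs (λ σ → ∏ (select (false ∷ b) σ) g) ⟩
    ∑ (picks (x ∷ xs)) (λ p → ∑ (perms (proj₂ p)) (λ σ → ∏ (select b σ) g))
      ≡⟨ ∑-cong-All (All.map (λ {p} e → trans
           (∑-perms-select b (proj₂ p) (subst (length b ≤_) (suc-injective e) h))
           (cong (λ k → F (trues b) (proj₂ p) * (k ∸ trues b) !) (sym (suc-injective e))))
           (picks-length (x ∷ xs))) ⟩
    ∑ (picks (x ∷ xs)) (λ p → F (trues b) (proj₂ p) * (length xs ∸ trues b) !)
      ≡⟨ ∑-*ʳ (picks (x ∷ xs)) ((length xs ∸ trues b) !) (λ p → F (trues b) (proj₂ p)) ⟩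
    ∑ (picks (x ∷ xs)) (λ p → F (trues b) (proj₂ p)) * (length xs ∸ trues b) !
      ≡⟨ cong (_* (length xs ∸ trues b) !) (∑-picks-falling∑ (trues b) (x ∷ xs)) ⟩
    (suc (length xs) ∸ trues b) * F (trues b) (x ∷ xs) * (length xs ∸ trues b) !
      ≡⟨ cong (λ k → k * F (trues b) (x ∷ xs) * (length xs ∸ trues b) !) (+-∸-assoc 1 k≤) ⟩
    suc (length xs ∸ trues b) * F (trues b) (x ∷ xs) * (length xs ∸ trues b) !
      ≡⟨ lemma (suc (length xs ∸ trues b)) (F (trues b) (x ∷ xs)) _ ⟩
    F (trues b) (x ∷ xs) * (suc (length xs ∸ trues b)) !
      ≡⟨ cong (λ k → F (trues b) (x ∷ xs) * k !) (+-∸-assoc 1 k≤) ⟨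
    F (trues b) (x ∷ xs) * (suc (length xs) ∸ trues b) ! ∎
    where
    open ≡-Reasoning
    lemma : ∀ a b c → a * b * c ≡ b * (a * c)
    lemma = solve-∀
    k≤ : trues b ≤ length xs
    k≤ = ≤-trans (trues≤ b) h

  private
    Q : ℕ → List A → ℕ
    Q k xs = ∑ (picks xs) (λ p → g (proj₁ p) * g (proj₁ p) * F k (proj₂ p))

    F≤Q : ∀ k xs → F (2 + k) xs ≤ (length xs ∸ suc k) * Q k xs
    F≤Q k xs = *-cancelˡ-≤ 2 doubled
      where
      open ≤-Reasoning
      pq : (A → A → ℕ) → ℕ
      pq w = ∑ (picks xs) (λ p → ∑ (picks (proj₂ p)) (λ q → w (proj₁ p) (proj₁ q) * F k (proj₂ q)))
      pq-+ : ∀ v w → pq (λ a b → v a b + w a b) ≡ pq v + pq w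
      pq-+ v w = trans (∑-cong (picks xs) (λ p → trans
          (∑-cong (picks (proj₂ p)) (λ q → *-distribʳ-+ (F k (proj₂ q)) (v _ _) (w _ _)))
          (∑-+ (picks (proj₂ p)) _ _)))
        (∑-+ (picks xs) _ _)
      F≡ : F (2 + k) xs ≡ pq (λ a b → g a * g b)
      F≡ = ∑-cong (picks xs) (λ p → trans (sym (∑-*ˡ (picks (proj₂ p)) (g (proj₁ p)) _))
        (∑-cong (picks (proj₂ p)) (λ q → sym (*-assoc (g (proj₁ p)) (g (proj₁ q)) _))))
      Q≡ : pq (λ a _ → g a * g a) ≡ (length xs ∸ suc k) * Q k xs
      Q≡ = trans (∑-cong-All (All.map (λ {p} e → step p e) (picks-length xs)))
                 (∑-*ˡ (picks xs) (length xs ∸ suc k) _)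
        where
        lemma : ∀ a b c → a * (b * c) ≡ b * (a * c)
        lemma = solve-∀
        step : ∀ p → length xs ≡ suc (length (proj₂ p)) →
          ∑ (picks (proj₂ p)) (λ q → g (proj₁ p) * g (proj₁ p) * F k (proj₂ q)) ≡
          (length xs ∸ suc k) * (g (proj₁ p) * g (proj₁ p) * F k (proj₂ p))
        step p e rewrite e = trans (∑-*ˡ (picks (proj₂ p)) (g (proj₁ p) * g (proj₁ p)) _)
          (trans (cong (g (proj₁ p) * g (proj₁ p) *_) (∑-picks-falling∑ k (proj₂ p)))
            (lemma (g (proj₁ p) * g (proj₁ p)) (length (proj₂ p) ∸ k) _))
      doubled : 2 * F (2 + k) xs ≤ 2 * ((length xs ∸ suc k) * Q k xs)
      doubled = begin
        2 * F (2 + k) xs ≡⟨ cong (2 *_) F≡ ⟩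
        2 * pq (λ a b → g a * g b) ≡⟨ cong (pq (λ a b → g a * g b) +_) (+-identityʳ _) ⟩
        pq (λ a b → g a * g b) + pq (λ a b → g a * g b)
          ≡⟨ pq-+ (λ a b → g a * g b) (λ a b → g a * g b) ⟨
        pq (λ a b → g a * g b + g a * g b)
          ≤⟨ ∑-mono (picks xs) (λ p → ∑-mono (picks (proj₂ p)) (λ q →
               *-monoˡ-≤ (F k (proj₂ q)) (2ab≤a²+b² (g (proj₁ p)) (g (proj₁ q))))) ⟩
        pq (λ a b → g a * g a + g b * g b)
          ≡⟨ pq-+ (λ a b → g a * g a) (λ a b → g b * g b) ⟩
        pq (λ a b → g a * g a) + pq (λ a b → g b * g b)
          ≡⟨ cong (pq (λ a b → g a * g a) +_) (∑-picks-swap xs (λ a b l → g b * g b * F k l)) ⟩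
        pq (λ a b → g a * g a) + pq (λ a b → g a * g a)
          ≡⟨ cong₂ _+_ Q≡ Q≡ ⟩
        (length xs ∸ suc k) * Q k xs + (length xs ∸ suc k) * Q k xs
          ≡⟨ cong ((length xs ∸ suc k) * Q k xs +_) (+-identityʳ _) ⟨
        2 * ((length xs ∸ suc k) * Q k xs) ∎

  -- One step of Maclaurin's inequality. Replacing the factor g(x)g(y) of two positions by
  -- (g(x)² + g(y)²)/2 bounds the (k+2)-nd sum by the sum with a repeated position.
  falling∑-step : ∀ k (xs : List A) →
    length xs * F (suc k) xs ≤ (length xs ∸ k) * (∑ xs g * F k xs)
  falling∑-step zero xs = ≤-reflexive (cong (length xs *_) (trans
    (∑-cong (picks xs) (λ p → *-identityʳ _))
    (trans (∑-picks-proj₁ xs g) (sym (*-identityʳ _)))))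
  falling∑-step (suc k) [] = z≤n
  falling∑-step (suc k) xs@(x ∷ xs′) = begin
    suc ℓ * F (2 + k) xs
      ≡⟨ +-comm (F (2 + k) xs) _ ⟩
    ℓ * F (2 + k) xs + F (2 + k) xs
      ≤⟨ +-monoʳ-≤ (ℓ * F (2 + k) xs) (F≤Q k xs) ⟩
    ℓ * F (2 + k) xs + (ℓ ∸ k) * Q k xs
      ≡⟨ cong₂ _+_ (∑-*ˡ (picks xs) ℓ (λ p → g (proj₁ p) * F (suc k) (proj₂ p)))
           (∑-*ˡ (picks xs) (ℓ ∸ k) (λ p → g (proj₁ p) * g (proj₁ p) * F k (proj₂ p))) ⟨
    ∑ (picks xs) (λ p → ℓ * (g (proj₁ p) * F (suc k) (proj₂ p)))
      + ∑ (picks xs) (λ p → (ℓ ∸ k) * (g (proj₁ p) * g (proj₁ p) * F k (proj₂ p)))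
      ≡⟨ ∑-+ (picks xs) (λ p → ℓ * (g (proj₁ p) * F (suc k) (proj₂ p)))
           (λ p → (ℓ ∸ k) * (g (proj₁ p) * g (proj₁ p) * F k (proj₂ p))) ⟨
    ∑ (picks xs) (λ p → ℓ * (g (proj₁ p) * F (suc k) (proj₂ p))
      + (ℓ ∸ k) * (g (proj₁ p) * g (proj₁ p) * F k (proj₂ p)))
      ≤⟨ ∑-mono-All (All.map (λ {p} (e , e′) → step p e e′)
           (All.zip (picks-length xs , picks-∑ xs g))) ⟩
    ∑ (picks xs) (λ p → (ℓ ∸ k) * (S * (g (proj₁ p) * F k (proj₂ p))))
      ≡⟨ trans (∑-*ˡ (picks xs) (ℓ ∸ k) (λ p → S * (g (proj₁ p) * F k (proj₂ p))))
           (cong ((ℓ ∸ k) *_) (∑-*ˡ (picks xs) S (λ p → g (proj₁ p) * F k (proj₂ p)))) ⟩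
    (ℓ ∸ k) * (S * F (suc k) xs) ∎
    where
    open ≤-Reasoning
    ℓ = length xs′
    S = ∑ xs g
    lemma₁ : ∀ a b c → a * (b * c) ≡ b * (a * c)
    lemma₁ = solve-∀
    lemma₂ : ∀ y r s f → y * (r * (s * f)) + r * (y * y * f) ≡ r * ((y + s) * (y * f))
    lemma₂ = solve-∀
    step : ∀ p → length xs ≡ suc (length (proj₂ p)) → S ≡ g (proj₁ p) + ∑ (proj₂ p) g →
      ℓ * (g (proj₁ p) * F (suc k) (proj₂ p)) + (ℓ ∸ k) * (g (proj₁ p) * g (proj₁ p) * F k (proj₂ p))
      ≤ (ℓ ∸ k) * (S * (g (proj₁ p) * F k (proj₂ p)))
    step p e e′ = begin
      ℓ * (y * F (suc k) ys) + (ℓ ∸ k) * (y * y * F k ys)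
        ≡⟨ cong (_+ (ℓ ∸ k) * (y * y * F k ys)) (lemma₁ ℓ y _) ⟩
      y * (ℓ * F (suc k) ys) + (ℓ ∸ k) * (y * y * F k ys)
        ≤⟨ +-monoˡ-≤ ((ℓ ∸ k) * (y * y * F k ys)) (*-monoʳ-≤ y
             (subst (λ l → l * F (suc k) ys ≤ (l ∸ k) * (∑ ys g * F k ys)) (sym (suc-injective e))
               (falling∑-step k ys))) ⟩
      y * ((ℓ ∸ k) * (∑ ys g * F k ys)) + (ℓ ∸ k) * (y * y * F k ys)
        ≡⟨ lemma₂ y (ℓ ∸ k) (∑ ys g) (F k ys) ⟩
      (ℓ ∸ k) * ((y + ∑ ys g) * (y * F k ys))
        ≡⟨ cong (λ z → (ℓ ∸ k) * (z * (y * F k ys))) e′ ⟨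
      (ℓ ∸ k) * (S * (y * F k ys)) ∎
      where
      y = g (proj₁ p)
      ys = proj₂ p

  falling∑-bound : ∀ k (xs : List A) → k ≤ length xs →
    F k xs * (length xs ∸ k) ! * length xs ^ k ≤ length xs ! * ∑ xs g ^ k
  falling∑-bound zero    xs _ = ≤-reflexive (cong (_* 1) (*-identityˡ (length xs !)))
  falling∑-bound (suc k) xs h = begin
    F (suc k) xs * (N ∸ suc k) ! * (N * N ^ k)
      ≡⟨ lemma₁ (F (suc k) xs) ((N ∸ suc k) !) N (N ^ k) ⟩
    N * F (suc k) xs * ((N ∸ suc k) ! * N ^ k)
      ≤⟨ *-monoˡ-≤ ((N ∸ suc k) ! * N ^ k) (falling∑-step k xs) ⟩
    (N ∸ k) * (S * F k xs) * ((N ∸ suc k) ! * N ^ k)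
      ≡⟨ lemma₂ (N ∸ k) S (F k xs) ((N ∸ suc k) !) (N ^ k) ⟩
    S * (F k xs * ((N ∸ k) * (N ∸ suc k) !) * N ^ k)
      ≡⟨ cong (λ z → S * (F k xs * z * N ^ k)) fact ⟩
    S * (F k xs * (N ∸ k) ! * N ^ k)
      ≤⟨ *-monoʳ-≤ S (falling∑-bound k xs (<⇒≤ h)) ⟩
    S * (N ! * S ^ k)
      ≡⟨ lemma₃ S (N !) (S ^ k) ⟩
    N ! * (S * S ^ k) ∎
    where
    open ≤-Reasoning
    N = length xs
    S = ∑ xs g
    fact : (N ∸ k) * (N ∸ suc k) ! ≡ (N ∸ k) !
    fact rewrite ∸-suc h = refl
    lemma₁ : ∀ a b c d → a * b * (c * d) ≡ c * a * (b * d)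
    lemma₁ = solve-∀
    lemma₂ : ∀ a s f c d → a * (s * f) * (c * d) ≡ s * (f * (a * c) * d)
    lemma₂ = solve-∀
    lemma₃ : ∀ s n t → s * (n * t) ≡ n * (s * t)
    lemma₃ = solve-∀

  -- Drawing without replacement is treated as if it were with replacement, so that a power of the
  -- mean of `g` replaces falling factorials in upper bounds. The mask `b` is arbitrary and may be
  -- computed from the other ordering.
  maclaurin : ∀ (b : List Bool) (xs : List A) → length b ≤ length xs →
    ∑ (perms xs) (λ σ → ∏ (select b σ) g) * length xs ^ trues b ≤ length xs ! * ∑ xs g ^ trues b
  maclaurin b xs h rewrite ∑-perms-select b xs h = falling∑-bound (trues b) xs (≤-trans (trues≤ b) h)

insertAll-↭ : ∀ {A : Set} (x : A) ys → All (_↭ x ∷ ys) (insertAll x ys)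
insertAll-↭ x []       = ↭-refl ∷ []
insertAll-↭ x (y ∷ ys) = ↭-refl ∷ All.map⁺ (All.map
  (λ p → ↭-trans (Perm.prep y p) (Perm.swap y x ↭-refl)) (insertAll-↭ x ys))

perms-↭ : ∀ {A : Set} (xs : List A) → All (_↭ xs) (perms xs)
perms-↭ []       = ↭-refl ∷ []
perms-↭ (x ∷ xs) = All.concat⁺ (All.map⁺ (All.map
  (λ {σ} p → All.map (λ q → ↭-trans q (Perm.prep x p)) (insertAll-↭ x σ)) (perms-↭ xs)))

∑-↭ : ∀ {A : Set} {xs ys : List A} (f : A → ℕ) → xs ↭ ys → ∑ xs f ≡ ∑ ys f
∑-↭ f Perm.refl          = refl
∑-↭ f (Perm.prep x p)    = cong (f x +_) (∑-↭ f p)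
∑-↭ f (Perm.swap x y p) = trans (cong (λ z → f x + (f y + z)) (∑-↭ f p)) (lemma (f x) (f y) _)
  where
  lemma : ∀ a b c → a + (b + c) ≡ b + (a + c)
  lemma = solve-∀
∑-↭ f (Perm.trans p q)   = trans (∑-↭ f p) (∑-↭ f q)

length≡∑ : ∀ {A : Set} (xs : List A) → length xs ≡ ∑ xs (λ _ → 1)
length≡∑ xs = sym (trans (∑-const xs 1) (*-identityʳ _))

perms-length : ∀ {A : Set} (xs : List A) → All (λ σ → length σ ≡ length xs) (perms xs)
perms-length xs = All.map (λ {σ} p → trans (length≡∑ σ) (trans (∑-↭ _ p) (sym (length≡∑ xs)))) (perms-↭ xs)

length-perms : ∀ {A : Set} (xs : List A) → length (perms xs) ≡ length xs !
length-perms xs = trans (length≡∑ (perms xs)) (trans (∑-perms-const xs 1) (*-identityʳ _))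

length-select : ∀ {A : Set} (b : List Bool) (xs : List A) → length b ≤ length xs →
  length (select b xs) ≡ trues b
length-select []          xs       _       = refl
length-select (true ∷ b)  (x ∷ xs) (s≤s h) = cong suc (length-select b xs h)
length-select (false ∷ b) (x ∷ xs) (s≤s h) = length-select b xs h

module _ {A : Set} where

  ∏-𝟙 : ∀ (h : A → Bool) xs → ∏ xs (𝟙 ∘ h) ≡ 𝟙 (all h xs)
  ∏-𝟙 h []       = refl
  ∏-𝟙 h (x ∷ xs) = trans (cong (𝟙 (h x) *_) (∏-𝟙 h xs)) (sym (𝟙-∧ (h x) _))

  ^∑≡∏ : ∀ (h : A → Bool) z xs → (1 + z) ^ ∑ xs (𝟙 ∘ h) ≡ ∏ xs (λ x → 1 + z * 𝟙 (h x))
  ^∑≡∏ h z []       = refl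
  ^∑≡∏ h z (x ∷ xs) with h x
  ... | true  = cong₂ _*_ (cong suc (sym (*-identityʳ z))) (^∑≡∏ h z xs)
  ... | false = trans (^∑≡∏ h z xs) (sym (trans
    (cong (λ k → (1 + k) * ∏ xs (λ x → 1 + z * 𝟙 (h x))) (*-zeroʳ z)) (*-identityˡ _)))

  ∑-1+z𝟙 : ∀ (h : A → Bool) z xs → ∑ xs (λ x → 1 + z * 𝟙 (h x)) ≡ length xs + z * ∑ xs (𝟙 ∘ h)
  ∑-1+z𝟙 h z xs = trans (∑-+ xs (λ _ → 1) _) (cong₂ _+_ (sym (length≡∑ xs)) (∑-*ˡ xs z _))

  ∑-not : ∀ (h : A → Bool) xs → ∑ xs (𝟙 ∘ h) + ∑ xs (𝟙 ∘ not ∘ h) ≡ length xs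
  ∑-not h xs = trans (sym (∑-+ xs _ _)) (trans (∑-cong xs (λ x → lemma (h x))) (sym (length≡∑ xs)))
    where
    lemma : ∀ b → 𝟙 b + 𝟙 (not b) ≡ 1
    lemma true  = refl
    lemma false = refl

module _ {A : Set} (xs : List A) (b : List Bool) (b≤ : length b ≤ length xs) (h : A → Bool) where

  private
    N k H : ℕ
    N = length xs
    k = trues b
    H = ∑ xs (𝟙 ∘ h)
    open ≤-Reasoning

  avoid-count : ∑ (perms xs) (λ σ → 𝟙 (all h (select b σ))) * N ^ k ≤ N ! * H ^ k
  avoid-count = subst (λ s → s * N ^ k ≤ N ! * H ^ k)
    (∑-cong (perms xs) (λ σ → ∏-𝟙 h (select b σ))) (maclaurin (𝟙 ∘ h) b xs b≤)

  -- Exponential moment: `1 + z` to the number of hits is a product over the positions, to which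
  -- `maclaurin` applies. Each application chooses its own tilt `z`.
  upper-tail : ∀ z t →
    (1 + z) ^ t * ∑ (perms xs) (λ σ → 𝟙 (t ≤ᵇ ∑ (select b σ) (𝟙 ∘ h))) * N ^ k ≤ N ! * (N + z * H) ^ k
  upper-tail z t = begin
    (1 + z) ^ t * ∑ (perms xs) (λ σ → 𝟙 (t ≤ᵇ ∑ (select b σ) (𝟙 ∘ h))) * N ^ k
      ≡⟨ cong (_* N ^ k) (∑-*ˡ (perms xs) ((1 + z) ^ t) _) ⟨
    ∑ (perms xs) (λ σ → (1 + z) ^ t * 𝟙 (t ≤ᵇ ∑ (select b σ) (𝟙 ∘ h))) * N ^ k
      ≤⟨ *-monoˡ-≤ (N ^ k) (∑-mono (perms xs) (λ σ → step (select b σ))) ⟩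
    ∑ (perms xs) (λ σ → ∏ (select b σ) (λ x → 1 + z * 𝟙 (h x))) * N ^ k
      ≤⟨ maclaurin _ b xs b≤ ⟩
    N ! * ∑ xs (λ x → 1 + z * 𝟙 (h x)) ^ k
      ≡⟨ cong (λ s → N ! * s ^ k) (∑-1+z𝟙 h z xs) ⟩
    N ! * (N + z * H) ^ k ∎
    where
    step : ∀ ys → (1 + z) ^ t * 𝟙 (t ≤ᵇ ∑ ys (𝟙 ∘ h)) ≤ ∏ ys (λ x → 1 + z * 𝟙 (h x))
    step ys with t ≤ᵇ ∑ ys (𝟙 ∘ h) in eq
    ... | false = ≤-trans (≤-reflexive (*-zeroʳ ((1 + z) ^ t))) z≤n
    ... | true  = subst₂ _≤_ (sym (*-identityʳ _)) (^∑≡∏ h z ys) (^-monoʳ-≤ (1 + z) (≤ᵇ-true⁻ t _ eq))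

  -- The same moment for the misses: at most `t` hits at `k` positions mean at least `k ∸ t` misses.
  -- Having `(1 + z) ^ t` on the right avoids the subtraction.
  lower-tail : ∀ z t →
    (1 + z) ^ k * ∑ (perms xs) (λ σ → 𝟙 (∑ (select b σ) (𝟙 ∘ h) ≤ᵇ t)) * N ^ k
      ≤ (1 + z) ^ t * (N ! * (N + z * ∑ xs (𝟙 ∘ not ∘ h)) ^ k)
  lower-tail z t = begin
    (1 + z) ^ k * ∑ (perms xs) (λ σ → 𝟙 (∑ (select b σ) (𝟙 ∘ h) ≤ᵇ t)) * N ^ k
      ≡⟨ cong (_* N ^ k) (∑-*ˡ (perms xs) ((1 + z) ^ k) _) ⟨
    ∑ (perms xs) (λ σ → (1 + z) ^ k * 𝟙 (∑ (select b σ) (𝟙 ∘ h) ≤ᵇ t)) * N ^ k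
      ≤⟨ *-monoˡ-≤ (N ^ k) (∑-mono-All (All.map (λ {σ} e → step (select b σ)
           (length-select b σ (subst (length b ≤_) (sym e) b≤))) (perms-length xs))) ⟩
    ∑ (perms xs) (λ σ → (1 + z) ^ t * ∏ (select b σ) (λ x → 1 + z * 𝟙 (not (h x)))) * N ^ k
      ≡⟨ cong (_* N ^ k) (∑-*ˡ (perms xs) ((1 + z) ^ t) _) ⟩
    (1 + z) ^ t * ∑ (perms xs) (λ σ → ∏ (select b σ) (λ x → 1 + z * 𝟙 (not (h x)))) * N ^ k
      ≡⟨ *-assoc ((1 + z) ^ t) _ _ ⟩
    (1 + z) ^ t * (∑ (perms xs) (λ σ → ∏ (select b σ) (λ x → 1 + z * 𝟙 (not (h x)))) * N ^ k)
      ≤⟨ *-monoʳ-≤ ((1 + z) ^ t) (maclaurin _ b xs b≤) ⟩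
    (1 + z) ^ t * (N ! * ∑ xs (λ x → 1 + z * 𝟙 (not (h x))) ^ k)
      ≡⟨ cong (λ s → (1 + z) ^ t * (N ! * s ^ k)) (∑-1+z𝟙 (not ∘ h) z xs) ⟩
    (1 + z) ^ t * (N ! * (N + z * ∑ xs (𝟙 ∘ not ∘ h)) ^ k) ∎
    where
    step : ∀ ys → length ys ≡ k → (1 + z) ^ k * 𝟙 (∑ ys (𝟙 ∘ h) ≤ᵇ t)
      ≤ (1 + z) ^ t * ∏ ys (λ x → 1 + z * 𝟙 (not (h x)))
    step ys e with ∑ ys (𝟙 ∘ h) ≤ᵇ t in eq
    ... | false = ≤-trans (≤-reflexive (*-zeroʳ ((1 + z) ^ k))) z≤n
    ... | true  = begin
      (1 + z) ^ k * 1 ≡⟨ *-identityʳ _ ⟩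
      (1 + z) ^ k ≡⟨ cong ((1 + z) ^_) (trans (sym e) (sym (∑-not h ys))) ⟩
      (1 + z) ^ (∑ ys (𝟙 ∘ h) + ∑ ys (𝟙 ∘ not ∘ h)) ≡⟨ ^-distribˡ-+-* (1 + z) (∑ ys (𝟙 ∘ h)) _ ⟩
      (1 + z) ^ ∑ ys (𝟙 ∘ h) * (1 + z) ^ ∑ ys (𝟙 ∘ not ∘ h)
        ≤⟨ *-mono-≤ (^-monoʳ-≤ (1 + z) (≤ᵇ-true⁻ (∑ ys (𝟙 ∘ h)) t eq)) (≤-reflexive (^∑≡∏ (not ∘ h) z ys)) ⟩
      (1 + z) ^ t * ∏ ys (λ x → 1 + z * 𝟙 (not (h x))) ∎

-- Exponential estimates

-- The inequalities (1+b/a)ⁿ ≥ 1+nb/a and (1-b/(c+b))ⁿ ≥ 1-nb/(c+b), without division.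
bernoulli⁺ : ∀ a b n → a ^ n * (a + n * b) ≤ (a + b) ^ n * a
bernoulli⁺ a b zero    = ≤-reflexive (cong (1 *_) (+-identityʳ a))
bernoulli⁺ a b (suc n) = begin
  a * a ^ n * (a + (b + n * b))   ≤⟨ m≤m+n _ (a ^ n * (n * b * b)) ⟩
  a * a ^ n * (a + (b + n * b)) + a ^ n * (n * b * b) ≡⟨ lemma a b (a ^ n) n ⟩
  (a + b) * (a ^ n * (a + n * b)) ≤⟨ *-monoʳ-≤ (a + b) (bernoulli⁺ a b n) ⟩
  (a + b) * ((a + b) ^ n * a)     ≡⟨ *-assoc (a + b) _ a ⟨
  (a + b) * (a + b) ^ n * a       ∎
  where
  open ≤-Reasoning
  lemma : ∀ a b c n → a * c * (a + (b + n * b)) + c * (n * b * b) ≡ (a + b) * (c * (a + n * b))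
  lemma = solve-∀

bernoulli⁻ : ∀ c b n → (c + b) ^ n * (c + b) ≤ c ^ n * (c + b) + n * b * (c + b) ^ n
bernoulli⁻ c b zero    = m≤m+n _ _
bernoulli⁻ c b (suc n) = begin
  (c + b) * (c + b) ^ n * (c + b)
    ≡⟨ lemma₁ c b ((c + b) ^ n) ⟩
  c * ((c + b) ^ n * (c + b)) + b * ((c + b) * (c + b) ^ n)
    ≤⟨ +-monoˡ-≤ _ (*-monoʳ-≤ c (bernoulli⁻ c b n)) ⟩
  c * (c ^ n * (c + b) + n * b * (c + b) ^ n) + b * ((c + b) * (c + b) ^ n)
    ≤⟨ m≤m+n _ (n * b * b * (c + b) ^ n) ⟩
  c * (c ^ n * (c + b) + n * b * (c + b) ^ n) + b * ((c + b) * (c + b) ^ n) + n * b * b * (c + b) ^ n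
    ≡⟨ lemma₂ c b n (c ^ n) ((c + b) ^ n) ⟩
  c * c ^ n * (c + b) + (b + n * b) * ((c + b) * (c + b) ^ n) ∎
  where
  open ≤-Reasoning
  lemma₁ : ∀ c b p → (c + b) * p * (c + b) ≡ c * (p * (c + b)) + b * ((c + b) * p)
  lemma₁ = solve-∀
  lemma₂ : ∀ c b n x p → c * (x * (c + b) + n * b * p) + b * ((c + b) * p) + n * b * b * p
    ≡ c * x * (c + b) + (b + n * b) * ((c + b) * p)
  lemma₂ = solve-∀

bernoulli-suc : ∀ n h → suc n ^ h * suc n ≤ n ^ h * suc n + h * suc n ^ h
bernoulli-suc n h = subst₂ _≤_ (cong (λ k → k ^ h * k) (+-comm n 1))
  (cong₂ (λ k l → n ^ h * k + l * k ^ h) (+-comm n 1) (*-identityʳ h)) (bernoulli⁻ n 1 h)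

-- `(1 - 1/(n+1))^h ≥ 1 - h/(n+1) ≥ 1/2` by `bernoulli-suc`.
^-half : ∀ n h → h + h ≤ suc n → suc n ^ h ≤ 2 * n ^ h
^-half n h hh = *-cancelʳ-≤ _ _ (suc n) (+-cancelʳ-≤ (p * suc n) _ _ (begin
  p * suc n + p * suc n             ≤⟨ +-mono-≤ (bernoulli-suc n h) (bernoulli-suc n h) ⟩
  x * suc n + h * p + (x * suc n + h * p) ≡⟨ lemma x p h (suc n) ⟩
  2 * x * suc n + p * (h + h)       ≤⟨ +-monoʳ-≤ (2 * x * suc n) (*-monoʳ-≤ p hh) ⟩
  2 * x * suc n + p * suc n         ∎))
  where
  open ≤-Reasoning
  p = suc n ^ h
  x = n ^ h
  lemma : ∀ x p h s → x * s + h * p + (x * s + h * p) ≡ 2 * x * s + p * (h + h)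
  lemma = solve-∀

[1+n]^n≤4n^n : ∀ n → suc n ^ n ≤ 4 * n ^ n
[1+n]^n≤4n^n n = begin
  suc n ^ n ≡⟨ cong (suc n ^_) (sym (⌊n/2⌋+⌈n/2⌉≡n n)) ⟩
  suc n ^ (⌊n/2⌋ + ⌈n/2⌉) ≡⟨ ^-distribˡ-+-* (suc n) ⌊n/2⌋ ⌈n/2⌉ ⟩
  suc n ^ ⌊n/2⌋ * suc n ^ ⌈n/2⌉ ≤⟨ *-mono-≤ (^-half n ⌊n/2⌋ low) (^-half n ⌈n/2⌉ high) ⟩
  2 * n ^ ⌊n/2⌋ * (2 * n ^ ⌈n/2⌉) ≡⟨ lemma (n ^ ⌊n/2⌋) (n ^ ⌈n/2⌉) ⟩
  4 * (n ^ ⌊n/2⌋ * n ^ ⌈n/2⌉) ≡⟨ cong (4 *_) (sym (^-distribˡ-+-* n ⌊n/2⌋ ⌈n/2⌉)) ⟩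
  4 * n ^ (⌊n/2⌋ + ⌈n/2⌉) ≡⟨ cong (λ k → 4 * n ^ k) (⌊n/2⌋+⌈n/2⌉≡n n) ⟩
  4 * n ^ n ∎
  where
  open ≤-Reasoning
  ⌊n/2⌋ = ℕ.⌊ n /2⌋
  ⌈n/2⌉ = ℕ.⌈ n /2⌉
  lemma : ∀ a b → 2 * a * (2 * b) ≡ 4 * (a * b)
  lemma = solve-∀
  high : ⌈n/2⌉ + ⌈n/2⌉ ≤ suc n
  high = ≤-trans (+-monoʳ-≤ ⌈n/2⌉ (⌊n/2⌋≤⌈n/2⌉ (suc n))) (≤-reflexive (⌊n/2⌋+⌈n/2⌉≡n (suc n)))
  low : ⌊n/2⌋ + ⌊n/2⌋ ≤ suc n
  low = ≤-trans (+-mono-≤ (⌊n/2⌋≤⌈n/2⌉ n) (⌊n/2⌋≤⌈n/2⌉ n)) high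

[m*n]^k : ∀ m n k → (m * n) ^ k ≡ m ^ k * n ^ k
[m*n]^k m n zero    = refl
[m*n]^k m n (suc k) rewrite [m*n]^k m n k = lemma m n (m ^ k) (n ^ k)
  where
  lemma : ∀ a b c d → a * b * (c * d) ≡ a * c * (b * d)
  lemma = solve-∀

^-comm : ∀ x i j → (x ^ i) ^ j ≡ (x ^ j) ^ i
^-comm x i j = trans (^-*-assoc x i j) (trans (cong (x ^_) (*-comm i j)) (sym (^-*-assoc x j i)))

^>0 : ∀ m k → 0 < m → 0 < m ^ k
^>0 m zero    _ = s≤s z≤n
^>0 m (suc k) h = *-mono-≤ h (^>0 m k h)

*-cancelʳ-≤′ : ∀ {a b} c → 0 < c → a * c ≤ b * c → a ≤ b
*-cancelʳ-≤′ {a} {b} (suc c) _ h = *-cancelʳ-≤ a b (suc c) h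

-- `1 + a/m ≤ (1 + 1/m)^a` by Bernoulli, and the `m`-th power of `1 + 1/m` is at most 4.
[m+a]^m≤4^a*m^m : ∀ m a → (m + a) ^ m ≤ 4 ^ a * m ^ m
[m+a]^m≤4^a*m^m zero      a = *-mono-≤ (^>0 4 a (s≤s z≤n)) (≤-refl {1})
[m+a]^m≤4^a*m^m m@(suc _) a = *-cancelʳ-≤′ ((m ^ a) ^ m) (^>0 (m ^ a) m (^>0 m a (s≤s z≤n))) (begin
  (m + a) ^ m * (m ^ a) ^ m  ≡⟨ trans (*-comm ((m + a) ^ m) _) (sym ([m*n]^k (m ^ a) (m + a) m)) ⟩
  (m ^ a * (m + a)) ^ m      ≤⟨ ^-monoˡ-≤ m (subst₂ _≤_ (cong (λ k → m ^ a * (m + k)) (*-identityʳ a))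
                                  (cong (λ k → k ^ a * m) (+-comm m 1)) (bernoulli⁺ m 1 a)) ⟩
  (suc m ^ a * m) ^ m        ≡⟨ [m*n]^k (suc m ^ a) m m ⟩
  (suc m ^ a) ^ m * m ^ m    ≡⟨ cong (_* m ^ m) (^-comm (suc m) a m) ⟩
  (suc m ^ m) ^ a * m ^ m    ≤⟨ *-monoˡ-≤ (m ^ m) (^-monoˡ-≤ a ([1+n]^n≤4n^n m)) ⟩
  (4 * m ^ m) ^ a * m ^ m    ≡⟨ cong (_* m ^ m) ([m*n]^k 4 (m ^ m) a) ⟩
  4 ^ a * (m ^ m) ^ a * m ^ m ≡⟨ lemma (4 ^ a) ((m ^ m) ^ a) (m ^ m) ⟩
  4 ^ a * m ^ m * (m ^ m) ^ a ≡⟨ cong (4 ^ a * m ^ m *_) (^-comm m m a) ⟩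
  4 ^ a * m ^ m * (m ^ a) ^ m ∎)
  where
  open ≤-Reasoning
  lemma : ∀ x y z → x * y * z ≡ x * z * y
  lemma = solve-∀

-- The substitute for `(1 + x/N)^m ≤ e^(xm/N)`, with 4 in place of e and an integer bound `a` on the
-- exponent.
exp-bound : ∀ N x m a → x * m ≤ a * N → (N + x) ^ m ≤ 4 ^ a * N ^ m
exp-bound N x zero      a h = *-mono-≤ (^>0 4 a (s≤s z≤n)) (≤-refl {1})
exp-bound N x m@(suc _) a h = *-cancelʳ-≤′ (m ^ m) (^>0 m m (s≤s z≤n)) (begin
  (N + x) ^ m * m ^ m   ≡⟨ [m*n]^k (N + x) m m ⟨
  ((N + x) * m) ^ m     ≤⟨ ^-monoˡ-≤ m step ⟩
  (N * (m + a)) ^ m     ≡⟨ [m*n]^k N (m + a) m ⟩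
  N ^ m * (m + a) ^ m   ≤⟨ *-monoʳ-≤ (N ^ m) ([m+a]^m≤4^a*m^m m a) ⟩
  N ^ m * (4 ^ a * m ^ m) ≡⟨ lemma (N ^ m) (4 ^ a) (m ^ m) ⟩
  4 ^ a * N ^ m * m ^ m ∎)
  where
  open ≤-Reasoning
  step : (N + x) * m ≤ N * (m + a)
  step = begin
    (N + x) * m     ≡⟨ *-distribʳ-+ m N x ⟩
    N * m + x * m   ≤⟨ +-monoʳ-≤ (N * m) h ⟩
    N * m + a * N   ≡⟨ cong (N * m +_) (*-comm a N) ⟩
    N * m + N * a   ≡⟨ *-distribˡ-+ N m a ⟨
    N * (m + a)     ∎
  lemma : ∀ x y z → x * (y * z) ≡ y * x * z
  lemma = solve-∀

exp-bound-suc : ∀ N m a → m ≤ a * N → suc N ^ m ≤ 4 ^ a * N ^ m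
exp-bound-suc N m a h = subst (λ x → x ^ m ≤ 4 ^ a * N ^ m) (+-comm N 1)
  (exp-bound N 1 m a (≤-trans (≤-reflexive (*-identityˡ m)) h))

2*n^[1+n]≤[1+n]^[1+n] : ∀ n → 2 * n ^ suc n ≤ suc n ^ suc n
2*n^[1+n]≤[1+n]^[1+n] zero      = z≤n
2*n^[1+n]≤[1+n]^[1+n] n@(suc _) = *-cancelʳ-≤′ n (s≤s z≤n) (begin
  2 * n ^ suc n * n               ≡⟨ lemma (n ^ suc n) n ⟩
  n ^ suc n * (n + n)             ≤⟨ *-monoʳ-≤ (n ^ suc n) (+-monoʳ-≤ n (≤-trans (n≤1+n n) (≤-reflexive (sym (*-identityʳ (suc n)))))) ⟩
  n ^ suc n * (n + suc n * 1)     ≤⟨ bernoulli⁺ n 1 (suc n) ⟩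
  (n + 1) ^ suc n * n             ≡⟨ cong (λ k → k ^ suc n * n) (+-comm n 1) ⟩
  suc n ^ suc n * n               ∎)
  where
  open ≤-Reasoning
  lemma : ∀ a n → 2 * a * n ≡ a * (n + n)
  lemma = solve-∀

n<2^n : ∀ n → n < 2 ^ n
n<2^n zero    = s≤s z≤n
n<2^n (suc n) = begin-strict
  suc n             <⟨ s≤s (n<2^n n) ⟩
  suc (2 ^ n)       ≡⟨ +-comm 1 (2 ^ n) ⟩
  2 ^ n + 1         ≤⟨ +-monoʳ-≤ (2 ^ n) (^>0 2 n (s≤s z≤n)) ⟩
  2 ^ n + 2 ^ n     ≡⟨ cong (2 ^ n +_) (sym (+-identityʳ (2 ^ n))) ⟩
  2 ^ suc n         ∎
  where open ≤-Reasoning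

-- Writing s ≤ 2t+1, both factors of 2^(2t) absorb a bounded power of t.
poly≤2^ : ∀ c j → ∃[ s₀ ] (∀ s → s₀ ≤ s → c * s ^ j ≤ 2 ^ s)
poly≤2^ c zero    = c * 1 , λ s h → ≤-trans h (<⇒≤ (n<2^n s))
poly≤2^ c (suc j) with poly≤2^ (c * 3 ^ suc j) j
... | t₀ , H = suc (t₀ + t₀ + 1) , bound
  where
  open ≤-Reasoning
  bound : ∀ s → suc (t₀ + t₀ + 1) ≤ s → c * s ^ suc j ≤ 2 ^ s
  bound s h = begin
    c * s ^ suc j             ≤⟨ *-monoʳ-≤ c (^-monoˡ-≤ (suc j) s≤3t) ⟩
    c * (3 * t) ^ suc j       ≡⟨ cong (c *_) ([m*n]^k 3 t (suc j)) ⟩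
    c * (3 ^ suc j * (t * t ^ j)) ≡⟨ lemma c (3 ^ suc j) t (t ^ j) ⟩
    t * (c * 3 ^ suc j * t ^ j) ≤⟨ *-mono-≤ (<⇒≤ (n<2^n t)) (H t t₀≤t) ⟩
    2 ^ t * 2 ^ t             ≡⟨ ^-distribˡ-+-* 2 t t ⟨
    2 ^ (t + t)               ≤⟨ ^-monoʳ-≤ 2 2t≤s ⟩
    2 ^ s                     ∎
    where
    t = ℕ.⌊ s /2⌋
    2t≤s : t + t ≤ s
    2t≤s = ≤-trans (+-monoʳ-≤ t (⌊n/2⌋≤⌈n/2⌉ s)) (≤-reflexive (⌊n/2⌋+⌈n/2⌉≡n s))
    s≤2t+1 : s ≤ t + suc t
    s≤2t+1 = ≤-trans (≤-reflexive (sym (⌊n/2⌋+⌈n/2⌉≡n s))) (+-monoʳ-≤ t (⌊n/2⌋-mono (n≤1+n (suc s))))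
    t₀≤t : t₀ ≤ t
    t₀≤t = ≤-pred (*-cancelˡ-< 2 t₀ (suc t) (begin-strict
      2 * t₀        ≡⟨ cong (t₀ +_) (+-identityʳ t₀) ⟩
      t₀ + t₀       <⟨ s≤s (m≤m+n (t₀ + t₀) 1) ⟩
      suc (t₀ + t₀ + 1) ≤⟨ h ⟩
      s             ≤⟨ s≤2t+1 ⟩
      t + suc t     ≤⟨ +-mono-≤ (n≤1+n t) (≤-reflexive (sym (+-identityʳ (suc t)))) ⟩
      2 * suc t     ∎))
    1≤t : 1 ≤ t
    1≤t = ⌊n/2⌋-mono {2} {s} (≤-trans (s≤s (m≤n+m 1 (t₀ + t₀))) h)
    s≤3t : s ≤ 3 * t
    s≤3t = ≤-trans s≤2t+1 (subst (t + suc t ≤_) (lemma′ t) (+-monoʳ-≤ t (+-monoˡ-≤ t 1≤t)))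
      where
      lemma′ : ∀ t → t + (t + t) ≡ 3 * t
      lemma′ = solve-∀
    lemma : ∀ c p t q → c * (p * (t * q)) ≡ t * (c * p * q)
    lemma = solve-∀

-- Counting edges and vertex sets

∑-tabulate : ∀ {A : Set} n (g : Fin n → A) f → ∑ (tabulate g) f ≡ ∑ (allFin n) (f ∘ g)
∑-tabulate zero    g f = refl
∑-tabulate (suc n) g f = cong (f (g Fin.zero) +_)
  (trans (∑-tabulate n (g ∘ Fin.suc) f) (sym (∑-tabulate n Fin.suc (f ∘ g))))

∑-allFin-suc : ∀ n (f : Fin (suc n) → ℕ) →
  ∑ (allFin (suc n)) f ≡ f Fin.zero + ∑ (allFin n) (f ∘ Fin.suc)
∑-allFin-suc n f = cong (f Fin.zero +_) (∑-tabulate n Fin.suc f)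

length-allFin : ∀ n → length (allFin n) ≡ n
length-allFin n = List.length-tabulate {n = n} id

==-true : ∀ {n} {i j : Fin n} → i ≡ j → (i == j) ≡ true
==-true {i = i} {j} e with i ≟F j
... | yes _ = refl
... | no ¬e = contradiction e ¬e

==-true⁻ : ∀ {n} {i j : Fin n} → (i == j) ≡ true → i ≡ j
==-true⁻ {i = i} {j} h with i ≟F j
... | yes e = e

==-false : ∀ {n} {i j : Fin n} → ¬ i ≡ j → (i == j) ≡ false
==-false {i = i} {j} e with i ≟F j
... | yes p = contradiction p e
... | no _  = refl

==-suc : ∀ {n} (i j : Fin n) → (Fin.suc i == Fin.suc j) ≡ (i == j)
==-suc i j with i ≟F j
... | yes _ = refl
... | no _  = refl

∑-single : ∀ {n} (i : Fin n) (g : Fin n → ℕ) → ∑ (allFin n) (λ j → 𝟙 (i == j) * g j) ≡ g i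
∑-single {suc n} Fin.zero g = trans (∑-allFin-suc n (λ j → 𝟙 (Fin.zero == j) * g j))
  (trans (cong₂ _+_ (+-identityʳ (g Fin.zero)) (∑-zero (allFin n))) (+-identityʳ (g Fin.zero)))
∑-single {suc n} (Fin.suc i) g = trans (∑-allFin-suc n (λ j → 𝟙 (Fin.suc i == j) * g j))
  (trans (∑-cong (allFin n) (λ j → cong (λ b → 𝟙 b * g (Fin.suc j)) (==-suc i j)))
         (∑-single i (g ∘ Fin.suc)))

card : ∀ {n} → (Fin n → Bool) → ℕ
card {n} χ = ∑ (allFin n) (𝟙 ∘ χ)

card-not : ∀ {n} (χ : Fin n → Bool) → card χ + card (not ∘ χ) ≡ n
card-not {n} χ = trans (∑-not χ (allFin n)) (length-allFin n)

card-mono : ∀ {n} {χ ψ : Fin n → Bool} → (∀ i → χ i ≡ true → ψ i ≡ true) → card χ ≤ card ψ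
card-mono {n} h = ∑-mono (allFin n) (λ i → 𝟙-mono (h i))

card-single : ∀ {n} (i : Fin n) → card (i ==_) ≡ 1
card-single {n} i = trans (∑-cong (allFin n) (λ j → sym (*-identityʳ _))) (∑-single i (λ _ → 1))

∈-allFin : ∀ {n} (i : Fin n) → i ∈ allFin n
∈-allFin i = Mem.∈-allFin i

card-true : ∀ n → card {n} (λ _ → true) ≡ n
card-true n = trans (sym (length≡∑ (allFin n))) (length-allFin n)

edge? : ∀ {n} → Fin n → Fin n → Bool
edge? i j = isYes (i Fin.<? j)

∑-edgesK : ∀ n (f : Edge n → ℕ) →
  ∑ (edgesK n) f ≡ ∑ (allFin n) (λ i → ∑ (allFin n) (λ j → 𝟙 (edge? i j) * f (i , j)))
∑-edgesK n f = trans (∑-concatMap _ (allFin n) f)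
  (∑-cong (allFin n) (λ i → trans (∑-concatMap _ (allFin n) f)
    (∑-cong (allFin n) (λ j → step i j))))
  where
  step : ∀ i j → ∑ (if edge? i j then (i , j) ∷ [] else []) f ≡ 𝟙 (edge? i j) * f (i , j)
  step i j with edge? i j
  ... | true  = refl
  ... | false = refl

edgesK-irrefl : ∀ n → All (λ e → ¬ proj₁ e ≡ proj₂ e) (edgesK n)
edgesK-irrefl n = All.concat⁺ (All.map⁺ (All.universal (λ i →
    All.concat⁺ (All.map⁺ (All.universal (λ j → step i j) (allFin n)))) (allFin n)))
  where
  step : ∀ i j → All (λ e → ¬ proj₁ e ≡ proj₂ e) (if isYes (i Fin.<? j) then (i , j) ∷ [] else [])
  step i j with i Fin.<? j
  ... | yes i<j = (λ e → <-irrefl (cong toℕ e) i<j) ∷ []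
  ... | no _    = []

trichotomy : ∀ {n} (i j : Fin n) → 𝟙 (edge? i j) + 𝟙 (edge? j i) + 𝟙 (i == j) ≡ 1
trichotomy i j with i Fin.<? j | j Fin.<? i | i ≟F j
... | yes p | yes q | _      = contradiction (<-trans p q) (<-irrefl refl)
... | yes p | no _  | yes e  = contradiction p (<-irrefl (cong toℕ e))
... | yes p | no _  | no _   = refl
... | no _  | yes q | yes e  = contradiction q (<-irrefl (cong toℕ (sym e)))
... | no _  | yes q | no _   = refl
... | no _  | no _  | yes _  = refl
... | no p  | no q  | no ¬e  = contradiction (toℕ-injective (≤-antisym (≮⇒≥ q) (≮⇒≥ p))) ¬e

-- Over ordered pairs the indicators used below split into functions of one vertex each, so that
-- their sums become products of cardinalities; over the edges with `i < j` they do not.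
∑-edgesK-sym : ∀ n (f : Fin n → Fin n → ℕ) → (∀ i j → f i j ≡ f j i) →
  2 * ∑ (edgesK n) (λ e → f (proj₁ e) (proj₂ e)) + ∑ (allFin n) (λ i → f i i)
    ≡ ∑ (allFin n) (λ i → ∑ (allFin n) (f i))
∑-edgesK-sym n f f-sym = begin
  2 * E + D ≡⟨ cong (_+ D) (cong (E +_) (+-identityʳ E)) ⟩
  E + E + D ≡⟨ cong₂ _+_ (cong₂ _+_ (∑-edgesK n _) (trans (∑-edgesK n _) flip)) diag ⟩
  dbl (λ i j → 𝟙 (edge? i j) * f i j) + dbl (λ i j → 𝟙 (edge? j i) * f i j)
    + dbl (λ i j → 𝟙 (i == j) * f i j)
    ≡⟨ cong (_+ dbl (λ i j → 𝟙 (i == j) * f i j)) (dbl-+ _ _) ⟨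
  dbl (λ i j → 𝟙 (edge? i j) * f i j + 𝟙 (edge? j i) * f i j) + dbl (λ i j → 𝟙 (i == j) * f i j)
    ≡⟨ dbl-+ _ _ ⟨
  dbl (λ i j → 𝟙 (edge? i j) * f i j + 𝟙 (edge? j i) * f i j + 𝟙 (i == j) * f i j)
    ≡⟨ ∑-cong (allFin n) (λ i → ∑-cong (allFin n) (λ j → begin
         𝟙 (edge? i j) * f i j + 𝟙 (edge? j i) * f i j + 𝟙 (i == j) * f i j
           ≡⟨ lemma (𝟙 (edge? i j)) (𝟙 (edge? j i)) (𝟙 (i == j)) (f i j) ⟩
         (𝟙 (edge? i j) + 𝟙 (edge? j i) + 𝟙 (i == j)) * f i j
           ≡⟨ cong (_* f i j) (trichotomy i j) ⟩
         1 * f i j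
           ≡⟨ *-identityˡ _ ⟩
         f i j ∎)) ⟩
  dbl f ∎
  where
  open ≡-Reasoning
  dbl : (Fin n → Fin n → ℕ) → ℕ
  dbl g = ∑ (allFin n) (λ i → ∑ (allFin n) (g i))
  E = ∑ (edgesK n) (λ e → f (proj₁ e) (proj₂ e))
  D = ∑ (allFin n) (λ i → f i i)
  dbl-+ : ∀ g h → dbl (λ i j → g i j + h i j) ≡ dbl g + dbl h
  dbl-+ g h = trans (∑-cong (allFin n) (λ i → ∑-+ (allFin n) (g i) (h i))) (∑-+ (allFin n) _ _)
  flip : dbl (λ i j → 𝟙 (edge? i j) * f i j) ≡ dbl (λ i j → 𝟙 (edge? j i) * f i j)
  flip = trans (∑-swap (allFin n) (allFin n) _)
    (∑-cong (allFin n) (λ i → ∑-cong (allFin n) (λ j → cong (𝟙 (edge? j i) *_) (f-sym j i))))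
  diag : D ≡ dbl (λ i j → 𝟙 (i == j) * f i j)
  diag = ∑-cong (allFin n) (λ i → sym (∑-single i (f i)))
  lemma : ∀ a b c d → a * d + b * d + c * d ≡ (a + b + c) * d
  lemma = solve-∀

∑-product : ∀ {A B : Set} (xs : List A) (ys : List B) f g →
  ∑ xs (λ x → ∑ ys (λ y → f x * g y)) ≡ ∑ xs f * ∑ ys g
∑-product xs ys f g = trans (∑-cong xs (λ x → ∑-*ˡ ys (f x) g)) (∑-*ʳ xs (∑ ys g) f)

inside cross : ∀ {n} → (Fin n → Bool) → Edge n → Bool
inside χ (i , j) = χ i ∧ χ j
cross  χ (i , j) = χ i xor χ j

inside-count : ∀ {n} (χ : Fin n → Bool) →
  2 * ∑ (edgesK n) (𝟙 ∘ inside χ) + card χ ≡ card χ * card χ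
inside-count {n} χ = begin
  2 * ∑ (edgesK n) (𝟙 ∘ inside χ) + card χ
    ≡⟨ cong (2 * ∑ (edgesK n) (𝟙 ∘ inside χ) +_) (∑-cong (allFin n) (λ i → diag (χ i))) ⟨
  2 * ∑ (edgesK n) (𝟙 ∘ inside χ) + ∑ (allFin n) (λ i → 𝟙 (χ i ∧ χ i))
    ≡⟨ ∑-edgesK-sym n (λ i j → 𝟙 (χ i ∧ χ j)) (λ i j → cong 𝟙 (∧-comm (χ i) (χ j))) ⟩
  ∑ (allFin n) (λ i → ∑ (allFin n) (λ j → 𝟙 (χ i ∧ χ j)))
    ≡⟨ ∑-cong (allFin n) (λ i → ∑-cong (allFin n) (λ j → 𝟙-∧ (χ i) (χ j))) ⟩
  ∑ (allFin n) (λ i → ∑ (allFin n) (λ j → 𝟙 (χ i) * 𝟙 (χ j)))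
    ≡⟨ ∑-product (allFin n) (allFin n) _ _ ⟩
  card χ * card χ ∎
  where
  open ≡-Reasoning
  diag : ∀ b → 𝟙 (b ∧ b) ≡ 𝟙 b
  diag true  = refl
  diag false = refl

cross-count : ∀ {n} (χ : Fin n → Bool) →
  ∑ (edgesK n) (𝟙 ∘ cross χ) ≡ card χ * card (not ∘ χ)
cross-count {n} χ = *-cancelˡ-≡ _ _ 2 (begin
  2 * ∑ (edgesK n) (𝟙 ∘ cross χ)
    ≡⟨ +-identityʳ _ ⟨
  2 * ∑ (edgesK n) (𝟙 ∘ cross χ) + 0
    ≡⟨ cong (2 * ∑ (edgesK n) (𝟙 ∘ cross χ) +_)
         (trans (∑-cong (allFin n) (λ i → diag (χ i))) (∑-zero (allFin n))) ⟨
  2 * ∑ (edgesK n) (𝟙 ∘ cross χ) + ∑ (allFin n) (λ i → 𝟙 (χ i xor χ i))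
    ≡⟨ ∑-edgesK-sym n (λ i j → 𝟙 (χ i xor χ j)) (λ i j → cong 𝟙 (xor-sym (χ i) (χ j))) ⟩
  ∑ (allFin n) (λ i → ∑ (allFin n) (λ j → 𝟙 (χ i xor χ j)))
    ≡⟨ ∑-cong (allFin n) (λ i → trans (∑-cong (allFin n) (λ j → split (χ i) (χ j))) (∑-+ (allFin n) _ _)) ⟩
  ∑ (allFin n) (λ i → ∑ (allFin n) (λ j → 𝟙 (χ i) * 𝟙 (not (χ j)))
    + ∑ (allFin n) (λ j → 𝟙 (not (χ i)) * 𝟙 (χ j)))
    ≡⟨ ∑-+ (allFin n) _ _ ⟩
  ∑ (allFin n) (λ i → ∑ (allFin n) (λ j → 𝟙 (χ i) * 𝟙 (not (χ j))))
    + ∑ (allFin n) (λ i → ∑ (allFin n) (λ j → 𝟙 (not (χ i)) * 𝟙 (χ j)))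
    ≡⟨ cong₂ _+_ (∑-product (allFin n) (allFin n) _ _) (∑-product (allFin n) (allFin n) _ _) ⟩
  card χ * card (not ∘ χ) + card (not ∘ χ) * card χ
    ≡⟨ lemma (card χ) (card (not ∘ χ)) ⟩
  2 * (card χ * card (not ∘ χ)) ∎)
  where
  open ≡-Reasoning
  diag : ∀ b → 𝟙 (b xor b) ≡ 0
  diag true  = refl
  diag false = refl
  xor-sym : ∀ a b → a xor b ≡ b xor a
  xor-sym true  true  = refl
  xor-sym true  false = refl
  xor-sym false true  = refl
  xor-sym false false = refl
  split : ∀ a b → 𝟙 (a xor b) ≡ 𝟙 a * 𝟙 (not b) + 𝟙 (not a) * 𝟙 b
  split true  true  = refl
  split true  false = refl
  split false true  = refl
  split false false = refl
  lemma : ∀ a b → a * b + b * a ≡ 2 * (a * b)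
  lemma = solve-∀

edgesK-count : ∀ n → 2 * length (edgesK n) + n ≡ n * n
edgesK-count n = subst₂ (λ a b → 2 * a + b ≡ b * b) (sym (length≡∑ (edgesK n))) (card-true n)
  (inside-count {n} (λ _ → true))

Nn-count : ∀ n → 2 * Nn n + n ≡ n * n
Nn-count zero    = refl
Nn-count (suc n) = begin
  2 * Nn (suc n) + suc n       ≡⟨ cong (λ c → 2 * c + suc n) (Comb.nCk+nC[k+1]≡[n+1]C[k+1] n 1) ⟨
  2 * (n Comb.C 1 + Nn n) + suc n   ≡⟨ cong (λ c → 2 * (c + Nn n) + suc n) (Comb.nC1≡n n) ⟩
  2 * (n + Nn n) + suc n       ≡⟨ lemma₁ n (Nn n) ⟩
  (2 * Nn n + n) + (n + suc n) ≡⟨ cong (_+ (n + suc n)) (Nn-count n) ⟩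
  n * n + (n + suc n)           ≡⟨ lemma₂ n ⟩
  suc n * suc n                 ∎
  where
  open ≡-Reasoning
  lemma₁ : ∀ n c → 2 * (n + c) + suc n ≡ (2 * c + n) + (n + suc n)
  lemma₁ = solve-∀
  lemma₂ : ∀ n → n * n + (n + suc n) ≡ suc n * suc n
  lemma₂ = solve-∀

2*edges : ∀ k → 2 * length (edgesK (suc k)) ≡ suc k * k
2*edges k = +-cancelʳ-≡ (suc k) _ _ (trans (edgesK-count (suc k)) (lemma k))
  where
  lemma : ∀ k → suc k * suc k ≡ suc k * k + suc k
  lemma = solve-∀

length-edgesK : ∀ n → length (edgesK n) ≡ Nn n
length-edgesK n = *-cancelˡ-≡ _ _ 2 (+-cancelʳ-≡ n _ _ (trans (edgesK-count n) (sym (Nn-count n))))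

allVec : ∀ n → List (Vec Bool n)
allVec zero    = [] ∷ []
allVec (suc n) = map (true ∷_) (allVec n) ++ map (false ∷_) (allVec n)

∈-allVec : ∀ {n} (S : Vec Bool n) → S ∈ allVec n
∈-allVec []          = here refl
∈-allVec (true ∷ S)  = Mem.∈-++⁺ˡ (Mem.∈-map⁺ (true ∷_) (∈-allVec S))
∈-allVec {suc n} (false ∷ S) = Mem.∈-++⁺ʳ (map (true ∷_) (allVec n)) (Mem.∈-map⁺ (false ∷_) (∈-allVec S))

size : ∀ {n} → Vec Bool n → ℕ
size S = card (lookup S)

size-∷ : ∀ {n} b (S : Vec Bool n) → size (b ∷ S) ≡ 𝟙 b + size S
size-∷ {n} b S = ∑-allFin-suc n _

size≤n : ∀ {n} (S : Vec Bool n) → size S ≤ n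
size≤n S = ≤-trans (m≤m+n _ _) (≤-reflexive (card-not (lookup S)))

size-tabulate : ∀ {n} (χ : Fin n → Bool) → size (Vec.tabulate χ) ≡ card χ
size-tabulate {n} χ = ∑-cong (allFin n) (λ i → cong 𝟙 (Vec.lookup∘tabulate χ i))

subset-binomial : ∀ n Z → ∑ (allVec n) (λ S → Z ^ (n ∸ size S)) ≡ (1 + Z) ^ n
subset-binomial zero    Z = refl
subset-binomial (suc n) Z = begin
  ∑ (allVec (suc n)) (λ S → Z ^ (suc n ∸ size S))
    ≡⟨ ∑-++ (map (true ∷_) (allVec n)) _ _ ⟩
  ∑ (map (true ∷_) (allVec n)) (λ S → Z ^ (suc n ∸ size S))
    + ∑ (map (false ∷_) (allVec n)) (λ S → Z ^ (suc n ∸ size S))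
    ≡⟨ cong₂ _+_ (∑-map (true ∷_) (allVec n) _) (∑-map (false ∷_) (allVec n) _) ⟩
  ∑ (allVec n) (λ S → Z ^ (suc n ∸ size (true ∷ S))) + ∑ (allVec n) (λ S → Z ^ (suc n ∸ size (false ∷ S)))
    ≡⟨ cong₂ _+_ (∑-cong (allVec n) (λ S → cong (λ k → Z ^ (suc n ∸ k)) (size-∷ true S)))
         (∑-cong (allVec n) (λ S → trans (cong (λ k → Z ^ (suc n ∸ k)) (size-∷ false S))
           (cong (Z ^_) (+-∸-assoc 1 (size≤n S))))) ⟩
  ∑ (allVec n) (λ S → Z ^ (n ∸ size S)) + ∑ (allVec n) (λ S → Z * Z ^ (n ∸ size S))
    ≡⟨ cong (∑ (allVec n) (λ S → Z ^ (n ∸ size S)) +_) (∑-*ˡ (allVec n) Z _) ⟩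
  ∑ (allVec n) (λ S → Z ^ (n ∸ size S)) + Z * ∑ (allVec n) (λ S → Z ^ (n ∸ size S))
    ≡⟨ cong (λ c → c + Z * c) (subset-binomial n Z) ⟩
  (1 + Z) ^ suc n ∎
  where open ≡-Reasoning

-- A union bound without binomial coefficients: if `f S` is at most `T / Z^|S|`, the binomial
-- theorem bounds the whole sum by `T (1 + 1/Z)^n`.
subset-sum : ∀ n Z T (f : Vec Bool n → ℕ) → (∀ S → f S * Z ^ size S ≤ T) →
  ∑ (allVec n) f * Z ^ n ≤ T * (1 + Z) ^ n
subset-sum n Z T f h = begin
  ∑ (allVec n) f * Z ^ n                 ≡⟨ ∑-*ʳ (allVec n) (Z ^ n) f ⟨
  ∑ (allVec n) (λ S → f S * Z ^ n)       ≤⟨ ∑-mono (allVec n) step ⟩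
  ∑ (allVec n) (λ S → T * Z ^ (n ∸ size S)) ≡⟨ ∑-*ˡ (allVec n) T _ ⟩
  T * ∑ (allVec n) (λ S → Z ^ (n ∸ size S)) ≡⟨ cong (T *_) (subset-binomial n Z) ⟩
  T * (1 + Z) ^ n                        ∎
  where
  open ≤-Reasoning
  step : ∀ S → f S * Z ^ n ≤ T * Z ^ (n ∸ size S)
  step S = begin
    f S * Z ^ n                             ≡⟨ cong (λ k → f S * Z ^ k) (sym (m+[n∸m]≡n (size≤n S))) ⟩
    f S * Z ^ (size S + (n ∸ size S))       ≡⟨ cong (f S *_) (^-distribˡ-+-* Z (size S) _) ⟩
    f S * (Z ^ size S * Z ^ (n ∸ size S))   ≡⟨ *-assoc (f S) _ _ ⟨
    f S * Z ^ size S * Z ^ (n ∸ size S)     ≤⟨ *-monoˡ-≤ (Z ^ (n ∸ size S)) (h S) ⟩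
    T * Z ^ (n ∸ size S)                    ∎

-- Leaving out the empty set turns `(1 + 1/Z)^n` into `(1 + 1/Z)^n - 1`, which is at most `1/s` once
-- `Z` is about `(s + 1) n`.
nonempty-subset-sum : ∀ n Z T s (f : Vec Bool n → ℕ) → suc s * n ≤ suc Z →
  (∀ S → size S ≡ 0 → f S ≡ 0) → (∀ S → 1 ≤ size S → f S * Z ^ size S ≤ T) → 0 < Z →
  s * ∑ (allVec n) f ≤ T
nonempty-subset-sum n Z T s f sn≤Z empty nonempty Z>0 =
  *-cancelʳ-≤′ (Z ^ n) (^>0 Z n Z>0) (+-cancelʳ-≤ (s * T * Z ^ n) _ _ (begin
    s * ∑ (allVec n) f * Z ^ n + s * T * Z ^ n
      ≡⟨ lemma₁ s (∑ (allVec n) f) (Z ^ n) T ⟩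
    s * ((∑ (allVec n) f + T) * Z ^ n)
      ≤⟨ *-monoʳ-≤ s (*-monoˡ-≤ (Z ^ n) with-empty) ⟩
    s * (∑ (allVec n) f′ * Z ^ n)
      ≤⟨ *-monoʳ-≤ s (subset-sum n Z T f′ f′-bound) ⟩
    s * (T * p)
      ≡⟨ lemma₂ s T p ⟩
    T * (s * p)
      ≤⟨ *-monoʳ-≤ T sp≤ ⟩
    T * (suc s * Z ^ n)
      ≡⟨ lemma₃ T s (Z ^ n) ⟩
    T * Z ^ n + s * T * Z ^ n ∎))
  where
  open ≤-Reasoning
  p = (1 + Z) ^ n
  lemma₁ : ∀ s f z t → s * f * z + s * t * z ≡ s * ((f + t) * z)
  lemma₁ = solve-∀
  lemma₂ : ∀ s t p → s * (t * p) ≡ t * (s * p)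
  lemma₂ = solve-∀
  lemma₃ : ∀ t s z → t * (suc s * z) ≡ t * z + s * t * z
  lemma₃ = solve-∀
  ∅ : Vec Bool n
  ∅ = Vec.tabulate (λ _ → false)
  size∅ : size ∅ ≡ 0
  size∅ = trans (size-tabulate {n} (λ _ → false)) (∑-zero (allFin n))
  -- Adding `T` at the empty set makes `f′` meet the hypothesis of `subset-sum` with equality there;
  -- the same `T` is subtracted again at the end.
  e f′ : Vec Bool n → ℕ
  e S = 𝟙 (size S ≤ᵇ 0) * T
  f′ S = f S + e S
  with-empty : ∑ (allVec n) f + T ≤ ∑ (allVec n) f′
  with-empty = begin
    ∑ (allVec n) f + T ≡⟨ cong (∑ (allVec n) f +_) (trans (sym (*-identityˡ T)) (cong (λ b → 𝟙 (b ≤ᵇ 0) * T) (sym size∅))) ⟩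
    ∑ (allVec n) f + e ∅ ≤⟨ +-monoʳ-≤ _ (∑-∈ e (∈-allVec ∅)) ⟩
    ∑ (allVec n) f + ∑ (allVec n) e ≡⟨ ∑-+ (allVec n) f e ⟨
    ∑ (allVec n) f′ ∎
  f′-bound : ∀ S → f′ S * Z ^ size S ≤ T
  f′-bound S with size S in eq
  ... | zero  rewrite empty S eq = ≤-reflexive (trans (*-identityʳ _) (*-identityˡ T))
  ... | suc k = subst₂ (λ a b → a * Z ^ b ≤ T) (sym (+-identityʳ (f S))) eq
                  (nonempty S (subst (1 ≤_) (sym eq) (s≤s z≤n)))
  sp≤ : s * p ≤ suc s * Z ^ n
  sp≤ = *-cancelʳ-≤′ (suc Z) (s≤s z≤n) (+-cancelʳ-≤ (p * suc Z) _ _ (begin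
    s * p * suc Z + p * suc Z             ≡⟨ lemma₄ s p (suc Z) ⟩
    suc s * (p * suc Z)                   ≤⟨ *-monoʳ-≤ (suc s) (bernoulli-suc Z n) ⟩
    suc s * (Z ^ n * suc Z + n * p)       ≡⟨ lemma₅ s (Z ^ n) (suc Z) n p ⟩
    suc s * Z ^ n * suc Z + p * (suc s * n) ≤⟨ +-monoʳ-≤ (suc s * Z ^ n * suc Z) (*-monoʳ-≤ p sn≤Z) ⟩
    suc s * Z ^ n * suc Z + p * suc Z     ∎))
    where
    lemma₄ : ∀ s p z → s * p * z + p * z ≡ suc s * (p * z)
    lemma₄ = solve-∀
    lemma₅ : ∀ s x z n p → suc s * (x * z + n * p) ≡ suc s * x * z + p * (suc s * n)
    lemma₅ = solve-∀

-- Components and rank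

bridges : ∀ {n} (E : List (Edge n)) → ∃[ f ] acyclic E ≡ all f (upTo (length E))
bridges E = _ , refl

bridge? : ∀ {n} → List (Edge n) → ℕ → Bool
bridge? E p = proj₁ (bridges E) p

-- `H` is the whole list, from which the edge at position `p` is dropped; `F` is the suffix still to
-- be scanned for that edge, and `q` the distance that remains.
bridgeAt : ∀ {n} → List (Edge n) → ℕ → ℕ → List (Edge n) → Bool
bridgeAt     H p q       []            = true
bridgeAt {n} H p zero    ((a , b) ∷ F) = not (reach n (dropAt p H) a b)
bridgeAt     H p (suc q) (_ ∷ F)       = bridgeAt H p q F

bridgeAt-unique : ∀ {n} (G : List (Edge n) → ℕ → ℕ → List (Edge n) → Bool)
  → (∀ H p q → G H p q [] ≡ true)
  → (∀ H p a b F → G H p zero ((a , b) ∷ F) ≡ not (reach n (dropAt p H) a b))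
  → (∀ H p q y F → G H p (suc q) (y ∷ F) ≡ G H p q F)
  → ∀ H p q F → G H p q F ≡ bridgeAt H p q F
bridgeAt-unique G e₁ e₂ e₃ H p q       []      = e₁ H p q
bridgeAt-unique G e₁ e₂ e₃ H p zero    (x ∷ F) = e₂ H p _ _ F
bridgeAt-unique G e₁ e₂ e₃ H p (suc q) (x ∷ F) =
  trans (e₃ H p q x F) (bridgeAt-unique G e₁ e₂ e₃ H p q F)

-- The local functions in the definition of acyclic have no names here. Abstracting over
-- suc q and x ∷ F separates their parameters from the arguments they recurse on, and then
-- unification can solve for the function itself.
mutual
  generic-bridge? : ∀ {n} → List (Edge n) → ℕ → ℕ → List (Edge n) → Bool
  generic-bridge? = _

  bridge?-generic : ∀ {n} (x : Edge n) F q →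
    bridge? (x ∷ F) (suc q) ≡ generic-bridge? (x ∷ F) (suc q) q F
  bridge?-generic x F q with suc q | x ∷ F
  ... | p | H = refl

bridge?≡bridgeAt : ∀ {n} (E : List (Edge n)) p → bridge? E p ≡ bridgeAt E p p E
bridge?≡bridgeAt []      p       = refl
bridge?≡bridgeAt (x ∷ F) zero    = refl
bridge?≡bridgeAt (x ∷ F) (suc q) = trans (bridge?-generic x F q)
  (bridgeAt-unique generic-bridge? (λ _ _ _ → refl) (λ _ _ _ _ _ → refl) (λ _ _ _ _ _ → refl)
    (x ∷ F) (suc q) q F)

data At {A : Set} (x : A) : List A → ℕ → Set where
  here  : ∀ {xs} → At x (x ∷ xs) zero
  there : ∀ {y xs p} → At x xs p → At x (y ∷ xs) (suc p)

dropAt-↭ : ∀ {A : Set} {x : A} {xs p} → At x xs p → xs ↭ x ∷ dropAt p xs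
dropAt-↭ here      = ↭-refl
dropAt-↭ (there {y} a) = ↭-trans (Perm.prep y (dropAt-↭ a)) (Perm.swap y _ ↭-refl)

acyclic-intro : ∀ {n} (E : List (Edge n)) →
  (∀ {e p} → At e E p → reach n (dropAt p E) (proj₁ e) (proj₂ e) ≡ false) → acyclic E ≡ true
acyclic-intro {n} E h = trans (proj₂ (bridges E))
  (all-true (bridge? E) (upTo (length E)) (λ {p} _ → trans (bridge?≡bridgeAt E p) (step E p h)))
  where
  step : ∀ {p} F q → (∀ {e} → At e F q → reach n (dropAt p E) (proj₁ e) (proj₂ e) ≡ false) →
    bridgeAt E p q F ≡ true
  step []      q       h = refl
  step (x ∷ F) zero    h rewrite h here = refl
  step (x ∷ F) (suc q) h = step F q (λ a → h (there a))

reach-refl : ∀ {n} k E (u : Fin n) → reach k E u u ≡ true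
reach-refl zero    E u = ==-true refl
reach-refl (suc k) E u rewrite reach-refl k E u = refl

reach-suc : ∀ {n} k E (u v : Fin n) → reach k E u v ≡ true → reach (suc k) E u v ≡ true
reach-suc k E u v h rewrite h = refl

hop : ∀ {n} → ℕ → List (Edge n) → Fin n → Fin n → Edge n → Bool
hop k E u v e = ((proj₁ e == u) ∧ reach k E (proj₂ e) v) ∨ ((proj₂ e == u) ∧ reach k E (proj₁ e) v)

reach-invariant : ∀ {n} {X : Set} (f : Fin n → X) k E → All (λ e → f (proj₁ e) ≡ f (proj₂ e)) E →
  ∀ u v → reach k E u v ≡ true → f u ≡ f v
reach-invariant f zero    E inv u v h = cong f (==-true⁻ h)
reach-invariant f (suc k) E inv u v h with ∨-true {reach k E u v} h
... | inj₁ q = reach-invariant f k E inv u v q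
... | inj₂ q with any-true⁻ (hop k E u v) E q
...   | (a , b) , m , r with ∨-true {(a == u) ∧ reach k E b v} r
...     | inj₁ t with ∧-true {a == u} t
...       | a≡u , s = trans (cong f (sym (==-true⁻ a≡u)))
                        (trans (All.lookup inv m) (reach-invariant f k E inv b v s))
reach-invariant f (suc k) E inv u v h | inj₂ q | (a , b) , m , r | inj₂ t with ∧-true {b == u} t
...       | b≡u , s = trans (cong f (sym (==-true⁻ b≡u)))
                        (trans (sym (All.lookup inv m)) (reach-invariant f k E inv a v s))

reach-edge : ∀ {n} k {E} {e : Edge n} v → e ∈ E →
  (reach k E (proj₂ e) v ≡ true → reach (suc k) E (proj₁ e) v ≡ true) ×
  (reach k E (proj₁ e) v ≡ true → reach (suc k) E (proj₂ e) v ≡ true)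
reach-edge k {E} {a , b} v m = forward , backward
  where
  ∨-introʳ : ∀ a {b} → b ≡ true → a ∨ b ≡ true
  ∨-introʳ true  _ = refl
  ∨-introʳ false h = h
  forward : reach k E b v ≡ true → reach (suc k) E a v ≡ true
  forward h = ∨-introʳ (reach k E a v) (any-true (hop k E a v) E m
    (cong (_∨ (b == a) ∧ reach k E a v) (cong₂ _∧_ (==-true {i = a} refl) h)))
  backward : reach k E a v ≡ true → reach (suc k) E b v ≡ true
  backward h = ∨-introʳ (reach k E b v) (any-true (hop k E b v) E m
    (∨-introʳ ((a == b) ∧ reach k E b v) (cong₂ _∧_ (==-true {i = b} refl) h)))

card≤1 : ∀ {n} (χ : Fin n → Bool) → (∀ {i j} → χ i ≡ true → χ j ≡ true → i ≡ j) → card χ ≤ 1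
card≤1 {n} χ h with any χ (allFin n) in eq
... | false = ≤-trans (≤-reflexive (trans
    (∑-cong (allFin n) (λ i → cong 𝟙 (any-false χ (allFin n) eq (∈-allFin i)))) (∑-zero (allFin n)))) z≤n
... | true with any-true⁻ χ (allFin n) eq
...   | i , _ , q = ≤-trans (card-mono {χ = χ} {i ==_} (λ j r → ==-true (h {i} {j} q r))) (≤-reflexive (card-single i))

card-≡ : ∀ {n} {χ ψ : Fin n → Bool} → (∀ i → χ i ≡ ψ i) → card χ ≡ card ψ
card-≡ {n} h = ∑-cong (allFin n) (λ i → cong 𝟙 (h i))

card-∨ : ∀ {n} (χ ψ : Fin n → Bool) → card (λ i → χ i ∨ ψ i) ≤ card χ + card ψ
card-∨ {n} χ ψ = ≤-trans (∑-mono (allFin n) (λ i → 𝟙-∨ (χ i) (ψ i))) (≤-reflexive (∑-+ (allFin n) _ _))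

card-insert : ∀ {n} {χ ψ : Fin n → Bool} {i} → χ i ≡ false → ψ i ≡ true →
  (∀ j → χ j ≡ true → ψ j ≡ true) → suc (card χ) ≤ card ψ
card-insert {n} {χ} {ψ} {i} p q h = begin
  suc (card χ)              ≡⟨ +-comm 1 _ ⟩
  card χ + 1                ≡⟨ cong (card χ +_) (card-single i) ⟨
  card χ + card (i ==_)     ≡⟨ ∑-+ (allFin n) _ _ ⟨
  ∑ (allFin n) (λ j → 𝟙 (χ j) + 𝟙 (i == j)) ≤⟨ ∑-mono (allFin n) step ⟩
  card ψ                    ∎
  where
  open ≤-Reasoning
  step : ∀ j → 𝟙 (χ j) + 𝟙 (i == j) ≤ 𝟙 (ψ j)
  step j with i ≟F j
  ... | yes refl rewrite p | q = ≤-refl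
  ... | no _ = ≤-trans (≤-reflexive (+-identityʳ _)) (𝟙-mono (h j))

-- lab E sends every vertex to a representative of its component in E.
lab : ∀ {n} → List (Edge n) → Fin n → Fin n
lab []            u = u
lab ((a , b) ∷ E) u = if lab E u == lab E b then lab E a else lab E u

_~_ : ∀ {n} → List (Edge n) → Edge n → Set
E ~ e = lab E (proj₁ e) ≡ lab E (proj₂ e)

-- Inclusion in the span of the graphic matroid: `E′` need not contain the edges of `E`, only
-- connect their ends.
record _⊑_ {n} (E E′ : List (Edge n)) : Set where
  constructor ⟪_⟫
  field joined : All (E′ ~_) E

open _⊑_ public

module _ {n : ℕ} where

  lab-step : ∀ {X : Set} (f : Fin n → X) a b E u → (∀ w → f (lab E w) ≡ f w) → f a ≡ f b →
    f (lab ((a , b) ∷ E) u) ≡ f u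
  lab-step f a b E u ih fa≡fb with lab E u ≟F lab E b
  ... | yes e = trans (ih a) (trans fa≡fb (trans (sym (ih b)) (trans (cong f (sym e)) (ih u))))
  ... | no _  = ih u

  lab-invariant : ∀ {X : Set} (f : Fin n → X) E → All (λ e → f (proj₁ e) ≡ f (proj₂ e)) E →
    ∀ u → f (lab E u) ≡ f u
  lab-invariant f []            []        u = refl
  lab-invariant f ((a , b) ∷ E) (p ∷ inv) u = lab-step f a b E u (lab-invariant f E inv) p

  -- Any labelling that is constant along the edges factors through `lab E`. Comparisons of edge
  -- sets rest on this, so the choice of representatives does not matter to them.
  lab-universal : ∀ {X : Set} (f : Fin n → X) E → All (λ e → f (proj₁ e) ≡ f (proj₂ e)) E →
    ∀ {u v} → lab E u ≡ lab E v → f u ≡ f v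
  lab-universal f E inv e =
    trans (sym (lab-invariant f E inv _)) (trans (cong f e) (lab-invariant f E inv _))

  lab-∷-mono : ∀ e E {u v : Fin n} → lab E u ≡ lab E v → lab (e ∷ E) u ≡ lab (e ∷ E) v
  lab-∷-mono (a , b) E eq rewrite eq = refl

  lab-∷-edge : ∀ (e : Edge n) E → (e ∷ E) ~ e
  lab-∷-edge (a , b) E with lab E a ≟F lab E b | lab E b ≟F lab E b
  ... | yes _ | yes _ = refl
  ... | no _  | yes _ = refl
  ... | _     | no ¬r = contradiction refl ¬r

  ⊑-∷ : ∀ (e : Edge n) {E E′} → E′ ⊑ E → E′ ⊑ (e ∷ E)
  ⊑-∷ e {E} ⟪ h ⟫ = ⟪ All.map (lab-∷-mono e E) h ⟫

  ⊑-refl : ∀ (E : List (Edge n)) → E ⊑ E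
  ⊑-refl []      = ⟪ [] ⟫
  ⊑-refl (e ∷ E) = ⟪ lab-∷-edge e E ∷ joined (⊑-∷ e (⊑-refl E)) ⟫

  lab-idem : ∀ (E : List (Edge n)) u → lab E (lab E u) ≡ lab E u
  lab-idem E = lab-invariant (lab E) E (joined (⊑-refl E))

  lab-⊑ : ∀ {E E′ : List (Edge n)} → E ⊑ E′ → ∀ {u v} → lab E u ≡ lab E v → lab E′ u ≡ lab E′ v
  lab-⊑ {E} {E′} ⟪ h ⟫ = lab-universal (lab E′) E h

  ⊑-⊆ : ∀ {E E′ : List (Edge n)} → (∀ {e} → e ∈ E → e ∈ E′) → E ⊑ E′
  ⊑-⊆ {E} {E′} h = ⟪ All.tabulate (λ m → All.lookup (joined (⊑-refl E′)) (h m)) ⟫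

  ⊑-++ʳ : ∀ (X : List (Edge n)) {E E′} → E ⊑ E′ → E ⊑ (X ++ E′)
  ⊑-++ʳ []      h = h
  ⊑-++ʳ (x ∷ X) h = ⊑-∷ x (⊑-++ʳ X h)

  ⊑-++ : ∀ (X : List (Edge n)) {E E′} → E ⊑ E′ → (X ++ E) ⊑ (X ++ E′)
  ⊑-++ []      h = h
  ⊑-++ (x ∷ X) {E} {E′} h = ⟪ lab-∷-edge x (X ++ E′) ∷ joined (⊑-∷ x (⊑-++ X h)) ⟫

  δ : List (Edge n) → Edge n → ℕ
  δ E e = 𝟙 (not (lab E (proj₁ e) == lab E (proj₂ e)))

  δ≤1 : ∀ E e → δ E e ≤ 1
  δ≤1 E e = 𝟙≤1 _

  δ-anti : ∀ {E E′ : List (Edge n)} → E ⊑ E′ → ∀ e → δ E′ e ≤ δ E e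
  δ-anti {E} {E′} h (a , b) with lab E a ≟F lab E b | lab E′ a ≟F lab E′ b
  ... | no _  | _     = 𝟙≤1 _
  ... | yes _ | yes _ = z≤n
  ... | yes p | no q  = contradiction (lab-⊑ h p) q

  rank : List (Edge n) → ℕ
  rank []      = 0
  rank (e ∷ E) = δ E e + rank E

  root : List (Edge n) → Fin n → Bool
  root E u = lab E u == u

  -- There is one root per component. An edge inside a component leaves the roots alone; an edge
  -- between two components takes this status from `lab E b` only.
  roots+rank : ∀ (E : List (Edge n)) → card (root E) + rank E ≡ n
  roots+rank [] = trans (+-identityʳ _)
    (trans (∑-cong (allFin n) (λ u → cong 𝟙 (==-true refl))) (card-true n))
  roots+rank (e@(a , b) ∷ E) = trans lemma (roots+rank E)
    where
    open ≡-Reasoning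
    lemma : card (root (e ∷ E)) + (δ E e + rank E) ≡ card (root E) + rank E
    lemma with lab E a ≟F lab E b
    ... | yes p = cong (_+ rank E) (card-≡ same)
      where
      same : ∀ u → root (e ∷ E) u ≡ root E u
      same u with lab E u ≟F lab E b
      ... | yes q = cong (_== u) (trans p (sym q))
      ... | no _  = refl
    ... | no ¬p = begin
      card (root (e ∷ E)) + (1 + rank E) ≡⟨ +-assoc (card (root (e ∷ E))) 1 _ ⟨
      card (root (e ∷ E)) + 1 + rank E
        ≡⟨ cong (λ c → card (root (e ∷ E)) + c + rank E) (card-single (lab E b)) ⟨
      card (root (e ∷ E)) + card (lab E b ==_) + rank E
        ≡⟨ cong (_+ rank E) (trans (sym (∑-+ (allFin n) _ _)) (∑-cong (allFin n) one)) ⟩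
      card (root E) + rank E ∎
      where
      one : ∀ u → 𝟙 (root (e ∷ E) u) + 𝟙 (lab E b == u) ≡ 𝟙 (root E u)
      one u with lab E u ≟F lab E b
      ... | no q rewrite ==-false {i = lab E b} {u} (λ r → q (trans (cong (lab E) (sym r)) (lab-idem E b))) =
              +-identityʳ _
      ... | yes q rewrite ==-false {i = lab E a} {u} (λ r →
              ¬p (trans (sym (lab-idem E a)) (trans (cong (lab E) r) q))) | q = refl

  -- Two roots of `E′` with equal labels in `E` have equal labels in `E′` and so coincide. Hence
  -- `E′` has no more components than `E`.
  rank-mono : ∀ {E E′ : List (Edge n)} → E ⊑ E′ → rank E ≤ rank E′
  rank-mono {E} {E′} h = +-cancelˡ-≤ (card (root E′)) _ _ (begin
    card (root E′) + rank E  ≤⟨ +-monoˡ-≤ (rank E) roots≤ ⟩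
    card (root E) + rank E   ≡⟨ trans (roots+rank E) (sym (roots+rank E′)) ⟩
    card (root E′) + rank E′ ∎)
    where
    open ≤-Reasoning
    roots≤ : card (root E′) ≤ card (root E)
    roots≤ = begin
      card (root E′)
        ≡⟨ ∑-cong (allFin n) (λ u → trans (sym (∑-single (lab E u) (λ _ → 𝟙 (root E′ u))))
             (∑-cong (allFin n) (λ w → *-comm (𝟙 (lab E u == w)) _))) ⟩
      ∑ (allFin n) (λ u → ∑ (allFin n) (λ w → 𝟙 (root E′ u) * 𝟙 (lab E u == w)))
        ≡⟨ ∑-swap (allFin n) (allFin n) _ ⟩
      ∑ (allFin n) (λ w → ∑ (allFin n) (λ u → 𝟙 (root E′ u) * 𝟙 (lab E u == w)))
        ≡⟨ ∑-cong (allFin n) (λ w → ∑-cong (allFin n) (λ u → sym (𝟙-∧ (root E′ u) _))) ⟩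
      ∑ (allFin n) (λ w → card (λ u → root E′ u ∧ (lab E u == w)))
        ≤⟨ ∑-mono (allFin n) (λ w → fibre w) ⟩
      card (root E) ∎
      where
      fibre : ∀ w → card (λ u → root E′ u ∧ (lab E u == w)) ≤ 𝟙 (root E w)
      fibre w with lab E w ≟F w
      ... | yes _ = card≤1 _ (λ {i} {j} p q →
        let p₁ , p₂ = ∧-true {root E′ i} p
            q₁ , q₂ = ∧-true {root E′ j} q
        in trans (sym (==-true⁻ p₁)) (trans
             (lab-⊑ h (trans (==-true⁻ p₂) (sym (==-true⁻ q₂)))) (==-true⁻ q₁)))
      ... | no ¬r = ≤-reflexive (trans (∑-cong (allFin n) (λ u → cong 𝟙 (none u))) (∑-zero (allFin n)))
        where
        none : ∀ u → root E′ u ∧ (lab E u == w) ≡ false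
        none u rewrite ==-false {i = lab E u} {w} (λ q → ¬r
          (trans (cong (lab E) (sym q)) (trans (lab-idem E u) q))) with root E′ u
        ... | true  = refl
        ... | false = refl

  rank-++ : ∀ (X : List (Edge n)) E → rank (X ++ E) ≤ length X + rank E
  rank-++ []      E = ≤-refl
  rank-++ (x ∷ X) E = +-mono-≤ (δ≤1 (X ++ E) x) (rank-++ X E)

  -- Adding the edges of `X` one at a time, each raises the rank over the larger span `A` by no more
  -- than over `C`, which is `δ-anti`.
  rank-submodular : ∀ (X : List (Edge n)) {C A} → C ⊑ A →
    rank (X ++ A) + rank C ≤ rank (X ++ C) + rank A
  rank-submodular []      {C} {A} h = ≤-reflexive (+-comm (rank A) (rank C))
  rank-submodular (x ∷ X) {C} {A} h = begin
    δ (X ++ A) x + rank (X ++ A) + rank C   ≡⟨ +-assoc (δ (X ++ A) x) _ _ ⟩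
    δ (X ++ A) x + (rank (X ++ A) + rank C) ≤⟨ +-mono-≤ (δ-anti (⊑-++ X h) x) (rank-submodular X h) ⟩
    δ (X ++ C) x + (rank (X ++ C) + rank A) ≡⟨ +-assoc (δ (X ++ C) x) _ _ ⟨
    δ (X ++ C) x + rank (X ++ C) + rank A   ∎
    where open ≤-Reasoning

-- Matroid intersection

module _ {n : ℕ} (E : List (Edge n)) (v : Fin n) where

  private
    Stable : ℕ → Set
    Stable j = ∀ u → reach (suc j) E u v ≡ true → reach j E u v ≡ true

    -- The sets of vertices reaching `v` within `k` steps grow until they repeat once. With a new
    -- vertex at every step there would be `n + 1` vertices after `n` steps, so the `n` steps that
    -- `connected` allows suffice.
    stable-or-large : ∀ k → (∃[ j ] j ≤ k × Stable j) ⊎ suc k ≤ card (λ u → reach k E u v)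
    stable-or-large zero = inj₂ (≤-trans (≤-reflexive (sym (card-single v)))
      (card-mono {χ = v ==_} {λ u → u == v} (λ u h → ==-true (sym (==-true⁻ h)))))
    stable-or-large (suc k) with stable-or-large k
    ... | inj₁ (j , j≤k , s) = inj₁ (j , m≤n⇒m≤1+n j≤k , s)
    ... | inj₂ large with any (λ u → reach (suc k) E u v ∧ not (reach k E u v)) (allFin n) in eq
    ...   | false = inj₁ (k , n≤1+n k , λ u h → stays _ _ h (any-false new (allFin n) eq (∈-allFin u)))
      where
      new : Fin n → Bool
      new u = reach (suc k) E u v ∧ not (reach k E u v)
      stays : ∀ b c → b ≡ true → b ∧ not c ≡ false → c ≡ true
      stays true true _ _ = refl
    ...   | true with any-true⁻ (λ u → reach (suc k) E u v ∧ not (reach k E u v)) (allFin n) eq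
    ...     | u , _ , q with ∧-true {reach (suc k) E u v} q
    ...       | new , old = inj₂ (≤-trans (s≤s large)
      (card-insert {χ = λ u → reach k E u v} {λ u → reach (suc k) E u v} {u} (not-true old) new (λ w → reach-suc k E w v)))
      where
      not-true : ∀ {b} → not b ≡ true → b ≡ false
      not-true {false} _ = refl

    reach-≤ : ∀ {j k} → j ≤ k → ∀ u → reach j E u v ≡ true → reach k E u v ≡ true
    reach-≤ {j} j≤k u h with m≤n⇒∃[o]m+o≡n j≤k
    ... | o , refl = go o
      where
      go : ∀ o → reach (j + o) E u v ≡ true
      go zero    rewrite +-identityʳ j = h
      go (suc o) rewrite +-suc j o = reach-suc (j + o) E u v (go o)

  reach-complete : ∀ u → lab E u ≡ lab E v → reach n E u v ≡ true
  reach-complete u e with stable-or-large n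
  ... | inj₂ large = contradiction (≤-trans large (≤-trans (m≤m+n _ _)
          (≤-reflexive (card-not (λ u → reach n E u v))))) (<-irrefl refl)
  ... | inj₁ (j , j≤n , stable) = reach-≤ j≤n u (trans
    (lab-universal (λ w → reach j E w v) E (All.tabulate invariant) e) (reach-refl j E v))
    where
    invariant : ∀ {e} → e ∈ E → reach j E (proj₁ e) v ≡ reach j E (proj₂ e) v
    invariant {a , b} m with reach j E a v in p | reach j E b v in q
    ... | true  | true  = refl
    ... | false | false = refl
    ... | true  | false = true≢false (stable b (proj₂ (reach-edge j v m) p)) q
    ... | false | true  = true≢false (stable a (proj₁ (reach-edge j v m) q)) p

module _ {n : ℕ} where

  connected-intro : ∀ {E : List (Edge n)} → (∀ u v → lab E u ≡ lab E v) → connected E ≡ true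
  connected-intro {E} h = all-true _ (allFin n) (λ {u} _ → all-true _ (allFin n) (λ {v} _ →
    reach-complete E v u (h u v)))

  connected-elim : ∀ {X : Set} {E : List (Edge n)} → connected E ≡ true →
    (f : Fin n → X) → All (λ e → f (proj₁ e) ≡ f (proj₂ e)) E → ∀ u v → f u ≡ f v
  connected-elim {E = E} h f inv u v = reach-invariant f n E inv u v
    (all-true⁻ _ (allFin n) (all-true⁻ (λ u → all (λ v → reach n E u v) (allFin n)) (allFin n) h (∈-allFin u))
      (∈-allFin v))

  connected-mono : ∀ {E E′ : List (Edge n)} → E ⊑ E′ → connected E ≡ true → connected E′ ≡ true
  connected-mono {E} {E′} h c = connected-intro (connected-elim c (lab E′) (joined h))

  card≤1⁻ : ∀ {χ : Fin n → Bool} → card χ ≤ 1 → ∀ {i j} → χ i ≡ true → χ j ≡ true → i ≡ j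
  card≤1⁻ {χ} h {i} {j} p q with i ≟F j
  ... | yes e = e
  ... | no ¬e = contradiction (≤-trans (≤-trans (≤-reflexive (cong suc (sym (card-single i))))
      (card-insert {χ = i ==_} {χ} {j} (==-false ¬e) q (λ k e → subst (λ k → χ k ≡ true) (==-true⁻ e) p))) h)
      (<-irrefl refl)

  rank≤length : ∀ (E : List (Edge n)) → rank E ≤ length E
  rank≤length []      = z≤n
  rank≤length (e ∷ E) = +-mono-≤ (δ≤1 E e) (rank≤length E)

  -- Were the ends of some edge still joined after its deletion, the rank would not drop, and the
  -- remaining `length E - 1` edges would have rank at least `length E`.
  spanningTree-intro : ∀ (E : List (Edge n)) → n ≤ suc (rank E) → length E ≤ rank E → spanningTree E ≡ true
  spanningTree-intro E n≤ ℓ≤ = cong₂ _∧_ (connected-intro one-label) (acyclic-intro E bridge)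
    where
    one-root : card (root E) ≤ 1
    one-root = +-cancelʳ-≤ (rank E) _ _ (≤-trans (≤-reflexive (roots+rank E)) n≤)
    one-label : ∀ u v → lab E u ≡ lab E v
    one-label u v = card≤1⁻ one-root (==-true (lab-idem E u)) (==-true (lab-idem E v))
    bridge : ∀ {e p} → At e E p → reach n (dropAt p E) (proj₁ e) (proj₂ e) ≡ false
    bridge {e} {p} at with reach n (dropAt p E) (proj₁ e) (proj₂ e) in eq
    ... | false = refl
    ... | true  = contradiction too-small (<-irrefl refl)
      where
      open ≤-Reasoning
      D = dropAt p E
      perm = dropAt-↭ at
      δ≡0 : δ D e ≡ 0
      δ≡0 rewrite ==-true {i = lab D (proj₁ e)} (reach-invariant (lab D) n D (joined (⊑-refl D)) _ _ eq) = refl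
      too-small : length E < length E
      too-small = begin
        suc (length E)     ≤⟨ s≤s ℓ≤ ⟩
        suc (rank E)       ≤⟨ s≤s (rank-mono (⊑-⊆ (Perm.∈-resp-↭ perm))) ⟩
        suc (δ D e + rank D) ≡⟨ cong (λ k → suc (k + rank D)) δ≡0 ⟩
        suc (rank D)       ≤⟨ s≤s (rank≤length D) ⟩
        suc (length D)     ≡⟨ trans (length≡∑ (e ∷ D)) (trans (sym (∑-↭ _ perm)) (sym (length≡∑ E))) ⟩
        length E           ∎

_∪_ _∩_ : ∀ {m} → Vec Bool m → Vec Bool m → Vec Bool m
A ∪ B = Vec.zipWith _∨_ A B
A ∩ B = Vec.zipWith _∧_ A B

∁ : ∀ {m} → Vec Bool m → Vec Bool m
∁ = Vec.map not

∅ : ∀ {m} → Vec Bool m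
∅ {m} = Vec.replicate m false

∪-∅ : ∀ {m} (A : Vec Bool m) → A ∪ ∅ ≡ A
∪-∅ []          = refl
∪-∅ (true ∷ A)  = cong (true ∷_) (∪-∅ A)
∪-∅ (false ∷ A) = cong (false ∷_) (∪-∅ A)

∩-∅ : ∀ {m} (A : Vec Bool m) → A ∩ ∅ ≡ ∅
∩-∅ []          = refl
∩-∅ (true ∷ A)  = cong (false ∷_) (∩-∅ A)
∩-∅ (false ∷ A) = cong (false ∷_) (∩-∅ A)

∁-∪ : ∀ {m} (A B : Vec Bool m) → ∁ (A ∪ B) ≡ ∁ A ∩ ∁ B
∁-∪ []          []      = refl
∁-∪ (true ∷ A)  (b ∷ B) = cong (false ∷_) (∁-∪ A B)
∁-∪ (false ∷ A) (b ∷ B) = cong (not b ∷_) (∁-∪ A B)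

∁-∩ : ∀ {m} (A B : Vec Bool m) → ∁ (A ∩ B) ≡ ∁ A ∪ ∁ B
∁-∩ []          []      = refl
∁-∩ (true ∷ A)  (b ∷ B) = cong (not b ∷_) (∁-∩ A B)
∁-∩ (false ∷ A) (b ∷ B) = cong (true ∷_) (∁-∩ A B)

weight : ∀ {m} → Vec Bool m → ℕ
weight A = trues (toList A)

weight-∅ : ∀ m → weight (∅ {m}) ≡ 0
weight-∅ zero    = refl
weight-∅ (suc m) = weight-∅ m

-- Rank functions of matroids up to an additive constant, so that contracting an element e
-- is just the restriction of r to the sets containing e.
record Rank {m} (r : Vec Bool m → ℕ) : Set where
  field
    submodular : ∀ A B → r (A ∪ B) + r (A ∩ B) ≤ r A + r B
    unit       : ∀ A B → r (A ∪ B) ≤ r A + weight B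

open Rank public

delete : ∀ {m r} → Rank {suc m} r → Rank (r ∘ (false ∷_))
delete R .submodular A B = submodular R (false ∷ A) (false ∷ B)
delete R .unit A B       = unit R (false ∷ A) (false ∷ B)

contract : ∀ {m r} → Rank {suc m} r → Rank (r ∘ (true ∷_))
contract R .submodular A B = submodular R (true ∷ A) (true ∷ B)
contract R .unit A B       = unit R (true ∷ A) (false ∷ B)

loop : ∀ {m r} → Rank {suc m} r → r (true ∷ ∅) ≤ r (false ∷ ∅) → ∀ A → r (true ∷ A) ≤ r (false ∷ A)
loop {r = r} R l A = +-cancelʳ-≤ (r (false ∷ ∅)) _ _ (begin
  r (true ∷ A) + r (false ∷ ∅)
    ≡⟨ cong₂ (λ B C → r (true ∷ B) + r (false ∷ C)) (∪-∅ A) (∩-∅ A) ⟨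
  r ((false ∷ A) ∪ (true ∷ ∅)) + r ((false ∷ A) ∩ (true ∷ ∅))
    ≤⟨ submodular R (false ∷ A) (true ∷ ∅) ⟩
  r (false ∷ A) + r (true ∷ ∅)
    ≤⟨ +-monoʳ-≤ (r (false ∷ A)) l ⟩
  r (false ∷ A) + r (false ∷ ∅) ∎)
  where open ≤-Reasoning

non-loop : ∀ {m r} → Rank {suc m} r → r (true ∷ ∅) ≤ suc (r (false ∷ ∅))
non-loop {m} {r} R = begin
  r (true ∷ ∅)                       ≡⟨ cong (λ B → r (true ∷ B)) (∪-∅ ∅) ⟨
  r ((false ∷ ∅) ∪ (true ∷ ∅))       ≤⟨ unit R (false ∷ ∅) (true ∷ ∅) ⟩
  r (false ∷ ∅) + suc (weight (∅ {m})) ≡⟨ cong (λ k → r (false ∷ ∅) + suc k) (weight-∅ m) ⟩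
  r (false ∷ ∅) + 1                  ≡⟨ +-comm _ 1 ⟩
  suc (r (false ∷ ∅))                ∎
  where open ≤-Reasoning

-- A set of weight `k` is independent if it raises the rank by `k`. The terms `r ∅` are there
-- because contraction shifts the rank functions by constants.
CommonIndependent : ∀ {m} (r₁ r₂ : Vec Bool m → ℕ) → ℕ → Set
CommonIndependent r₁ r₂ k = ∃[ I ] weight I ≡ k × k + r₁ ∅ ≤ r₁ I × k + r₂ ∅ ≤ r₂ I

Obstruction : ∀ {m} (r₁ r₂ : Vec Bool m → ℕ) → ℕ → Set
Obstruction r₁ r₂ k = ∃[ A ] r₁ A + r₂ (∁ A) < k + (r₁ ∅ + r₂ ∅)

-- Induction on the ground set. If the first element is a loop of one matroid, an obstruction of the
-- deletion extends by giving the element to that matroid's side. Otherwise the deletion has an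
-- obstruction `A` and the contraction an obstruction `B`, unless one of them provides the
-- independent set. By submodularity the values of `A ∪ B` with the element and of `A ∩ B` without
-- it sum to less than twice the bound, so one of these is an obstruction.
matroid-intersection : ∀ m {r₁ r₂ : Vec Bool m → ℕ} → Rank r₁ → Rank r₂ → ∀ k →
  CommonIndependent r₁ r₂ k ⊎ Obstruction r₁ r₂ k
matroid-intersection m R₁ R₂ zero = inj₁ (∅ , weight-∅ m , ≤-refl , ≤-refl)
matroid-intersection zero    {r₁} {r₂} R₁ R₂ (suc k) = inj₂ ([] , s≤s (m≤n+m _ k))
matroid-intersection (suc m) {r₁} {r₂} R₁ R₂ k@(suc k-1)
  with matroid-intersection m (delete R₁) (delete R₂) k
... | inj₁ (I , w , p , q) = inj₁ (false ∷ I , w , p , q)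
... | inj₂ (A , a) with r₁ (true ∷ ∅) ≤? r₁ (false ∷ ∅)
...   | yes l₁ = inj₂ (true ∷ A , ≤-trans (s≤s (+-monoˡ-≤ _ (loop R₁ l₁ A))) a)
...   | no ¬l₁ with r₂ (true ∷ ∅) ≤? r₂ (false ∷ ∅)
...     | yes l₂ = inj₂ (false ∷ A , ≤-trans (s≤s (+-monoʳ-≤ (r₁ (false ∷ A)) (loop R₂ l₂ (∁ A)))) a)
...     | no ¬l₂ with matroid-intersection m (contract R₁) (contract R₂) k-1
...       | inj₁ (I , w , p , q) = inj₁ (true ∷ I , cong suc w
  , ≤-trans (≤-trans (≤-reflexive (sym (+-suc k-1 _))) (+-monoʳ-≤ k-1 (≰⇒> ¬l₁))) p
  , ≤-trans (≤-trans (≤-reflexive (sym (+-suc k-1 _))) (+-monoʳ-≤ k-1 (≰⇒> ¬l₂))) q)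
...       | inj₂ (B , b) with r₁ (true ∷ A ∪ B) + r₂ (false ∷ ∁ (A ∪ B)) <? k + (r₁ ∅ + r₂ ∅)
...         | yes h = inj₂ (true ∷ A ∪ B , h)
...         | no ¬h with r₁ (false ∷ A ∩ B) + r₂ (true ∷ ∁ (A ∩ B)) <? k + (r₁ ∅ + r₂ ∅)
...           | yes h = inj₂ (false ∷ A ∩ B , h)
...           | no ¬g = contradiction uncrossed (<-irrefl refl)
  where
  open ≤-Reasoning
  c = k + (r₁ ∅ + r₂ ∅)
  lemma₁ : ∀ x y z w → x + y + (z + w) ≡ x + z + (w + y)
  lemma₁ = solve-∀
  lemma₂ : ∀ x y z w → x + y + (z + w) ≡ x + z + (y + w)
  lemma₂ = solve-∀
  lemma₃ : ∀ k x y → k + (suc x + suc y) ≡ suc (suc k + (x + y))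
  lemma₃ = solve-∀
  -- Contraction raises each `r ∅` by at most one and lowers the target by one, so an obstruction of
  -- the contraction still satisfies the bound `c`, though not strictly. The strictness in `a` is
  -- enough for the sum.
  b′ : r₁ (true ∷ B) + r₂ (true ∷ ∁ B) ≤ c
  b′ = ≤-pred (≤-trans b (≤-trans
    (+-monoʳ-≤ k-1 (+-mono-≤ (non-loop R₁) (non-loop R₂))) (≤-reflexive (lemma₃ k-1 _ _))))
  uncrossed : c + c < c + c
  uncrossed = begin-strict
    c + c
      ≤⟨ +-mono-≤ (≮⇒≥ ¬h) (≮⇒≥ ¬g) ⟩
    r₁ (true ∷ A ∪ B) + r₂ (false ∷ ∁ (A ∪ B)) + (r₁ (false ∷ A ∩ B) + r₂ (true ∷ ∁ (A ∩ B)))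
      ≡⟨ lemma₁ (r₁ (true ∷ A ∪ B)) _ _ _ ⟩
    r₁ (true ∷ A ∪ B) + r₁ (false ∷ A ∩ B) + (r₂ (true ∷ ∁ (A ∩ B)) + r₂ (false ∷ ∁ (A ∪ B)))
      ≡⟨ cong₂ (λ U V → r₁ (true ∷ A ∪ B) + r₁ (false ∷ A ∩ B) + (r₂ (true ∷ U) + r₂ (false ∷ V)))
           (∁-∩ A B) (∁-∪ A B) ⟩
    r₁ (true ∷ A ∪ B) + r₁ (false ∷ A ∩ B) + (r₂ (true ∷ ∁ A ∪ ∁ B) + r₂ (false ∷ ∁ A ∩ ∁ B))
      ≤⟨ +-mono-≤ (submodular R₁ (false ∷ A) (true ∷ B)) (submodular R₂ (false ∷ ∁ A) (true ∷ ∁ B)) ⟩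
    r₁ (false ∷ A) + r₁ (true ∷ B) + (r₂ (false ∷ ∁ A) + r₂ (true ∷ ∁ B))
      ≡⟨ lemma₂ (r₁ (false ∷ A)) _ _ _ ⟩
    r₁ (false ∷ A) + r₂ (false ∷ ∁ A) + (r₁ (true ∷ B) + r₂ (true ∷ ∁ B))
      <⟨ +-mono-<-≤ a b′ ⟩
    c + c ∎

sel : ∀ {A : Set} {m} → Vec Bool m → List A → List A
sel b = select (toList b)

module _ {A : Set} {P : A → Set} where

  sel-∪ : ∀ {m} (B C : Vec Bool m) xs → All P (sel B xs) → All P (sel C xs) → All P (sel (B ∪ C) xs)
  sel-∪ []          []          xs       _        _        = []
  sel-∪ (_ ∷ B)     (_ ∷ C)     []       _        _        = []
  sel-∪ (true ∷ B)  (true ∷ C)  (x ∷ xs) (p ∷ ps) (_ ∷ qs) = p ∷ sel-∪ B C xs ps qs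
  sel-∪ (true ∷ B)  (false ∷ C) (x ∷ xs) (p ∷ ps) qs       = p ∷ sel-∪ B C xs ps qs
  sel-∪ (false ∷ B) (true ∷ C)  (x ∷ xs) ps       (q ∷ qs) = q ∷ sel-∪ B C xs ps qs
  sel-∪ (false ∷ B) (false ∷ C) (x ∷ xs) ps       qs       = sel-∪ B C xs ps qs

  sel-∩ˡ : ∀ {m} (B C : Vec Bool m) xs → All P (sel B xs) → All P (sel (B ∩ C) xs)
  sel-∩ˡ []          []          xs       _        = []
  sel-∩ˡ (_ ∷ B)     (_ ∷ C)     []       _        = []
  sel-∩ˡ (true ∷ B)  (true ∷ C)  (x ∷ xs) (p ∷ ps) = p ∷ sel-∩ˡ B C xs ps
  sel-∩ˡ (true ∷ B)  (false ∷ C) (x ∷ xs) (p ∷ ps) = sel-∩ˡ B C xs ps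
  sel-∩ˡ (false ∷ B) (_ ∷ C)     (x ∷ xs) ps       = sel-∩ˡ B C xs ps

  sel-∩ʳ : ∀ {m} (B C : Vec Bool m) xs → All P (sel C xs) → All P (sel (B ∩ C) xs)
  sel-∩ʳ []          []          xs       _        = []
  sel-∩ʳ (_ ∷ B)     (_ ∷ C)     []       _        = []
  sel-∩ʳ (true ∷ B)  (true ∷ C)  (x ∷ xs) (p ∷ ps) = p ∷ sel-∩ʳ B C xs ps
  sel-∩ʳ (true ∷ B)  (false ∷ C) (x ∷ xs) ps       = sel-∩ʳ B C xs ps
  sel-∩ʳ (false ∷ B) (true ∷ C)  (x ∷ xs) (p ∷ ps) = sel-∩ʳ B C xs ps
  sel-∩ʳ (false ∷ B) (false ∷ C) (x ∷ xs) ps       = sel-∩ʳ B C xs ps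

length-select≤ : ∀ {A : Set} b (xs : List A) → length (select b xs) ≤ trues b
length-select≤ []          xs       = z≤n
length-select≤ (_ ∷ b)     []       = z≤n
length-select≤ (true ∷ b)  (x ∷ xs) = s≤s (length-select≤ b xs)
length-select≤ (false ∷ b) (x ∷ xs) = length-select≤ b xs

sel-∅ : ∀ {A : Set} m (xs : List A) → sel (∅ {m}) xs ≡ []
sel-∅ zero    xs       = refl
sel-∅ (suc m) []       = refl
sel-∅ (suc m) (x ∷ xs) = sel-∅ m xs

⊑-++-join : ∀ {n} {X Y Z : List (Edge n)} → X ⊑ Z → Y ⊑ Z → (X ++ Y) ⊑ Z
⊑-++-join ⟪ h ⟫ ⟪ g ⟫ = ⟪ All.++⁺ h g ⟫

sel-∪-⊑ : ∀ {n m} (A B : Vec Bool m) (E : List (Edge n)) → sel (A ∪ B) E ⊑ (sel B E ++ sel A E)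
sel-∪-⊑ A B E = ⟪ sel-∪ A B E (joined (⊑-++ʳ (sel B E) (⊑-refl (sel A E))))
                      (All.++⁻ˡ (sel B E) (joined (⊑-refl (sel B E ++ sel A E)))) ⟫

graphic : ∀ {n} (E : List (Edge n)) {m} → Rank {m} (λ b → rank (sel b E))
graphic E .submodular A B = begin
  rank (sel (A ∪ B) E) + rank (sel (A ∩ B) E)
    ≤⟨ +-monoˡ-≤ _ (rank-mono (sel-∪-⊑ A B E)) ⟩
  rank (SB ++ SA) + rank (sel (A ∩ B) E)
    ≤⟨ rank-submodular SB ⟪ sel-∩ˡ A B E (joined (⊑-refl SA)) ⟫ ⟩
  rank (SB ++ sel (A ∩ B) E) + rank SA
    ≤⟨ +-monoˡ-≤ _ (rank-mono (⊑-++-join (⊑-refl SB) ⟪ sel-∩ʳ A B E (joined (⊑-refl SB)) ⟫)) ⟩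
  rank SB + rank SA
    ≡⟨ +-comm (rank SB) _ ⟩
  rank SA + rank SB ∎
  where
  open ≤-Reasoning
  SA = sel A E
  SB = sel B E
graphic E .unit A B = begin
  rank (sel (A ∪ B) E)
    ≤⟨ rank-mono (sel-∪-⊑ A B E) ⟩
  rank (SB ++ SA)     ≤⟨ rank-++ SB SA ⟩
  length SB + rank SA ≤⟨ +-monoˡ-≤ _ (length-select≤ (toList B) E) ⟩
  weight B + rank SA  ≡⟨ +-comm (weight B) _ ⟩
  rank SA + weight B  ∎
  where
  open ≤-Reasoning
  SA = sel A E
  SB = sel B E

-- A common independent set of size `k`, one less than the number of vertices, is a spanning tree in
-- both graphs.
multiTree-or-obstruction : ∀ {k} m (E₁ E₂ : List (Edge (suc k))) →
  (∃[ I ] multiTree E₁ E₂ (toList {n = m} I) ≡ true) ⊎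
  (∃[ A ] rank (sel {m = m} A E₁) + rank (sel (∁ A) E₂) < k)
multiTree-or-obstruction {k} m E₁ E₂ with matroid-intersection m (graphic E₁) (graphic E₂) k
... | inj₁ (I , w , p , q) = inj₁ (I , cong₂ _∧_ (tree E₁ p) (tree E₂ q))
  where
  tree : ∀ E → k + rank (sel (∅ {m}) E) ≤ rank (sel I E) → spanningTree (sel I E) ≡ true
  tree E p = spanningTree-intro (sel I E) (s≤s k≤)
    (≤-trans (length-select≤ (toList I) E) (≤-trans (≤-reflexive w) k≤))
    where
    k≤ : k ≤ rank (sel I E)
    k≤ = ≤-trans (m≤m+n k _) p
... | inj₂ (A , h) = inj₂ (A , ≤-trans h (≤-reflexive zero-rank))
  where
  zero-rank : k + (rank (sel (∅ {m}) E₁) + rank (sel (∅ {m}) E₂)) ≡ k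
  zero-rank rewrite sel-∅ m E₁ | sel-∅ m E₂ = +-identityʳ k

firstFrom-spec : ∀ k m p {j} → m ≤ j → j < m + k → p j ≡ true →
  ∃[ a ] firstFrom k m p ≡ just a × p a ≡ true × a ≤ j × (∀ i → m ≤ i → p i ≡ true → a ≤ i)
firstFrom-spec zero    m p m≤j j< h = contradiction (≤-trans j< (≤-reflexive (+-identityʳ m))) (≤⇒≯ m≤j)
firstFrom-spec (suc k) m p {j} m≤j j< h with p m in eq
... | true  = m , refl , eq , m≤j , λ i m≤i _ → m≤i
... | false with firstFrom-spec k (suc m) p (≤∧≢⇒< m≤j (λ { refl → true≢false h eq }))
                   (≤-trans j< (≤-reflexive (+-suc m k))) h
...   | a , e , q , a≤j , least = a , e , q , a≤j , λ i m≤i r →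
          least i (≤∧≢⇒< m≤i (λ { refl → true≢false r eq })) r

minM-spec : ∀ N p {j} → j < N → p j ≡ true →
  ∃[ a ] minM N p ≡ just a × p a ≡ true × a ≤ j × (∀ i → p i ≡ true → a ≤ i)
minM-spec N p j<N h with firstFrom-spec N 0 p z≤n j<N h
... | a , e , q , a≤j , least = a , e , q , a≤j , λ i → least i z≤n

∈-subsets : ∀ {m} (I : Vec Bool m) → toList I ∈ subsets m
∈-subsets []      = here refl
∈-subsets (b ∷ I) = Mem.∈-concatMap⁺ _ (Any-map (∈-subsets I) (choice b))
  where
  choice : ∀ b → (b ∷ toList I) ∈ ((true ∷ toList I) ∷ (false ∷ toList I) ∷ [])
  choice true  = here refl
  choice false = there (here refl)
  Any-map : ∀ {A : Set} {P : A → Set} {x xs} → x ∈ xs → P x → Any P xs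
  Any-map (here refl) p = here p
  Any-map (there m)   p = there (Any-map m p)

subsets-length : ∀ m → All (λ I → length I ≡ m) (subsets m)
subsets-length zero    = refl ∷ []
subsets-length (suc m) = All.concat⁺ (All.map⁺ (All.map (λ e → cong suc e ∷ cong suc e ∷ []) (subsets-length m)))

take-select : ∀ {A : Set} {P : A → Set} I (xs : List A) → All P (take (length I) xs) → All P (select I xs)
take-select []          xs       _        = []
take-select (_ ∷ I)     []       _        = []
take-select (true ∷ I)  (x ∷ xs) (p ∷ ps) = p ∷ take-select I xs ps
take-select (false ∷ I) (x ∷ xs) (p ∷ ps) = take-select I xs ps

take-mono : ∀ {A : Set} {P : A → Set} {i j} → i ≤ j → ∀ (xs : List A) → All P (take j xs) → All P (take i xs)
take-mono z≤n     xs       _        = []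
take-mono (s≤s h) []       _        = []
take-mono (s≤s h) (x ∷ xs) (p ∷ ps) = p ∷ take-mono h xs ps

select-⊑-take : ∀ {n} I (σ : List (Edge n)) → select I σ ⊑ take (length I) σ
select-⊑-take I σ = ⟪ take-select I σ (joined (⊑-refl (take (length I) σ))) ⟫

take-⊑ : ∀ {n i j} → i ≤ j → (σ : List (Edge n)) → take i σ ⊑ take j σ
take-⊑ {j = j} h σ = ⟪ take-mono h σ (joined (⊑-refl (take j σ))) ⟫

-- This half of the theorem holds for all pairs of orderings: a MultiTree is never earlier than
-- either connectivity time.
containsMT-connected : ∀ {n} (σ₁ σ₂ : List (Edge n)) m → containsMT σ₁ σ₂ m ≡ true →
  connected (take m σ₁) ≡ true × connected (take m σ₂) ≡ true
containsMT-connected σ₁ σ₂ m h with any-true⁻ (multiTree σ₁ σ₂) (subsets m) h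
... | I , I∈ , t with ∧-true {spanningTree (select I σ₁)} t | All.lookup (subsets-length m) I∈
...   | t₁ , t₂ | refl =
  connected-mono (select-⊑-take I σ₁) (proj₁ (∧-true {connected (select I σ₁)} t₁)) ,
  connected-mono (select-⊑-take I σ₂) (proj₁ (∧-true {connected (select I σ₂)} t₂))

≡-isYes : ∀ {a b : ℕ} → a ≡ b → isYes (a ℕ.≟ b) ≡ true
≡-isYes {a} {b} e with a ℕ.≟ b
... | yes _ = refl
... | no ¬e = contradiction e ¬e

-- The larger connectivity time is the only index at which a MultiTree has to be found. All that is
-- known of it is that it lies between `m₀` and `m₁`, so `mt` covers this whole window.
goodEvent-intro : ∀ n (σ₁ σ₂ : List (Edge n)) m₀ m₁ → m₁ < Nn n →
  connected (take m₁ σ₁) ≡ true → connected (take m₁ σ₂) ≡ true → connected (take m₀ σ₁) ≡ false →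
  (∀ M → m₀ ≤ M → M ≤ m₁ → connected (take M σ₁) ≡ true → connected (take M σ₂) ≡ true →
    containsMT σ₁ σ₂ M ≡ true) →
  goodEvent n σ₁ σ₂ ≡ true
goodEvent-intro n σ₁ σ₂ m₀ m₁ m₁<N c₁ c₂ d mt
  with minM-spec (Nn n) (λ m → connected (take m σ₁)) m₁<N c₁
     | minM-spec (Nn n) (λ m → connected (take m σ₂)) m₁<N c₂
... | a , ea , pa , a≤ , leasta | b , eb , pb , b≤ , leastb
  with minM-spec (Nn n) (containsMT σ₁ σ₂) {a ⊔ b} (≤-trans (s≤s (⊔-lub a≤ b≤)) m₁<N)
         (mt (a ⊔ b) m₀≤ (⊔-lub a≤ b≤)
           (connected-mono (take-⊑ (m≤m⊔n a b) σ₁) pa) (connected-mono (take-⊑ (m≤n⊔m a b) σ₂) pb))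
  where
  m₀≤ : m₀ ≤ a ⊔ b
  m₀≤ with ≤-total m₀ a
  ... | inj₁ h = ≤-trans h (m≤m⊔n a b)
  ... | inj₂ h = true≢false (connected-mono (take-⊑ h σ₁) pa) d
... | s , es , ps , s≤ , leasts rewrite es | ea | eb = ≡-isYes (≤-antisym s≤
  (⊔-lub (leasta s (proj₁ (containsMT-connected σ₁ σ₂ s ps))) (leastb s (proj₂ (containsMT-connected σ₁ σ₂ s ps)))))

containsMT-intro : ∀ {n m} (σ₁ σ₂ : List (Edge n)) (I : Vec Bool m) →
  multiTree σ₁ σ₂ (toList I) ≡ true → containsMT σ₁ σ₂ m ≡ true
containsMT-intro {m = m} σ₁ σ₂ I h = any-true (multiTree σ₁ σ₂) (subsets m) (∈-subsets I) h

-- The deterministic argument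

xor-same : ∀ {a b} → a ≡ b → a xor b ≡ false
xor-same {true}  refl = refl
xor-same {false} refl = refl

xor-false : ∀ {a b} → a xor b ≡ false → a ≡ b
xor-false {true}  {true}  _ = refl
xor-false {false} {false} _ = refl

∧-false-right : ∀ {a b} → a ≡ true → a ∧ b ≡ false → b ≡ false
∧-false-right refl h = h

not-injective-false : ∀ {b} → not b ≡ false → b ≡ true
not-injective-false {true} _ = refl

not-true⁻ : ∀ {b} → not b ≡ true → b ≡ false
not-true⁻ {false} _ = refl

∨-introˡ : ∀ {a} b → a ≡ true → a ∨ b ≡ true
∨-introˡ b refl = refl

∨-introʳ : ∀ a {b} → b ≡ true → a ∨ b ≡ true
∨-introʳ true  _ = refl
∨-introʳ false h = h

∑𝟙≤0 : ∀ {A : Set} (p : A → Bool) xs → ∑ xs (𝟙 ∘ p) ≤ 0 → All (λ x → p x ≡ false) xs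
∑𝟙≤0 p []       h = []
∑𝟙≤0 p (x ∷ xs) h with p x in eq
... | false = eq ∷ ∑𝟙≤0 p xs h

pair : ∀ {n} → Fin n → Fin n → Fin n → Bool
pair u w x = (u == x) ∨ (w == x)

card-pair≤2 : ∀ {n} (u w : Fin n) → card (pair u w) ≤ 2
card-pair≤2 u w = ≤-trans (card-∨ (u ==_) (w ==_))
  (≤-reflexive (cong₂ _+_ (card-single u) (card-single w)))

lab-∷-cases : ∀ {n} (a b : Fin n) E {u w} → lab ((a , b) ∷ E) u ≡ lab ((a , b) ∷ E) w →
  lab E u ≡ lab E w ⊎
  ((lab E u ≡ lab E a ⊎ lab E u ≡ lab E b) × (lab E w ≡ lab E a ⊎ lab E w ≡ lab E b))
lab-∷-cases a b E {u} {w} h with lab E u ≟F lab E b | lab E w ≟F lab E b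
... | yes p | yes q = inj₁ (trans p (sym q))
... | yes p | no _  = inj₂ (inj₂ p , inj₁ (sym h))
... | no _  | yes q = inj₂ (inj₁ h , inj₂ q)
... | no _  | no _  = inj₁ h

Irreflexive : ∀ {n} → List (Edge n) → Set
Irreflexive E = All (λ e → ¬ proj₁ e ≡ proj₂ e) E

record Matching {n} (J : List (Edge n)) : Set where
  constructor matching
  field degree≤1 : ∀ (v : Fin n) → ∑ J (𝟙 ∘ cross (v ==_)) ≤ 1

open Matching public

cross-left : ∀ {n} {a b : Fin n} → ¬ a ≡ b → cross (a ==_) (a , b) ≡ true
cross-left {a = a} ¬e rewrite ==-true {i = a} refl | ==-false ¬e = refl

cross-right : ∀ {n} {a b : Fin n} → ¬ a ≡ b → cross (b ==_) (a , b) ≡ true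
cross-right {a = a} {b} ¬e rewrite ==-true {i = b} refl | ==-false {i = b} {a} (¬e ∘ sym) = refl

module _ {n : ℕ} where

  private
    isolated : ∀ (v : Fin n) J → ∑ J (𝟙 ∘ cross (v ==_)) ≤ 0 → ∀ {u} → lab J u ≡ lab J v → u ≡ v
    isolated v J h e = sym (==-true⁻ (trans
      (lab-universal (v ==_) J (All.map xor-false (∑𝟙≤0 _ J h)) e) (==-true refl)))

    rest≤0 : ∀ v (e : Edge n) J → cross (v ==_) e ≡ true → ∑ (e ∷ J) (𝟙 ∘ cross (v ==_)) ≤ 1 →
      ∑ J (𝟙 ∘ cross (v ==_)) ≤ 0
    rest≤0 v e J c h rewrite c = ≤-pred h

    tail-matching : ∀ {e : Edge n} {J} → Matching (e ∷ J) → Matching J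
    tail-matching {e} M .degree≤1 v = ≤-trans (m≤n+m _ (𝟙 (cross (v ==_) e))) (degree≤1 M v)

  module _ {a b : Fin n} {J} (a≢b : ¬ a ≡ b) (M : Matching ((a , b) ∷ J)) where

    matching-iso-left : ∀ {u} → lab J u ≡ lab J a → u ≡ a
    matching-iso-left = isolated a J (rest≤0 a (a , b) J (cross-left a≢b) (degree≤1 M a))

    matching-iso-right : ∀ {u} → lab J u ≡ lab J b → u ≡ b
    matching-iso-right = isolated b J (rest≤0 b (a , b) J (cross-right a≢b) (degree≤1 M b))

    matching-ends : ∀ {u} → lab J u ≡ lab J a ⊎ lab J u ≡ lab J b → u ≡ a ⊎ u ≡ b
    matching-ends (inj₁ e) = inj₁ (matching-iso-left e)
    matching-ends (inj₂ e) = inj₂ (matching-iso-right e)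

  matching-rank : ∀ {J : List (Edge n)} → Irreflexive J → Matching J → rank J ≡ length J
  matching-rank {[]}          _          M = refl
  matching-rank {(a , b) ∷ J} (a≢b ∷ irr) M
    rewrite ==-false {i = lab J a} {lab J b} (λ e → a≢b (matching-iso-right a≢b M e)) =
    cong suc (matching-rank irr (tail-matching M))

  matching-class : ∀ {J : List (Edge n)} → Irreflexive J → Matching J →
    ∀ u → card (λ w → lab J w == lab J u) ≤ 2
  matching-class {[]}          _           M u = ≤-trans (≤-trans
    (card-mono {χ = λ w → w == u} {u ==_} (λ w h → ==-true (sym (==-true⁻ h)))) (≤-reflexive (card-single u))) (s≤s z≤n)
  matching-class {(a , b) ∷ J} (a≢b ∷ irr) M u with u ≟F a | u ≟F b
  ... | yes refl | _ = ≤-trans (card-mono {ψ = pair a b} ends) (card-pair≤2 a b)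
    where
    ends : ∀ w → (lab ((a , b) ∷ J) w == lab ((a , b) ∷ J) a) ≡ true → pair a b w ≡ true
    ends w h with lab-∷-cases a b J (==-true⁻ h)
    ... | inj₁ e = ∨-introˡ _ (==-true (sym (matching-iso-left a≢b M e)))
    ... | inj₂ (e , _) with matching-ends a≢b M {w} e
    ...   | inj₁ p = ∨-introˡ _ (==-true (sym p))
    ...   | inj₂ p = ∨-introʳ (a == w) (==-true (sym p))
  ... | no _ | yes refl = ≤-trans (card-mono {ψ = pair a b} ends) (card-pair≤2 a b)
    where
    ends : ∀ w → (lab ((a , b) ∷ J) w == lab ((a , b) ∷ J) b) ≡ true → pair a b w ≡ true
    ends w h with lab-∷-cases a b J (==-true⁻ h)
    ... | inj₁ e = ∨-introʳ (a == w) (==-true (sym (matching-iso-right a≢b M e)))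
    ... | inj₂ (e , _) with matching-ends a≢b M {w} e
    ...   | inj₁ p = ∨-introˡ _ (==-true (sym p))
    ...   | inj₂ p = ∨-introʳ (a == w) (==-true (sym p))
  ... | no u≢a | no u≢b = ≤-trans (card-mono {ψ = λ w → lab J w == lab J u} old)
                            (matching-class irr (tail-matching M) u)
    where
    old : ∀ w → (lab ((a , b) ∷ J) w == lab ((a , b) ∷ J) u) ≡ true → (lab J w == lab J u) ≡ true
    old w h with lab-∷-cases a b J (==-true⁻ h)
    ... | inj₁ e = ==-true e
    ... | inj₂ (_ , e) with matching-ends a≢b M {u} e
    ...   | inj₁ p = contradiction p u≢a
    ...   | inj₂ p = contradiction p u≢b

  matching-edge : ∀ {J : List (Edge n)} → Irreflexive J → Matching J →
    ∀ {u w} → lab J u ≡ lab J w → ¬ u ≡ w → 1 ≤ ∑ J (𝟙 ∘ inside (pair u w))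
  matching-edge {[]}          _           M e u≢w = contradiction e u≢w
  matching-edge {(a , b) ∷ J} (a≢b ∷ irr) M {u} {w} e u≢w with lab-∷-cases a b J e
  ... | inj₁ e′ = ≤-trans (matching-edge irr (tail-matching M) e′ u≢w)
                    (m≤n+m _ (𝟙 (inside (pair u w) (a , b))))
  ... | inj₂ (p , q) with matching-ends a≢b M {u} p | matching-ends a≢b M {w} q
  ...   | inj₁ refl | inj₁ refl = contradiction refl u≢w
  ...   | inj₂ refl | inj₂ refl = contradiction refl u≢w
  ...   | inj₁ refl | inj₂ refl rewrite ==-true {i = a} refl | ==-true {i = b} refl
                                      | ∨-introʳ (a == b) {true} refl = s≤s z≤n
  ...   | inj₂ refl | inj₁ refl rewrite ==-true {i = a} refl | ==-true {i = b} refl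
                                      | ∨-introʳ (b == a) {true} refl = s≤s z≤n

  -- The vertices whose component in `J` grows when `X` is added, that is, the vertices that `X`
  -- occupies after contraction of `J`.
  grown : List (Edge n) → List (Edge n) → Fin n → Bool
  grown J X u = any (λ w → (lab (X ++ J) w == lab (X ++ J) u) ∧ not (lab J w == lab J u)) (allFin n)

  grown-intro : ∀ J X {u w} → lab (X ++ J) w ≡ lab (X ++ J) u → ¬ lab J w ≡ lab J u → grown J X u ≡ true
  grown-intro J X {u} {w} e ¬e = any-true _ (allFin n) (∈-allFin w)
    (cong₂ _∧_ (==-true e) (cong not (==-false ¬e)))

  grown-elim : ∀ J X {u} → grown J X u ≡ true →
    ∃[ w ] lab (X ++ J) w ≡ lab (X ++ J) u × ¬ lab J w ≡ lab J u
  grown-elim J X {u} h with any-true⁻ _ (allFin n) h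
  ... | w , _ , q with ∧-true {lab (X ++ J) w == lab (X ++ J) u} q
  ...   | p , r = w , ==-true⁻ p , λ e → true≢false (==-true e) (not-true⁻ r)

  -- When an edge of `X` raises the rank, only vertices in the `J`-components of its two ends can
  -- grow for the first time, and `class` bounds these by 2 + 2. Hence the factor 4 per unit of
  -- rank.
  grown-bound : ∀ J → (∀ u → card (λ w → lab J w == lab J u) ≤ 2) → ∀ X →
    card (grown J X) + 4 * rank J ≤ 4 * rank (X ++ J)
  grown-bound J class [] = +-monoˡ-≤ (4 * rank J) (≤-reflexive (trans
    (∑-cong (allFin n) (λ u → cong 𝟙 (none u))) (∑-zero (allFin n))))
    where
    none : ∀ u → grown J [] u ≡ false
    none u with grown J [] u in eq
    ... | false = refl
    ... | true with grown-elim J [] eq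
    ...   | _ , e , ¬e = contradiction e ¬e
  grown-bound J class ((a , b) ∷ X) with lab (X ++ J) a ≟F lab (X ++ J) b
  ... | yes p = ≤-trans (+-monoˡ-≤ (4 * rank J) (card-mono same)) (grown-bound J class X)
    where
    kernel : ∀ {u w} → lab ((a , b) ∷ X ++ J) u ≡ lab ((a , b) ∷ X ++ J) w → lab (X ++ J) u ≡ lab (X ++ J) w
    kernel e with lab-∷-cases a b (X ++ J) e
    ... | inj₁ q = q
    ... | inj₂ (inj₁ q , inj₁ r) = trans q (sym r)
    ... | inj₂ (inj₁ q , inj₂ r) = trans q (trans p (sym r))
    ... | inj₂ (inj₂ q , inj₁ r) = trans q (trans (sym p) (sym r))
    ... | inj₂ (inj₂ q , inj₂ r) = trans q (sym r)
    same : ∀ u → grown J ((a , b) ∷ X) u ≡ true → grown J X u ≡ true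
    same u h with grown-elim J ((a , b) ∷ X) h
    ... | w , e , ¬e = grown-intro J X (kernel e) ¬e
  ... | no _ = begin
    card (grown J ((a , b) ∷ X)) + 4 * rank J
      ≤⟨ +-monoˡ-≤ (4 * rank J) (card-mono split) ⟩
    card (λ u → grown J X u ∨ ((lab J u == lab J a) ∨ (lab J u == lab J b))) + 4 * rank J
      ≤⟨ +-monoˡ-≤ (4 * rank J) (≤-trans (card-∨ (grown J X) _)
           (+-monoʳ-≤ (card (grown J X)) (≤-trans (card-∨ (λ u → lab J u == lab J a) (λ u → lab J u == lab J b))
             (+-mono-≤ (class a) (class b))))) ⟩
    card (grown J X) + 4 + 4 * rank J
      ≡⟨ lemma (card (grown J X)) (4 * rank J) ⟩
    4 + (card (grown J X) + 4 * rank J)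
      ≤⟨ +-monoʳ-≤ 4 (grown-bound J class X) ⟩
    4 + 4 * rank (X ++ J)
      ≡⟨ *-suc 4 (rank (X ++ J)) ⟨
    4 * suc (rank (X ++ J)) ∎
    where
    open ≤-Reasoning
    lemma : ∀ g r → g + 4 + r ≡ 4 + (g + r)
    lemma = solve-∀
    E = X ++ J
    split : ∀ u → grown J ((a , b) ∷ X) u ≡ true →
      grown J X u ∨ ((lab J u == lab J a) ∨ (lab J u == lab J b)) ≡ true
    split u h with grown J X u in old
    ... | true  = refl
    ... | false with grown-elim J ((a , b) ∷ X) h
    ...   | w , e , ¬e with lab-∷-cases a b E e
    ...     | inj₁ q = true≢false (grown-intro J X q ¬e) old
    ...     | inj₂ (_ , ends) = at ends
      where
      stays : ∀ {v} → lab E u ≡ lab E v → lab J u ≡ lab J v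
      stays {v} q with lab J v ≟F lab J u
      ... | yes r = sym r
      ... | no ¬r = true≢false (grown-intro J X (sym q) ¬r) old
      at : lab E u ≡ lab E a ⊎ lab E u ≡ lab E b → (lab J u == lab J a) ∨ (lab J u == lab J b) ≡ true
      at (inj₁ q) = ∨-introˡ _ (==-true (stays q))
      at (inj₂ q) = ∨-introʳ (lab J u == lab J a) (==-true (stays q))

-- (i ∈ A, eᵢ, fᵢ) for an index i, where A is the obstruction.
Item : ℕ → Set
Item n = Bool × Edge n × Edge n

inA : ∀ {n} → Item n → Bool
inA = proj₁

e₁ e₂ : ∀ {n} → Item n → Edge n
e₁ (_ , e , _) = e
e₂ (_ , _ , f) = f

touch : ∀ {n} → (Fin n → Bool) → Edge n → Bool
touch χ (i , j) = χ i ∨ χ j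

module _ {A : Set} {n : ℕ} (e : A → Edge n) where

  sub : (A → Bool) → List A → List (Edge n)
  sub p its = map e (filterᵇ p its)

  ∈-sub : ∀ p {its it} → it ∈ its → p it ≡ true → e it ∈ sub p its
  ∈-sub p {x ∷ its} (here refl) h rewrite h = here refl
  ∈-sub p {x ∷ its} (there m) h with p x
  ... | true  = there (∈-sub p m h)
  ... | false = ∈-sub p m h

  All-sub : ∀ {P : Edge n → Set} p its → (∀ {it} → it ∈ its → p it ≡ true → P (e it)) → All P (sub p its)
  All-sub p []         h = []
  All-sub p (it ∷ its) h with p it in eq
  ... | true  = h (here refl) eq ∷ All-sub p its (h ∘ there)
  ... | false = All-sub p its (h ∘ there)

  sub-~ : ∀ p {its it} → it ∈ its → p it ≡ true → sub p its ~ e it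
  sub-~ p {its} m h = All.lookup (joined (⊑-refl (sub p its))) (∈-sub p m h)

  ∑-sub : ∀ p its f → ∑ (sub p its) f ≡ ∑ its (λ it → 𝟙 (p it) * f (e it))
  ∑-sub p its f = trans (∑-map e (filterᵇ p its) f) (∑-filterᵇ p its (f ∘ e))

  length-sub : ∀ p its → length (sub p its) ≡ ∑ its (𝟙 ∘ p)
  length-sub p its = trans (length≡∑ (sub p its)) (trans (∑-sub p its _) (∑-cong its (λ it → *-identityʳ _)))

inside-true : ∀ {n} {χ : Fin n → Bool} {e} → χ (proj₁ e) ≡ true → χ (proj₂ e) ≡ true → inside χ e ≡ true
inside-true p q = cong₂ _∧_ p q

-- What the argument needs of the two prefixes of a common length. The factor 4 in `4 * suc k` makes
-- room for the grown vertices, which may be four times as many as the at most `n/Y` vertices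
-- outside the large component. In `core`, `10 = 2 + 2 · 4`: sparsity in the small components uses
-- up 2, sparsity on the grown vertices twice 4.
record Typical {k : ℕ} (its : List (Item (suc k))) (K Y : ℕ) : Set where
  field
    L         : Fin (suc k) → Bool
    K>0       : 0 < K
    simple    : ∀ χ → card χ ≤ 2 → ∑ its (𝟙 ∘ inside χ ∘ e₁) ≤ 1
    loopless  : All (λ it → ¬ proj₁ (e₁ it) ≡ proj₂ (e₁ it)) its
    connected₂ : ∀ (χ : Fin (suc k) → Bool) → All (λ it → χ (proj₁ (e₂ it)) ≡ χ (proj₂ (e₂ it))) its →
      ∀ u v → χ u ≡ χ v
    sparse₁   : ∀ χ → card χ * Y ≤ 4 * suc k → ∑ its (𝟙 ∘ inside χ ∘ e₁) ≤ K * card χ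
    sparse₂   : ∀ χ → card χ * Y ≤ 4 * suc k → ∑ its (𝟙 ∘ inside χ ∘ e₂) ≤ K * card χ
    core      : ∀ v → L v ≡ false →
      10 * K ≤ ∑ its (λ it → 𝟙 (cross (v ==_) (e₂ it) ∧ inside (not ∘ L) (e₂ it)))
    disjoint  : ∀ v → ∑ its (λ it → 𝟙 (touch L (e₂ it) ∧ cross (v ==_) (e₁ it))) ≤ 1

module SmallRank {k : ℕ} {its : List (Item (suc k))} {K Y : ℕ} (typical : Typical its K Y) where
  open Typical typical

  private
    n : ℕ
    n = suc k
    inJ A∖J A∩J ¬A∪J : Item n → Bool
    inJ it  = touch L (e₂ it)
    A∖J it  = inA it ∧ not (inJ it)
    A∩J it  = inA it ∧ inJ it
    ¬A∪J it = not (inA it) ∨ inJ it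
    X JA E₁ E₂ E₂′ : List (Edge n)
    X   = sub e₁ A∖J its
    JA  = sub e₁ A∩J its
    E₁  = sub e₁ inA its
    E₂  = sub e₂ (not ∘ inA) its
    E₂′ = sub e₂ ¬A∪J its
    f j : ℕ
    f = ∑ its (𝟙 ∘ A∖J)
    j = ∑ its (𝟙 ∘ A∩J)
    Z : Fin n → Bool
    Z = grown JA X

    JA-irreflexive : Irreflexive JA
    JA-irreflexive = All-sub e₁ A∩J its (λ m _ → All.lookup loopless m)

    JA-matching : Matching JA
    JA-matching .degree≤1 v = ≤-trans (≤-reflexive (∑-sub e₁ A∩J its (𝟙 ∘ cross (v ==_))))
      (≤-trans (∑-mono its (λ it → step (inA it) (inJ it) (cross (v ==_) (e₁ it)))) (disjoint v))
      where
      step : ∀ a b c → 𝟙 (a ∧ b) * 𝟙 c ≤ 𝟙 (b ∧ c)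
      step true  true  c = ≤-reflexive (+-identityʳ _)
      step true  false c = z≤n
      step false b     c = z≤n

    -- Only an edge between two vertices already joined by the matching could fail to grow a
    -- component. It would be parallel to an edge of the matching by `matching-edge`, but every edge
    -- of the complete graph occurs only once, which is `simple`.
    X-grown : ∀ {it} → it ∈ its → A∖J it ≡ true → inside Z (e₁ it) ≡ true
    X-grown {it@(_ , (a , b) , _)} m h with lab JA a ≟F lab JA b
    ... | no ¬e = inside-true {χ = Z} {a , b} (grown-intro JA X (sym joined-ab) (¬e ∘ sym)) (grown-intro JA X joined-ab ¬e)
      where
      joined-ab : lab (X ++ JA) a ≡ lab (X ++ JA) b
      joined-ab = All.lookup (joined (⊑-refl (X ++ JA))) (Mem.∈-++⁺ˡ (∈-sub e₁ A∖J m h))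
    ... | yes e = contradiction (≤-trans two (simple (pair a b) (card-pair≤2 a b))) (<-irrefl refl)
      where
      open ≤-Reasoning
      ins : Item n → ℕ
      ins it = 𝟙 (inside (pair a b) (e₁ it))
      here-1 : 1 ≤ 𝟙 (A∖J it) * ins it
      here-1 rewrite h | ==-true {i = a} refl | ==-true {i = b} refl | ∨-introʳ (a == b) {true} refl = s≤s z≤n
      split : ∀ p q c → 𝟙 (p ∧ q) * c + 𝟙 (p ∧ not q) * c ≤ c
      split true  true  c = ≤-reflexive (trans (+-identityʳ _) (+-identityʳ c))
      split true  false c = ≤-reflexive (+-identityʳ c)
      split false q     c = z≤n
      two : 2 ≤ ∑ its ins
      two = begin
        2 ≤⟨ +-mono-≤ (matching-edge JA-irreflexive JA-matching e (All.lookup loopless m))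
               (≤-trans here-1 (∑-∈ (λ it → 𝟙 (A∖J it) * ins it) m)) ⟩
        ∑ JA (𝟙 ∘ inside (pair a b)) + ∑ its (λ it → 𝟙 (A∖J it) * ins it)
          ≡⟨ cong (_+ ∑ its (λ it → 𝟙 (A∖J it) * ins it)) (∑-sub e₁ A∩J its (𝟙 ∘ inside (pair a b))) ⟩
        ∑ its (λ it → 𝟙 (A∩J it) * ins it) + ∑ its (λ it → 𝟙 (A∖J it) * ins it)
          ≡⟨ ∑-+ its _ _ ⟨
        ∑ its (λ it → 𝟙 (A∩J it) * ins it + 𝟙 (A∖J it) * ins it)
          ≤⟨ ∑-mono its (λ it → split (inA it) (inJ it) (ins it)) ⟩
        ∑ its ins ∎

    grown≤ : card Z + 4 * j ≤ 4 * rank E₁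
    grown≤ = begin
      card Z + 4 * j       ≡⟨ cong (λ r → card Z + 4 * r) (trans (matching-rank JA-irreflexive JA-matching) (length-sub e₁ A∩J its)) ⟨
      card Z + 4 * rank JA ≤⟨ grown-bound JA (matching-class JA-irreflexive JA-matching) X ⟩
      4 * rank (X ++ JA)   ≤⟨ *-monoʳ-≤ 4 (rank-mono {E = X ++ JA} {E₁} (⊑-++-join {X = X} {JA} {E₁}
        ⟪ All-sub e₁ A∖J its (λ {it} m h → sub-~ e₁ inA m (proj₁ (∧-true {inA it} h))) ⟫
        ⟪ All-sub e₁ A∩J its (λ {it} m h → sub-~ e₁ inA m (proj₁ (∧-true {inA it} h))) ⟫)) ⟩
      4 * rank E₁          ∎
      where open ≤-Reasoning

    rank-E₂′ : rank E₂′ ≤ j + rank E₂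
    rank-E₂′ = begin
      rank E₂′                                     ≤⟨ rank-mono {E = E₂′} {sub e₂ A∩J its ++ E₂} ⟪ All-sub e₂ ¬A∪J its cover ⟫ ⟩
      rank (sub e₂ A∩J its ++ E₂)                  ≤⟨ rank-++ (sub e₂ A∩J its) E₂ ⟩
      length (sub e₂ A∩J its) + rank E₂            ≡⟨ cong (_+ rank E₂) (length-sub e₂ A∩J its) ⟩
      j + rank E₂                                  ∎
      where
      open ≤-Reasoning
      cover : ∀ {it} → it ∈ its → ¬A∪J it ≡ true → (sub e₂ A∩J its ++ E₂) ~ e₂ it
      cover {it} m h with inA it in a
      ... | false = All.lookup (joined (⊑-refl (sub e₂ A∩J its ++ E₂)))
                      (Mem.∈-++⁺ʳ (sub e₂ A∩J its) (∈-sub e₂ (not ∘ inA) m (cong not a)))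
      ... | true  = All.lookup (joined (⊑-refl (sub e₂ A∩J its ++ E₂)))
                      (Mem.∈-++⁺ˡ (∈-sub e₂ A∩J m (cong₂ _∧_ a h)))

    E₂⊑E₂′ : E₂ ⊑ E₂′
    E₂⊑E₂′ = ⟪ All-sub e₂ (not ∘ inA) its (λ {it} m h → sub-~ e₂ ¬A∪J m (∨-introˡ (inJ it) h)) ⟫

    module _ (z : Fin n) where

      c : Fin n → Fin n
      c = lab E₂′

      Q : Fin n → Bool
      Q u = not (c u == c z) ∧ not (L u)

      Q-true : ∀ {u} → Q u ≡ true → ¬ c u ≡ c z × L u ≡ false
      Q-true {u} h with ∧-true {not (c u == c z)} h
      ... | p , q = (λ e → true≢false (==-true e) (not-true⁻ p)) , not-true⁻ q

      -- Every class of c other than the class of z contains a vertex outside L; otherwise all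
      -- edges leaving the class touch L and are kept in E₂′, so the class is a component.
      class-meets-Q : ∀ {w} → root E₂′ w ≡ true → ¬ c z ≡ w → ∃[ u ] Q u ≡ true × c u ≡ w
      class-meets-Q {w} w-root z≢w with any (λ u → (c u == w) ∧ not (L u)) (allFin n) in eq
      ... | true with any-true⁻ (λ u → (c u == w) ∧ not (L u)) (allFin n) eq
      ...   | u , _ , h with ∧-true {c u == w} h
      ...     | p , q = u , cong₂ _∧_ (cong not (==-false λ e → z≢w (trans (sym e) (==-true⁻ p)))) q , ==-true⁻ p
      class-meets-Q {w} w-root z≢w | false = contradiction
        (==-true⁻ (trans (connected₂ (λ u → c u == w) (All.tabulate closed) z w) w-root)) z≢w
        where
        inside-L : ∀ {u} → c u ≡ w → L u ≡ true
        inside-L {u} e = not-injective-false (∧-false-right (==-true e)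
          (any-false (λ u → (c u == w) ∧ not (L u)) (allFin n) eq (∈-allFin u)))
        closed : ∀ {it} → it ∈ its → (c (proj₁ (e₂ it)) == w) ≡ (c (proj₂ (e₂ it)) == w)
        closed {it@(_ , _ , (a , b))} m with c a ≟F w | c b ≟F w
        ... | yes _ | yes _ = refl
        ... | no _  | no _  = refl
        ... | yes p | no ¬q = contradiction (trans (sym (sub-~ e₂ ¬A∪J m
                (∨-introʳ (not (inA it)) (∨-introˡ (L b) (inside-L p))))) p) ¬q
        ... | no ¬p | yes q = contradiction (trans (sub-~ e₂ ¬A∪J m
                (∨-introʳ (not (inA it)) (∨-introʳ (L a) (inside-L q)))) q) ¬p

      roots≤Q : card (root E₂′) ≤ card Q + 1
      roots≤Q = begin
        card (root E₂′)
          ≤⟨ card-mono {ψ = λ w → (root E₂′ w ∧ not (c z == w)) ∨ (c z == w)} (λ w h → split w h) ⟩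
        card (λ w → (root E₂′ w ∧ not (c z == w)) ∨ (c z == w))
          ≤⟨ card-∨ (λ w → root E₂′ w ∧ not (c z == w)) (c z ==_) ⟩
        card (λ w → root E₂′ w ∧ not (c z == w)) + card (c z ==_)
          ≤⟨ +-mono-≤ (∑-mono (allFin n) class) (≤-reflexive (card-single (c z))) ⟩
        ∑ (allFin n) (λ w → ∑ (allFin n) (λ u → 𝟙 (c u == w) * 𝟙 (Q u))) + 1
          ≡⟨ cong (_+ 1) (trans (∑-swap (allFin n) (allFin n) _)
               (∑-cong (allFin n) (λ u → ∑-single (c u) (λ _ → 𝟙 (Q u))))) ⟩
        card Q + 1 ∎
        where
        open ≤-Reasoning
        split : ∀ w → root E₂′ w ≡ true → (root E₂′ w ∧ not (c z == w)) ∨ (c z == w) ≡ true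
        split w h rewrite h with c z == w
        ... | true  = refl
        ... | false = refl
        class : ∀ w → 𝟙 (root E₂′ w ∧ not (c z == w)) ≤ ∑ (allFin n) (λ u → 𝟙 (c u == w) * 𝟙 (Q u))
        class w with root E₂′ w in r | c z ≟F w
        ... | false | _     = z≤n
        ... | true  | yes _ = z≤n
        ... | true  | no ¬e with class-meets-Q r ¬e
        ...   | u , q , e = ≤-trans (≤-reflexive (sym (cong₂ _*_ (cong 𝟙 (==-true e)) (cong 𝟙 q))))
                              (∑-∈ (λ u → 𝟙 (c u == w) * 𝟙 (Q u)) (∈-allFin u))

      -- The core edges at vertices of `Q` are counted, each at most twice. Such an edge avoids `L`,
      -- so its index is not in J. Unless the index is in A, the edge is kept in `E₂′`; then its
      -- other end lies in the same class and is again in `Q`. So it is inside `Q`, where `sparse₂`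
      -- applies, or it is one of the `f` removed edges.
      degree-sum : (card Q * Y ≤ 4 * n) → 10 * K * card Q ≤ 2 * (K * card Q) + 2 * f
      degree-sum small = begin
        10 * K * card Q
          ≡⟨ ∑-*ˡ (allFin n) (10 * K) (𝟙 ∘ Q) ⟨
        ∑ (allFin n) (λ v → 10 * K * 𝟙 (Q v))
          ≤⟨ ∑-mono (allFin n) vertex ⟩
        ∑ (allFin n) (λ v → ∑ its (λ it → 𝟙 (Q v) * near v it))
          ≡⟨ ∑-swap (allFin n) its _ ⟩
        ∑ its (λ it → ∑ (allFin n) (λ v → 𝟙 (Q v) * near v it))
          ≤⟨ ∑-mono-All (All.tabulate edge) ⟩
        ∑ its (λ it → 2 * 𝟙 (inside Q (e₂ it)) + 2 * 𝟙 (A∖J it))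
          ≡⟨ trans (∑-+ its _ _) (cong₂ _+_ (∑-*ˡ its 2 _) (∑-*ˡ its 2 _)) ⟩
        2 * ∑ its (𝟙 ∘ inside Q ∘ e₂) + 2 * f
          ≤⟨ +-monoˡ-≤ (2 * f) (*-monoʳ-≤ 2 (sparse₂ Q small)) ⟩
        2 * (K * card Q) + 2 * f ∎
        where
        open ≤-Reasoning
        near : Fin n → Item n → ℕ
        near v it = 𝟙 (cross (v ==_) (e₂ it) ∧ inside (not ∘ L) (e₂ it))
        vertex : ∀ v → 10 * K * 𝟙 (Q v) ≤ ∑ its (λ it → 𝟙 (Q v) * near v it)
        vertex v with Q v in q
        ... | false = ≤-trans (≤-reflexive (*-zeroʳ (10 * K))) z≤n
        ... | true  = begin
          10 * K * 1                     ≡⟨ *-identityʳ _ ⟩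
          10 * K                         ≤⟨ core v (proj₂ (Q-true q)) ⟩
          ∑ its (near v)                 ≡⟨ ∑-cong its (λ it → +-identityʳ _) ⟨
          ∑ its (λ it → 1 * near v it)   ∎
        cross-end : ∀ {v a b} → cross (v ==_) (a , b) ≡ true → v ≡ a ⊎ v ≡ b
        cross-end {v} {a} {b} h with v ≟F a | v ≟F b
        ... | yes p | _     = inj₁ p
        ... | no _  | yes q = inj₂ q
        cross≤2 : ∀ a b → ∑ (allFin n) (λ v → 𝟙 (cross (v ==_) (a , b))) ≤ 2
        cross≤2 a b = ≤-trans (card-mono {χ = λ v → cross (v ==_) (a , b)} {pair a b} ends) (card-pair≤2 a b)
          where
          ends : ∀ v → cross (v ==_) (a , b) ≡ true → pair a b v ≡ true
          ends v h with cross-end {v} h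
          ... | inj₁ p = ∨-introˡ _ (==-true (sym p))
          ... | inj₂ p = ∨-introʳ (a == v) (==-true (sym p))
        edge : ∀ {it} → it ∈ its → ∑ (allFin n) (λ v → 𝟙 (Q v) * near v it)
          ≤ 2 * 𝟙 (inside Q (e₂ it)) + 2 * 𝟙 (A∖J it)
        edge {it@(_ , _ , (a , b))} m with bool-cases (inside Q (a , b) ∨ A∖J it)
        ... | inj₁ h = begin
          ∑ (allFin n) (λ v → 𝟙 (Q v) * near v it)
            ≤⟨ ∑-mono (allFin n) (λ v → ≤-trans (≤-reflexive (sym (𝟙-∧ (Q v) _)))
                 (𝟙-mono (λ h → proj₁ (∧-true {cross (v ==_) (a , b)} (proj₂ (∧-true {Q v} h)))))) ⟩
          ∑ (allFin n) (λ v → 𝟙 (cross (v ==_) (a , b))) ≤⟨ cross≤2 a b ⟩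
          2 * 1                                     ≤⟨ *-monoʳ-≤ 2 (≤-trans (≤-reflexive (cong 𝟙 (sym h))) (𝟙-∨ (inside Q (a , b)) (A∖J it))) ⟩
          2 * (𝟙 (inside Q (a , b)) + 𝟙 (A∖J it))   ≡⟨ *-distribˡ-+ 2 (𝟙 (inside Q (a , b))) _ ⟩
          2 * 𝟙 (inside Q (a , b)) + 2 * 𝟙 (A∖J it) ∎
        ... | inj₂ h = ≤-trans (≤-reflexive (trans (∑-cong (allFin n) none) (∑-zero (allFin n)))) z≤n
          where
          ¬inside = proj₁ (∨-false {inside Q (a , b)} h)
          ¬A∖J = proj₂ (∨-false {inside Q (a , b)} h)
          none : ∀ v → 𝟙 (Q v) * near v it ≡ 0
          none v with bool-cases (Q v ∧ (cross (v ==_) (a , b) ∧ inside (not ∘ L) (a , b)))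
          ... | inj₂ p = trans (sym (𝟙-∧ (Q v) _)) (cong 𝟙 p)
          ... | inj₁ p with ∧-true {Q v} p
          ...   | qv , r with ∧-true {cross (v ==_) (a , b)} r
          ...     | cr , la with ∧-true {not (L a)} la
          ...       | na , nb = true≢false (inside-true {χ = Q} {a , b} (cong₂ _∧_ (far-a (cross-end cr)) na)
                                  (cong₂ _∧_ (far-b (cross-end cr)) nb)) ¬inside
            where
            ¬J : inJ it ≡ false
            ¬J = cong₂ _∨_ (not-true⁻ na) (not-true⁻ nb)
            ¬A : inA it ≡ false
            ¬A = outside (inA it) ¬J ¬A∖J
              where
              outside : ∀ a {b} → b ≡ false → a ∧ not b ≡ false → a ≡ false
              outside false _    _ = refl
              outside true  refl ()
            ca≡cb : c a ≡ c b
            ca≡cb = sub-~ e₂ ¬A∪J m (∨-introˡ (inJ it) (cong not ¬A))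
            far : ∀ {x} → c x ≡ c v → not (c x == c z) ≡ true
            far e = cong not (==-false (λ h → proj₁ (Q-true qv) (trans (sym e) h)))
            far-a : v ≡ a ⊎ v ≡ b → not (c a == c z) ≡ true
            far-a (inj₁ refl) = far refl
            far-a (inj₂ refl) = far ca≡cb
            far-b : v ≡ a ⊎ v ≡ b → not (c b == c z) ≡ true
            far-b (inj₁ refl) = far (sym ca≡cb)
            far-b (inj₂ refl) = far refl

  no-small-obstruction : rank E₁ + rank E₂ < k → ∀ z →
    let u = card (λ v → not (lab E₂ v == lab E₂ z)) in rank E₁ ≤ u → u * Y ≤ n → ⊥
  no-small-obstruction deficient z r≤u u-small = <⇒≱ K-large final
    where
    open ≤-Reasoning
    u = card (λ v → not (lab E₂ v == lab E₂ z))
    q = card (Q z)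
    r = rank E₁
    q≤u : q ≤ u
    q≤u = card-mono {χ = Q z} {λ v → not (lab E₂ v == lab E₂ z)}
      (λ v h → cong not (==-false (λ e → proj₁ (Q-true z {v} h) (lab-⊑ E₂⊑E₂′ e))))
    q-small : q * Y ≤ 4 * n
    q-small = ≤-trans (*-monoˡ-≤ Y q≤u) (≤-trans u-small (m≤m+n n _))
    Z-small : card Z * Y ≤ 4 * n
    Z-small = begin
      card Z * Y   ≤⟨ *-monoˡ-≤ Y (≤-trans (m≤m+n (card Z) (4 * j)) (≤-trans grown≤ (*-monoʳ-≤ 4 r≤u))) ⟩
      4 * u * Y    ≡⟨ *-assoc 4 u Y ⟩
      4 * (u * Y)  ≤⟨ *-monoʳ-≤ 4 u-small ⟩
      4 * n        ∎
    f≤ : f ≤ K * card Z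
    f≤ = ≤-trans (∑-mono-All {f = 𝟙 ∘ A∖J} {𝟙 ∘ inside Z ∘ e₁} (All.tabulate (λ m → 𝟙-mono (X-grown m)))) (sparse₁ Z Z-small)
    r<q+j : suc r ≤ q + j
    r<q+j = +-cancelʳ-≤ (rank E₂) _ _ (≤-trans deficient (≤-pred (begin
      suc k                            ≡⟨ roots+rank E₂′ ⟨
      card (root E₂′) + rank E₂′       ≤⟨ +-mono-≤ (roots≤Q z) rank-E₂′ ⟩
      q + 1 + (j + rank E₂)            ≡⟨ lemma q j (rank E₂) ⟩
      suc (q + j + rank E₂)            ∎)))
      where
      lemma : ∀ a b c → a + 1 + (b + c) ≡ suc (a + b + c)
      lemma = solve-∀
    -- The deficiency is strict, so `suc r` and not only `r` is bounded by `q + j`. The 4 gained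
    -- here becomes the `8 * K` that contradicts the degree count in `final`.
    Z≤ : card Z + 4 ≤ 4 * q
    Z≤ = +-cancelʳ-≤ (4 * j) _ _ (begin
      card Z + 4 + 4 * j     ≡⟨ lemma₁ (card Z) j ⟩
      card Z + 4 * j + 4     ≤⟨ +-monoˡ-≤ 4 grown≤ ⟩
      4 * r + 4              ≡⟨ lemma₂ r ⟩
      4 * suc r              ≤⟨ *-monoʳ-≤ 4 r<q+j ⟩
      4 * (q + j)            ≡⟨ *-distribˡ-+ 4 q j ⟩
      4 * q + 4 * j          ∎)
      where
      lemma₁ : ∀ a b → a + 4 + 4 * b ≡ a + 4 * b + 4
      lemma₁ = solve-∀
      lemma₂ : ∀ a → 4 * a + 4 ≡ 4 * suc a
      lemma₂ = solve-∀
    K-large : 0 < 8 * K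
    K-large = ≤-trans K>0 (m≤m+n K _)
    final : 8 * K ≤ 0
    final = +-cancelˡ-≤ (10 * K * q) _ _ (begin
      10 * K * q + 8 * K                     ≤⟨ +-monoˡ-≤ (8 * K) (degree-sum z q-small) ⟩
      2 * (K * q) + 2 * f + 8 * K            ≤⟨ +-monoˡ-≤ (8 * K) (+-monoʳ-≤ (2 * (K * q)) (*-monoʳ-≤ 2 f≤)) ⟩
      2 * (K * q) + 2 * (K * card Z) + 8 * K ≡⟨ lemma₃ K q (card Z) ⟩
      2 * (K * q) + 2 * (K * (card Z + 4))   ≤⟨ +-monoʳ-≤ (2 * (K * q)) (*-monoʳ-≤ 2 (*-monoʳ-≤ K Z≤)) ⟩
      2 * (K * q) + 2 * (K * (4 * q))        ≡⟨ lemma₄ K q ⟩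
      10 * K * q + 0                         ∎)
      where
      lemma₃ : ∀ K q z → 2 * (K * q) + 2 * (K * z) + 8 * K ≡ 2 * (K * q) + 2 * (K * (z + 4))
      lemma₃ = solve-∀
      lemma₄ : ∀ K q → 2 * (K * q) + 2 * (K * (4 * q)) ≡ 10 * K * q + 0
      lemma₄ = solve-∀

module Separation {k : ℕ} {its : List (Item (suc k))} {K Y : ℕ} (typical : Typical its K Y) (5≤Y : 5 ≤ Y)
  (mixing : ∀ (R U : Fin (suc k) → Bool) → card R ≤ 2 * card U → 2 * card R ≤ suc k → 4 * card U ≤ 3 * suc k →
    suc k < card U * Y → ∃[ it ] it ∈ its × inside (not ∘ R) (e₁ it) ≡ true × cross U (e₂ it) ≡ true) where

  open Typical typical using (loopless)

  private
    n : ℕ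
    n = suc k
    E₁ E₂ : List (Edge n)
    E₁ = sub e₁ inA its
    E₂ = sub e₂ (not ∘ inA) its
    c : Fin n → Fin n
    c = lab E₂
    R : Fin n → Bool
    R = not ∘ root E₁

    card-R : card R ≡ rank E₁
    card-R = +-cancelˡ-≡ (card (root E₁)) _ _ (trans (card-not (root E₁)) (sym (roots+rank E₁)))

    -- The vertices outside R lie in different components of E₁, so an edge between two of
    -- them has its index outside A; but then the other edge lies inside a component of E₂.
    no-mixing : ∀ U → (∀ {it} → it ∈ its → inA it ≡ false → U (proj₁ (e₂ it)) ≡ U (proj₂ (e₂ it))) →
      rank E₁ ≤ 2 * card U → 2 * rank E₁ ≤ n → 4 * card U ≤ 3 * n → n < card U * Y → ⊥
    no-mixing U closed h₁ h₂ h₃ h₄ with mixing R U (≤-trans (≤-reflexive card-R) h₁)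
      (≤-trans (≤-reflexive (cong (2 *_) card-R)) h₂) h₃ h₄
    ... | (a , (x , y) , (v , w)) , m , ins , cr with a in eq
    ...   | false = true≢false cr (xor-same (closed m refl))
    ...   | true = All.lookup loopless m (trans (sym (is-root x-root)) (trans (sub-~ e₁ inA m refl) (is-root y-root)))
      where
      x-root = proj₁ (∧-true {not (R x)} ins)
      y-root = proj₂ (∧-true {not (R x)} ins)
      is-root : ∀ {x} → not (R x) ≡ true → lab E₁ x ≡ x
      is-root {x} h with lab E₁ x ≟F x
      ... | yes e = e

    below : ℕ → Fin n → Bool
    below t v = suc (toℕ (c v)) ≤ᵇ t

    closed-by-label : ∀ (g : Fin n → Bool) {it} → it ∈ its → inA it ≡ false →
      g (c (proj₁ (e₂ it))) ≡ g (c (proj₂ (e₂ it)))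
    closed-by-label g m h = cong g (sub-~ e₂ (not ∘ inA) m (cong not h))

    -- The vertices are swept in the order of their labels, one component at a time, until a quarter
    -- of them is reached. If the component added last overshoots three quarters, it alone has more
    -- than half of the vertices, and its complement is the `U` of `BigClass`.
    crossing : ∀ t → n ≤ 4 * card (below t) → ∃[ t ] 4 * card (below t) < n × n ≤ 4 * card (below (suc t))
    crossing zero    h = contradiction (≤-trans h (≤-reflexive (cong (4 *_) (∑-zero (allFin n))))) (<⇒≱ (s≤s z≤n))
    crossing (suc t) h with n ≤? 4 * card (below t)
    ... | yes p = crossing t p
    ... | no ¬p = t , ≰⇒> ¬p , h

    all-below : n ≤ 4 * card (below n)
    all-below = ≤-trans (m≤m+n n _) (≤-reflexive (cong (4 *_) (sym (trans
      (∑-cong (allFin n) (λ v → cong 𝟙 (≤ᵇ-true (toℕ<n (c v))))) (card-true n)))))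

    module BigClass (t : ℕ) (low : 4 * card (below t) < n) (high : 3 * n < 4 * card (below (suc t))) where
      open ≤-Reasoning

      at-t : Fin n → Bool
      at-t v = (toℕ (c v) ≤ᵇ t) ∧ (t ≤ᵇ toℕ (c v))

      at-t⁻ : ∀ {v} → at-t v ≡ true → toℕ (c v) ≡ t
      at-t⁻ {v} h with ∧-true {toℕ (c v) ≤ᵇ t} h
      ... | p , q = ≤-antisym (≤ᵇ-true⁻ (toℕ (c v)) t p) (≤ᵇ-true⁻ t (toℕ (c v)) q)

      step : card (below (suc t)) ≤ card (below t) + card at-t
      step = ≤-trans (card-mono {χ = below (suc t)} {λ v → below t v ∨ at-t v} split) (card-∨ (below t) at-t)
        where
        split : ∀ v → below (suc t) v ≡ true → below t v ∨ at-t v ≡ true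
        split v h with ≤ᵇ-true⁻ (suc (toℕ (c v))) (suc t) h
        ... | s≤s p with <-cmp (toℕ (c v)) t
        ...   | tri< q _ _ = ∨-introˡ (at-t v) (≤ᵇ-true q)
        ...   | tri≈ _ q _ = ∨-introʳ (below t v) (cong₂ _∧_ (≤ᵇ-true p) (≤ᵇ-true (≤-reflexive (sym q))))
        ...   | tri> _ _ q = contradiction p (<⇒≱ q)

      big : 2 * n < 4 * card at-t
      big = +-cancelˡ-< n _ _ (begin-strict
        n + 2 * n                                ≡⟨⟩
        3 * n                                    <⟨ high ⟩
        4 * card (below (suc t))                 ≤⟨ *-monoʳ-≤ 4 step ⟩
        4 * (card (below t) + card at-t)         ≡⟨ *-distribˡ-+ 4 (card (below t)) _ ⟩
        4 * card (below t) + 4 * card at-t       ≤⟨ +-monoˡ-≤ _ (<⇒≤ low) ⟩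
        n + 4 * card at-t                        ∎)

      member : ∃[ z ] at-t z ≡ true
      member with any at-t (allFin n) in eq
      ... | true  = let z , _ , h = any-true⁻ at-t (allFin n) eq in z , h
      ... | false = contradiction (≤-trans big (≤-reflexive (cong (4 *_) (trans
          (∑-cong (allFin n) (λ v → cong 𝟙 (any-false at-t (allFin n) eq (∈-allFin v)))) (∑-zero (allFin n))))))
          (λ ())

      z : Fin n
      z = proj₁ member

      U : Fin n → Bool
      U v = not (c v == c z)

      U-small : 4 * card U ≤ 3 * n
      U-small = +-cancelʳ-≤ (4 * card at-t) _ _ (begin
        4 * card U + 4 * card at-t ≡⟨ *-distribˡ-+ 4 (card U) _ ⟨
        4 * (card U + card at-t)   ≤⟨ *-monoʳ-≤ 4 (+-monoʳ-≤ (card U) (card-mono {ψ = λ v → c v == c z} same)) ⟩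
        4 * (card U + card (λ v → c v == c z)) ≡⟨ cong (4 *_) (trans (+-comm (card U) _) (card-not (λ v → c v == c z))) ⟩
        4 * n                      ≤⟨ m≤m+n (4 * n) n ⟩
        4 * n + n                  ≡⟨ lemma n ⟩
        3 * n + 2 * n              ≤⟨ +-monoʳ-≤ (3 * n) (<⇒≤ big) ⟩
        3 * n + 4 * card at-t      ∎)
        where
        lemma : ∀ n → 4 * n + n ≡ 3 * n + 2 * n
        lemma = solve-∀
        same : ∀ v → at-t v ≡ true → (c v == c z) ≡ true
        same v h = ==-true (toℕ-injective (trans (at-t⁻ h) (sym (at-t⁻ (proj₂ member)))))

      rank≤U : rank E₁ + rank E₂ < k → rank E₁ ≤ card U
      rank≤U deficient = +-cancelʳ-≤ (suc (rank E₂)) _ _ (begin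
        rank E₁ + suc (rank E₂)        ≡⟨ +-suc (rank E₁) _ ⟩
        suc (rank E₁ + rank E₂)        ≤⟨ deficient ⟩
        k                              ≤⟨ n≤1+n k ⟩
        n                              ≡⟨ roots+rank E₂ ⟨
        card (root E₂) + rank E₂       ≤⟨ +-monoˡ-≤ (rank E₂) roots≤ ⟩
        card U + 1 + rank E₂           ≡⟨ +-assoc (card U) 1 _ ⟩
        card U + suc (rank E₂)         ∎)
        where
        roots≤ : card (root E₂) ≤ card U + 1
        roots≤ = ≤-trans (card-mono {ψ = λ w → U w ∨ (c z == w)} split)
          (≤-trans (card-∨ U (c z ==_)) (≤-reflexive (cong (card U +_) (card-single (c z)))))
          where
          split : ∀ w → root E₂ w ≡ true → U w ∨ (c z == w) ≡ true
          split w h with c w ≟F c z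
          ... | no _  = refl
          ... | yes e = ==-true (trans (sym e) (==-true⁻ h))

  no-obstruction : rank E₁ + rank E₂ < k → 2 * rank E₁ ≤ n → ⊥
  no-obstruction deficient r≤ with crossing n all-below
  ... | t , low , high with 4 * card (below (suc t)) ≤? 3 * n
  ...   | yes mid = no-mixing (below (suc t)) (closed-by-label (λ x → suc (toℕ x) ≤ᵇ suc t))
      (*-cancelˡ-≤ 2 (≤-trans r≤ (≤-trans high (≤-reflexive (*-assoc 2 2 (card (below (suc t)))))))) r≤ mid large
    where
    open ≤-Reasoning
    u = card (below (suc t))
    -- A set with at least `n/4` vertices passes the threshold `n/Y` because `Y` is at least 5.
    large : n < u * Y
    large = begin-strict
      n           ≤⟨ high ⟩
      4 * u       <⟨ *-monoˡ-< u {{ℕ.>-nonZero (positive u high)}} (s≤s (≤-refl {4})) ⟩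
      5 * u       ≤⟨ *-monoˡ-≤ u 5≤Y ⟩
      Y * u       ≡⟨ *-comm Y u ⟩
      u * Y       ∎
      where
      positive : ∀ u → n ≤ 4 * u → 0 < u
      positive (suc u) _ = s≤s z≤n
  ...   | no ¬mid with n <? card (BigClass.U t low (≰⇒> ¬mid)) * Y
  ...     | yes large = no-mixing U (closed-by-label (λ x → not (x == c z)))
      (≤-trans (rank≤U deficient) (m≤m+n (card U) _)) r≤ U-small large
    where open BigClass t low (≰⇒> ¬mid)
  ...     | no ¬large = SmallRank.no-small-obstruction typical deficient z (rank≤U deficient) (≮⇒≥ ¬large)
    where open BigClass t low (≰⇒> ¬mid)

-- Cores

pick : ∀ {A : Set} → (A → Bool) → List A → Maybe A
pick p []       = nothing
pick p (x ∷ xs) = if p x then just x else pick p xs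

pick-just : ∀ {A : Set} (p : A → Bool) xs {x} → pick p xs ≡ just x → p x ≡ true
pick-just p (y ∷ xs) h with p y in eq
pick-just p (y ∷ xs) refl | true = eq
... | false = pick-just p xs h

pick-nothing : ∀ {A : Set} (p : A → Bool) xs → pick p xs ≡ nothing → ∀ {x} → x ∈ xs → p x ≡ false
pick-nothing p (y ∷ xs) h m with p y in eq
pick-nothing p (y ∷ xs) h (here refl) | false = eq
pick-nothing p (y ∷ xs) h (there m)   | false = pick-nothing p xs h m

module _ {n : ℕ} (D : ℕ) (H : List (Edge n)) where

  degree-outside : (Fin n → Bool) → Fin n → ℕ
  degree-outside L v = ∑ H (λ e → 𝟙 (cross (v ==_) e ∧ inside (not ∘ L) e))

  removable : (Fin n → Bool) → Fin n → Bool
  removable L v = not (L v) ∧ (suc (degree-outside L v) ≤ᵇ D)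

  -- L is the set of vertices removed so far.
  peel : ℕ → (Fin n → Bool) → Fin n → Bool
  peel-from : ℕ → (Fin n → Bool) → Maybe (Fin n) → Fin n → Bool
  peel zero    L = L
  peel (suc f) L = peel-from f L (pick (removable L) (allFin n))
  peel-from f L nothing  = L
  peel-from f L (just v) = peel f (λ u → L u ∨ (v == u))

  IsCore : (Fin n → Bool) → Set
  IsCore L = ∀ v → L v ≡ false → D ≤ degree-outside L v

  module _ (loopless : Irreflexive H) where

    private
      Sparse : (Fin n → Bool) → Set
      Sparse L = ∑ H (𝟙 ∘ touch L) ≤ D * card L

      touch-insert : ∀ L v → ∑ H (𝟙 ∘ touch (λ u → L u ∨ (v == u))) ≤ ∑ H (𝟙 ∘ touch L) + degree-outside L v
      touch-insert L v = ≤-trans (∑-mono-All (All.map edge loopless)) (≤-reflexive (∑-+ H _ _))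
        where
        edge : ∀ {e} → ¬ proj₁ e ≡ proj₂ e → 𝟙 (touch (λ u → L u ∨ (v == u)) e) ≤
          𝟙 (touch L e) + 𝟙 (cross (v ==_) e ∧ inside (not ∘ L) e)
        edge {a , b} a≢b with L a | L b | v ≟F a | v ≟F b
        ... | true  | _     | _     | _     = s≤s z≤n
        ... | false | true  | _     | _     = ≤-trans (𝟙≤1 _) (s≤s z≤n)
        ... | false | false | yes p | yes q = contradiction (trans (sym p) q) a≢b
        ... | false | false | yes _ | no _  = s≤s z≤n
        ... | false | false | no _  | yes _ = s≤s z≤n
        ... | false | false | no _  | no _  = z≤n

      card-insert-≡ : ∀ (L : Fin n → Bool) v → L v ≡ false → card (λ u → L u ∨ (v == u)) ≡ suc (card L)
      card-insert-≡ L v h = ≤-antisym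
        (≤-trans (card-∨ L (v ==_)) (≤-reflexive (trans (cong (card L +_) (card-single v)) (+-comm (card L) 1))))
        (card-insert {χ = L} {λ u → L u ∨ (v == u)} {v} h (∨-introʳ (L v) (==-true refl)) (λ j q → ∨-introˡ _ q))

    -- Each removed vertex has fewer than `D` edges to the vertices left, so at most `D |L|` edges
    -- touch `L`. The fuel `f` is the size that `L` should not reach: if it runs out, the result is
    -- a set of exactly known size that few edges touch, and the event `low` is made to exclude such
    -- sets.
    peel-spec : ∀ f L → Sparse L → Sparse (peel f L) × card (peel f L) ≤ card L + f ×
      (IsCore (peel f L) ⊎ card (peel f L) ≡ card L + f)
    peel-spec zero    L sp = sp , m≤m+n _ 0 , inj₂ (sym (+-identityʳ _))
    peel-spec (suc f) L sp with pick (removable L) (allFin n) in eq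
    ... | nothing = sp , m≤m+n _ _ , inj₁ (λ v h → ≤-pred (≤ᵇ-false⁻ (suc (degree-outside L v)) D
            (∧-false-right (cong not h) (pick-nothing (removable L) (allFin n) eq (∈-allFin v)))))
    ... | just v with ∧-true {not (L v)} (pick-just (removable L) (allFin n) eq)
    ...   | v∉L , low with peel-spec f (λ u → L u ∨ (v == u)) sp′
      where
      open ≤-Reasoning
      sp′ : Sparse (λ u → L u ∨ (v == u))
      sp′ = begin
        ∑ H (𝟙 ∘ touch (λ u → L u ∨ (v == u)))  ≤⟨ touch-insert L v ⟩
        ∑ H (𝟙 ∘ touch L) + degree-outside L v  ≤⟨ +-mono-≤ sp (<⇒≤ (≤ᵇ-true⁻ (suc (degree-outside L v)) D low)) ⟩
        D * card L + D                          ≡⟨ trans (+-comm (D * card L) D) (sym (*-suc D (card L))) ⟩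
        D * suc (card L)                        ≡⟨ cong (D *_) (card-insert-≡ L v (not-true⁻ v∉L)) ⟨
        D * card (λ u → L u ∨ (v == u))         ∎
    ...     | s , c≤ , core = s , ≤-trans c≤ (≤-reflexive shift) , Sum.map₂ (λ e → trans e shift) core
      where
      shift : card (λ u → L u ∨ (v == u)) + f ≡ card L + suc f
      shift = trans (cong (_+ f) (card-insert-≡ L v (not-true⁻ v∉L))) (sym (+-suc (card L) f))

  cross≤touch : ∀ (χ : Fin n → Bool) e → 𝟙 (cross χ e) ≤ 𝟙 (touch χ e)
  cross≤touch χ (a , b) with χ a | χ b
  ... | true  | true  = z≤n
  ... | true  | false = ≤-refl
  ... | false | true  = ≤-refl
  ... | false | false = ≤-refl

touch-degrees : ∀ {n} (L : Fin n → Bool) (H : List (Edge n)) → Irreflexive H →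
  ∑ H (𝟙 ∘ touch L) ≤ ∑ (allFin n) (λ v → 𝟙 (L v) * ∑ H (𝟙 ∘ cross (v ==_)))
touch-degrees {n} L H loopless = begin
  ∑ H (𝟙 ∘ touch L)
    ≤⟨ ∑-mono-All (All.map (λ {e} → edge e) loopless) ⟩
  ∑ H (λ e → ∑ (allFin n) (λ v → 𝟙 (L v) * 𝟙 (cross (v ==_) e)))
    ≡⟨ ∑-swap H (allFin n) _ ⟩
  ∑ (allFin n) (λ v → ∑ H (λ e → 𝟙 (L v) * 𝟙 (cross (v ==_) e)))
    ≡⟨ ∑-cong (allFin n) (λ v → ∑-*ˡ H (𝟙 (L v)) _) ⟩
  ∑ (allFin n) (λ v → 𝟙 (L v) * ∑ H (𝟙 ∘ cross (v ==_))) ∎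
  where
  open ≤-Reasoning
  edge : ∀ e → ¬ proj₁ e ≡ proj₂ e → 𝟙 (touch L e) ≤ ∑ (allFin n) (λ v → 𝟙 (L v) * 𝟙 (cross (v ==_) e))
  edge (a , b) a≢b with L a in p | L b in q
  ... | false | false = z≤n
  ... | true  | _     = ≤-trans (≤-reflexive (sym (cong₂ _*_ (cong 𝟙 p) (cong 𝟙 (cross-left a≢b)))))
                          (∑-∈ (λ v → 𝟙 (L v) * 𝟙 (cross (v ==_) (a , b))) (∈-allFin a))
  ... | false | true  = ≤-trans (≤-reflexive (sym (cong₂ _*_ (cong 𝟙 q) (cong 𝟙 (cross-right a≢b)))))
                          (∑-∈ (λ v → 𝟙 (L v) * 𝟙 (cross (v ==_) (a , b))) (∈-allFin b))

-- Prefixes of the two orderings and the exceptional events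

full : ℕ → List Bool
full m = replicate m true

select-full : ∀ {A : Set} m (xs : List A) → select (full m) xs ≡ take m xs
select-full zero    xs       = refl
select-full (suc m) []       = refl
select-full (suc m) (x ∷ xs) = cong (x ∷_) (select-full m xs)

∑-take-mono : ∀ {A : Set} {i j} → i ≤ j → (xs : List A) (g : A → ℕ) → ∑ (take i xs) g ≤ ∑ (take j xs) g
∑-take-mono z≤n     xs       g = z≤n
∑-take-mono (s≤s h) []       g = z≤n
∑-take-mono (s≤s h) (x ∷ xs) g = +-monoʳ-≤ (g x) (∑-take-mono h xs g)

∑-take≤ : ∀ {A : Set} i (xs : List A) (g : A → ℕ) → ∑ (take i xs) g ≤ ∑ xs g
∑-take≤ zero    xs       g = z≤n
∑-take≤ (suc i) []       g = z≤n
∑-take≤ (suc i) (x ∷ xs) g = +-monoʳ-≤ (g x) (∑-take≤ i xs g)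

items : ∀ {n m} → Vec Bool m → List (Edge n) → List (Edge n) → List (Item n)
items []      _       _       = []
items (a ∷ A) (e ∷ σ) (f ∷ τ) = (a , e , f) ∷ items A σ τ
items (a ∷ A) _       _       = []

items-e₁ : ∀ {n m} (A : Vec Bool m) (σ τ : List (Edge n)) → m ≤ length σ → m ≤ length τ →
  map e₁ (items A σ τ) ≡ take m σ
items-e₁ []      σ       τ       _       _       = refl
items-e₁ (a ∷ A) (e ∷ σ) (f ∷ τ) (s≤s p) (s≤s q) = cong (e ∷_) (items-e₁ A σ τ p q)

items-e₂ : ∀ {n m} (A : Vec Bool m) (σ τ : List (Edge n)) → m ≤ length σ → m ≤ length τ →
  map e₂ (items A σ τ) ≡ take m τ
items-e₂ []      σ       τ       _       _       = refl
items-e₂ (a ∷ A) (e ∷ σ) (f ∷ τ) (s≤s p) (s≤s q) = cong (f ∷_) (items-e₂ A σ τ p q)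

items-inA : ∀ {n m} (A : Vec Bool m) (σ τ : List (Edge n)) → m ≤ length σ → m ≤ length τ →
  sub e₁ inA (items A σ τ) ≡ sel A σ
items-inA []          σ       τ       _       _       = refl
items-inA (true ∷ A)  (e ∷ σ) (f ∷ τ) (s≤s p) (s≤s q) = cong (e ∷_) (items-inA A σ τ p q)
items-inA (false ∷ A) (e ∷ σ) (f ∷ τ) (s≤s p) (s≤s q) = items-inA A σ τ p q

items-∁A : ∀ {n m} (A : Vec Bool m) (σ τ : List (Edge n)) → m ≤ length σ → m ≤ length τ →
  sub e₂ (not ∘ inA) (items A σ τ) ≡ sel (∁ A) τ
items-∁A []          σ       τ       _       _       = refl
items-∁A (true ∷ A)  (e ∷ σ) (f ∷ τ) (s≤s p) (s≤s q) = items-∁A A σ τ p q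
items-∁A (false ∷ A) (e ∷ σ) (f ∷ τ) (s≤s p) (s≤s q) = cong (f ∷_) (items-∁A A σ τ p q)

items-∑ : ∀ {n m} (A : Vec Bool m) (p q : Edge n → Bool) σ τ {j} → m ≤ j →
  ∑ (items A σ τ) (λ it → 𝟙 (p (e₂ it) ∧ q (e₁ it))) ≤ ∑ (select (map p (take j τ)) σ) (𝟙 ∘ q)
items-∑ []      p q σ       τ       _       = z≤n
items-∑ (a ∷ A) p q []      τ       _       = z≤n
items-∑ (a ∷ A) p q (e ∷ σ) []      _       = z≤n
items-∑ (a ∷ A) p q (e ∷ σ) (f ∷ τ) (s≤s h) with p f
... | true  = +-monoʳ-≤ (𝟙 (q e)) (items-∑ A p q σ τ h)
... | false = items-∑ A p q σ τ h

items-∃ : ∀ {n m} (A : Vec Bool m) (p q : Edge n → Bool) σ τ {j} → j ≤ m → m ≤ length σ → m ≤ length τ →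
  all (not ∘ q) (select (map p (take j σ)) τ) ≡ false →
  ∃[ it ] it ∈ items A σ τ × p (e₁ it) ≡ true × q (e₂ it) ≡ true
items-∃ (a ∷ A) p q (e ∷ σ) (f ∷ τ) (s≤s h) (s≤s x) (s≤s y) bad with p e in pe
... | false = let it , m , r = items-∃ A p q σ τ h x y bad in it , there m , r
... | true with q f in qf
...   | true  = _ , here refl , pe , qf
...   | false = let it , m , r = items-∃ A p q σ τ h x y bad in it , there m , r

inside-lookup : ∀ {n} (χ : Fin n → Bool) (e : Edge n) → inside (lookup (Vec.tabulate χ)) e ≡ inside χ e
inside-lookup χ (a , b) = cong₂ _∧_ (Vec.lookup∘tabulate χ a) (Vec.lookup∘tabulate χ b)

cross-lookup : ∀ {n} (χ : Fin n → Bool) (e : Edge n) → cross (lookup (Vec.tabulate χ)) e ≡ cross χ e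
cross-lookup χ (a , b) = cong₂ _xor_ (Vec.lookup∘tabulate χ a) (Vec.lookup∘tabulate χ b)

all-cong : ∀ {A : Set} {p q : A → Bool} (xs : List A) → (∀ x → p x ≡ q x) → all p xs ≡ all q xs
all-cong []       h = refl
all-cong (x ∷ xs) h = cong₂ _∧_ (h x) (all-cong xs h)

-- Properties that more edges preserve are tested at `m₀` or, for connectivity, demanded by `m₁`;
-- upper bounds on edge counts are tested at `m₁`. So the bounds hold for all prefix lengths in
-- between at once. `K` bounds densities, `Y` delimits small sets, `b` bounds the size of L and `Δ`
-- the degrees.
module Events (k m₀ m₁ K Y b Δ : ℕ) where

  n : ℕ
  n = suc k

  Ordering : Set
  Ordering = List (Edge n)

  disconnectedBy : Ordering → Vec Bool n → Bool
  disconnectedBy σ S = ((1 ≤ᵇ size S) ∧ (2 * size S ≤ᵇ n)) ∧ all (not ∘ cross (lookup S)) (select (full m₁) σ)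

  isolatedIn : Ordering → Fin n → Bool
  isolatedIn σ v = all (inside (not ∘ (v ==_))) (select (full m₀) σ)

  denseOn : Ordering → Vec Bool n → Bool
  denseOn σ S = (size S * Y ≤ᵇ 4 * n) ∧ (suc (K * size S) ≤ᵇ ∑ (select (full m₁) σ) (𝟙 ∘ inside (lookup S)))

  lowOn : Ordering → Vec Bool n → Bool
  lowOn σ S = ((size S ≤ᵇ b) ∧ (b ≤ᵇ size S)) ∧ (∑ (select (full m₀) σ) (𝟙 ∘ cross (lookup S)) ≤ᵇ 10 * K * b)

  highDegree : Ordering → Fin n → Bool
  highDegree σ v = suc Δ ≤ᵇ ∑ (select (full m₁) σ) (𝟙 ∘ cross (v ==_))

  lows : Ordering → Fin n → Bool
  lows σ = peel (10 * K) (select (full m₀) σ) b (λ _ → false)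

  -- The positions of J, taken up to the latest time in question. They depend on one ordering only,
  -- so the other one is still uniform when its entries at these positions are examined.
  touchMask : Ordering → List Bool
  touchMask σ = map (touch (lows σ)) (take m₁ σ)

  clashAt : Ordering → Ordering → Fin n → Bool
  clashAt σ τ v = 2 ≤ᵇ ∑ (select (touchMask τ) σ) (𝟙 ∘ cross (v ==_))

  -- `size R ≤ 2 * size U` lets the choice of `R` be charged to `U` in the union bound. The bounds
  -- by `n` leave a positive fraction of the vertices outside `R` and outside `U`.
  admissible : Vec Bool n → Vec Bool n → Bool
  admissible R U = ((size R ≤ᵇ 2 * size U) ∧ (2 * size R ≤ᵇ n)) ∧ ((4 * size U ≤ᵇ 3 * n) ∧ (suc n ≤ᵇ size U * Y))

  separatedBy : Ordering → Ordering → Vec Bool n → Vec Bool n → Bool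
  separatedBy σ τ R U = admissible R U ∧
    all (not ∘ cross (lookup U)) (select (map (inside (not ∘ lookup R)) (take m₀ σ)) τ)

  disconnected noIsolated dense low high : Ordering → Bool
  disconnected σ = any (disconnectedBy σ) (allVec n)
  noIsolated σ   = not (any (isolatedIn σ) (allFin n))
  dense σ        = any (denseOn σ) (allVec n)
  low σ          = any (lowOn σ) (allVec n)
  high σ         = any (highDegree σ) (allFin n)

  clash separated : Ordering → Ordering → Bool
  clash σ τ     = any (clashAt σ τ) (allFin n)
  separated σ τ = any (λ R → any (separatedBy σ τ R) (allVec n)) (allVec n)

  not-disconnected : ∀ σ → disconnected σ ≡ false → connected (take m₁ σ) ≡ true
  not-disconnected σ h = connected-intro same
    where
    E = take m₁ σ
    no-cut : ∀ χ → All (λ e → χ (proj₁ e) ≡ χ (proj₂ e)) E → 1 ≤ card χ → 2 * card χ ≤ n → ⊥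
    no-cut χ inv 1≤ ≤n = true≢false
      (cong₂ _∧_ (cong₂ _∧_ (≤ᵇ-true (≤-trans 1≤ (≤-reflexive (sym size≡))))
                            (≤ᵇ-true (≤-trans (≤-reflexive (cong (2 *_) size≡)) ≤n)))
                 (trans (cong (all (not ∘ cross (lookup S))) (select-full m₁ σ)) (all-true _ E uncut)))
      (any-false (disconnectedBy σ) (allVec n) h (∈-allVec S))
      where
      S = Vec.tabulate χ
      size≡ : size S ≡ card χ
      size≡ = size-tabulate χ
      uncut : ∀ {e} → e ∈ E → not (cross (lookup S) e) ≡ true
      uncut {e} m = cong not (trans (cross-lookup χ e) (xor-same (All.lookup inv m)))
    same : ∀ u v → lab E u ≡ lab E v
    same u v with lab E u ≟F lab E v
    ... | yes e = e
    ... | no ¬e with 2 * card (λ w → lab E w == lab E u) ≤? n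
    ...   | yes small = ⊥-elim (no-cut (λ w → lab E w == lab E u)
              (All.map (cong (_== lab E u)) (joined (⊑-refl E)))
              (≤-trans (≤-reflexive (sym (card-single u)))
                (card-mono {χ = u ==_} {λ w → lab E w == lab E u}
                  (λ w q → ==-true (cong (lab E) (sym (==-true⁻ q)))))) small)
    ...   | no large = ⊥-elim (no-cut (λ w → not (lab E w == lab E u))
              (All.map (cong (λ x → not (x == lab E u))) (joined (⊑-refl E)))
              (≤-trans (≤-reflexive (sym (card-single v)))
                (card-mono {χ = v ==_} {λ w → not (lab E w == lab E u)}
                  (λ w q → cong not (==-false (λ r → ¬e (trans (sym r) (cong (lab E) (sym (==-true⁻ q)))))))))
              (+-cancelˡ-≤ (2 * card (λ w → lab E w == lab E u)) _ _ (begin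
                2 * x + 2 * y  ≡⟨ *-distribˡ-+ 2 x y ⟨
                2 * (x + y)    ≡⟨ cong (2 *_) (card-not (λ w → lab E w == lab E u)) ⟩
                n + (n + 0)    ≡⟨ cong (n +_) (+-identityʳ n) ⟩
                n + n          ≤⟨ +-monoˡ-≤ n (<⇒≤ (≰⇒> large)) ⟩
                2 * x + n      ∎)))
      where
      open ≤-Reasoning
      x = card (λ w → lab E w == lab E u)
      y = card (λ w → not (lab E w == lab E u))

  isolated-disconnected : 2 ≤ n → ∀ σ → noIsolated σ ≡ false → connected (take m₀ σ) ≡ false
  isolated-disconnected 2≤n σ h with any-true⁻ (isolatedIn σ) (allFin n) (not-injective-false h)
  ... | v , _ , iso with connected (take m₀ σ) in c
  ...   | false = refl
  ...   | true  = contradiction (≤-trans 2≤n (≤-trans (≤-reflexive (sym (card-true n)))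
            (≤-trans (card-mono {χ = λ _ → true} {v ==_} (λ w _ → trans (sym (alone v w)) (==-true refl))) (≤-reflexive (card-single v)))))
            (<-irrefl refl)
    where
    outside : ∀ {e} → e ∈ take m₀ σ → inside (not ∘ (v ==_)) e ≡ true
    outside m = all-true⁻ _ (take m₀ σ) (trans (cong (all _) (sym (select-full m₀ σ))) iso) m
    alone : ∀ u w → (v == u) ≡ (v == w)
    alone = connected-elim c (v ==_) (All.tabulate (λ {e} m →
      let p , q = ∧-true {not (v == proj₁ e)} (outside {e} m) in trans (not-true⁻ p) (sym (not-true⁻ q))))

  module _ {σ : Ordering} (σ∈ : σ ∈ orderings n) where

    ordering-↭ : σ ↭ edgesK n
    ordering-↭ = All.lookup (perms-↭ (edgesK n)) σ∈

    ordering-length : length σ ≡ Nn n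
    ordering-length = trans (All.lookup (perms-length (edgesK n)) σ∈) (length-edgesK n)

    ordering-loopless : Irreflexive σ
    ordering-loopless = Perm.All-resp-↭ (↭-sym ordering-↭) (edgesK-irrefl n)

    prefix-simple : ∀ M χ → card χ ≤ 2 → ∑ (take M σ) (𝟙 ∘ inside χ) ≤ 1
    prefix-simple M χ h = ≤-trans (∑-take≤ M σ _) (≤-trans (≤-reflexive (∑-↭ _ ordering-↭)) (bound _ (card χ) h (inside-count χ)))
      where
      bound : ∀ x c → c ≤ 2 → 2 * x + c ≡ c * c → x ≤ 1
      bound zero    c h e = z≤n
      bound (suc x) 0 h ()
      bound (suc x) 1 h e = contradiction (suc-injective (trans (+-comm 1 (2 * suc x)) e)) (λ ())
      bound (suc x) 2 h e = *-cancelˡ-≤ 2 (≤-reflexive (+-cancelʳ-≡ 2 _ 2 e))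
      bound (suc x) (suc (suc (suc c))) (s≤s (s≤s ())) e

  not-dense : ∀ σ {M} → M ≤ m₁ → dense σ ≡ false → ∀ χ → card χ * Y ≤ 4 * n →
    ∑ (take M σ) (𝟙 ∘ inside χ) ≤ K * card χ
  not-dense σ {M} M≤ h χ small = begin
    ∑ (take M σ) (𝟙 ∘ inside χ)                    ≤⟨ ∑-take-mono M≤ σ _ ⟩
    ∑ (take m₁ σ) (𝟙 ∘ inside χ)                   ≡⟨ cong (λ l → ∑ l (𝟙 ∘ inside χ)) (select-full m₁ σ) ⟨
    ∑ (select (full m₁) σ) (𝟙 ∘ inside χ)          ≡⟨ ∑-cong (select (full m₁) σ) (λ e → cong 𝟙 (inside-lookup χ e)) ⟨
    ∑ (select (full m₁) σ) (𝟙 ∘ inside (lookup S)) ≤⟨ ≤-pred (≤ᵇ-false⁻ (suc (K * size S)) _ (∧-false-right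
      (≤ᵇ-true (≤-trans (≤-reflexive (cong (_* Y) (size-tabulate χ))) small))
      (any-false (denseOn σ) (allVec n) h (∈-allVec S)))) ⟩
    K * size S                                     ≡⟨ cong (K *_) (size-tabulate χ) ⟩
    K * card χ                                     ∎
    where
    open ≤-Reasoning
    S = Vec.tabulate χ

  not-low : ∀ σ → Irreflexive (take m₀ σ) → low σ ≡ false →
    IsCore (10 * K) (select (full m₀) σ) (lows σ) × card (lows σ) ≤ b
  not-low σ loopless h with peel-spec (10 * K) H loopless′ b (λ _ → false) (≤-trans (≤-reflexive (∑-zero H)) z≤n)
    where
    H = select (full m₀) σ
    loopless′ : Irreflexive H
    loopless′ = subst Irreflexive (sym (select-full m₀ σ)) loopless
  ... | sp , c≤ , inj₁ core = core , ≤-trans c≤ (≤-reflexive (cong (_+ b) (∑-zero (allFin n))))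
  ... | sp , c≤ , inj₂ c≡ = contradiction (any-false (lowOn σ) (allVec n) h (∈-allVec S)) (λ e → true≢false
      (cong₂ _∧_ (cong₂ _∧_ (≤ᵇ-true (≤-reflexive size≡)) (≤ᵇ-true (≤-reflexive (sym size≡))))
        (≤ᵇ-true (begin
          ∑ H (𝟙 ∘ cross (lookup S)) ≡⟨ ∑-cong H (λ e → cong 𝟙 (cross-lookup (lows σ) e)) ⟩
          ∑ H (𝟙 ∘ cross (lows σ))   ≤⟨ ∑-mono H (cross≤touch (10 * K) H (lows σ)) ⟩
          ∑ H (𝟙 ∘ touch (lows σ))   ≤⟨ sp ⟩
          10 * K * card (lows σ)     ≡⟨ cong (10 * K *_) card≡ ⟩
          10 * K * b                 ∎))) e)
    where
    open ≤-Reasoning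
    H = select (full m₀) σ
    S = Vec.tabulate (lows σ)
    card≡ : card (lows σ) ≡ b
    card≡ = trans c≡ (cong (_+ b) (∑-zero (allFin n)))
    size≡ : size S ≡ b
    size≡ = trans (size-tabulate (lows σ)) card≡

  trues-touchMask : ∀ {σ} → σ ∈ orderings n → low σ ≡ false → high σ ≡ false → trues (touchMask σ) ≤ b * Δ
  trues-touchMask {σ} σ∈ ¬low ¬high = begin
    trues (touchMask σ)                     ≡⟨ ∑-map (touch L) (take m₁ σ) 𝟙 ⟩
    ∑ (take m₁ σ) (𝟙 ∘ touch L)             ≤⟨ touch-degrees L (take m₁ σ) (All.take⁺ m₁ (ordering-loopless σ∈)) ⟩
    ∑ (allFin n) (λ v → 𝟙 (L v) * ∑ (take m₁ σ) (𝟙 ∘ cross (v ==_)))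
      ≤⟨ ∑-mono (allFin n) (λ v → *-monoʳ-≤ (𝟙 (L v)) (≤-pred (≤ᵇ-false⁻ (suc Δ) _
           (subst (λ l → (suc Δ ≤ᵇ ∑ l (𝟙 ∘ cross (v ==_))) ≡ false) (select-full m₁ σ)
             (any-false (highDegree σ) (allFin n) ¬high (∈-allFin v)))))) ⟩
    ∑ (allFin n) (λ v → 𝟙 (L v) * Δ)        ≡⟨ ∑-*ʳ (allFin n) Δ (𝟙 ∘ L) ⟩
    card L * Δ                              ≤⟨ *-monoˡ-≤ Δ (proj₂ (not-low σ (All.take⁺ m₀ (ordering-loopless σ∈)) ¬low)) ⟩
    b * Δ                                   ∎
    where
    open ≤-Reasoning
    L = lows σ

∁-involutive : ∀ {m} (A : Vec Bool m) → ∁ (∁ A) ≡ A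
∁-involutive []          = refl
∁-involutive (true ∷ A)  = cong (true ∷_) (∁-involutive A)
∁-involutive (false ∷ A) = cong (false ∷_) (∁-involutive A)

module Deterministic (k m₀ m₁ K Y b Δ : ℕ) (K>0 : 0 < K) (5≤Y : 5 ≤ Y) (m₁<N : m₁ < Nn (suc k)) (1≤k : 1 ≤ k) where

  open Events k m₀ m₁ K Y b Δ

  -- The conditions for an obstruction A whose rank in the first graph is at most `n/2`. Any other
  -- obstruction is treated with the orderings exchanged and A replaced by its complement, so `good`
  -- asks for both directions.
  record OneSided (σ τ : Ordering) : Set where
    field
      σ∈         : σ ∈ orderings n
      τ∈         : τ ∈ orderings n
      ¬dense     : dense σ ≡ false
      ¬dense′    : dense τ ≡ false
      ¬low       : low τ ≡ false
      ¬clash     : clash σ τ ≡ false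
      ¬separated : separated σ τ ≡ false

  module _ {σ τ : Ordering} (S : OneSided σ τ) {M : ℕ} (m₀≤M : m₀ ≤ M) (M≤m₁ : M ≤ m₁)
           (conn : connected (take M τ) ≡ true) (A : Vec Bool M) where
    open OneSided S

    private
      its : List (Item n)
      its = items A σ τ
      M≤N : M ≤ Nn n
      M≤N = ≤-trans M≤m₁ (<⇒≤ m₁<N)
      M≤σ : M ≤ length σ
      M≤σ = ≤-trans M≤N (≤-reflexive (sym (ordering-length σ∈)))
      M≤τ : M ≤ length τ
      M≤τ = ≤-trans M≤N (≤-reflexive (sym (ordering-length τ∈)))

      ∑-e₁ : ∀ g → ∑ its (g ∘ e₁) ≡ ∑ (take M σ) g
      ∑-e₁ g = trans (sym (∑-map e₁ its g)) (cong (λ l → ∑ l g) (items-e₁ A σ τ M≤σ M≤τ))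

      ∑-e₂ : ∀ g → ∑ its (g ∘ e₂) ≡ ∑ (take M τ) g
      ∑-e₂ g = trans (sym (∑-map e₂ its g)) (cong (λ l → ∑ l g) (items-e₂ A σ τ M≤σ M≤τ))

      All-e₁ : ∀ {P : Edge n → Set} → All P (take M σ) → All (P ∘ e₁) its
      All-e₁ {P} h = All.map⁻ (subst (All P) (sym (items-e₁ A σ τ M≤σ M≤τ)) h)

      All-e₂ : ∀ {P : Edge n → Set} → All (P ∘ e₂) its → All P (take M τ)
      All-e₂ {P} h = subst (All P) (items-e₂ A σ τ M≤σ M≤τ) (All.map⁺ h)

    typical : Typical its K Y
    typical .Typical.L = lows τ
    typical .Typical.K>0 = K>0
    typical .Typical.simple χ h = ≤-trans (≤-reflexive (∑-e₁ (𝟙 ∘ inside χ))) (prefix-simple σ∈ M χ h)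
    typical .Typical.loopless = All-e₁ (All.take⁺ M (ordering-loopless σ∈))
    typical .Typical.connected₂ χ inv = connected-elim conn χ (All-e₂ inv)
    typical .Typical.sparse₁ χ h = ≤-trans (≤-reflexive (∑-e₁ (𝟙 ∘ inside χ))) (not-dense σ M≤m₁ ¬dense χ h)
    typical .Typical.sparse₂ χ h = ≤-trans (≤-reflexive (∑-e₂ (𝟙 ∘ inside χ))) (not-dense τ M≤m₁ ¬dense′ χ h)
    typical .Typical.core v h = begin
      10 * K                                        ≤⟨ proj₁ (not-low τ (All.take⁺ m₀ (ordering-loopless τ∈)) ¬low) v h ⟩
      ∑ (select (full m₀) τ) near                   ≡⟨ cong (λ l → ∑ l near) (select-full m₀ τ) ⟩
      ∑ (take m₀ τ) near                            ≤⟨ ∑-take-mono m₀≤M τ near ⟩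
      ∑ (take M τ) near                             ≡⟨ ∑-e₂ near ⟨
      ∑ its (near ∘ e₂)                             ∎
      where
      open ≤-Reasoning
      near : Edge n → ℕ
      near e = 𝟙 (cross (v ==_) e ∧ inside (not ∘ lows τ) e)
    typical .Typical.disjoint v = ≤-trans (items-∑ A (touch (lows τ)) (cross (v ==_)) σ τ M≤m₁)
      (≤-pred (≤ᵇ-false⁻ 2 _ (any-false (clashAt σ τ) (allFin n) ¬clash (∈-allFin v))))

    mixing : ∀ (R U : Fin n → Bool) → card R ≤ 2 * card U → 2 * card R ≤ n → 4 * card U ≤ 3 * n →
      n < card U * Y → ∃[ it ] it ∈ its × inside (not ∘ R) (e₁ it) ≡ true × cross U (e₂ it) ≡ true
    mixing R U h₁ h₂ h₃ h₄ =
      let it , m , p , q = items-∃ A _ _ σ τ m₀≤M M≤σ M≤τ not-all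
      in it , m
       , trans (cong₂ (λ x y → not x ∧ not y) (sym (Vec.lookup∘tabulate R (proj₁ (e₁ it)))) (sym (Vec.lookup∘tabulate R (proj₂ (e₁ it))))) p
       , trans (sym (cross-lookup U (e₂ it))) q
      where
      R′ = Vec.tabulate R
      U′ = Vec.tabulate U
      #R = sym (size-tabulate R)
      #U = sym (size-tabulate U)
      admits : admissible R′ U′ ≡ true
      admits = cong₂ _∧_
        (cong₂ _∧_ (≤ᵇ-true (subst₂ (λ r u → r ≤ 2 * u) #R #U h₁)) (≤ᵇ-true (subst (λ r → 2 * r ≤ n) #R h₂)))
        (cong₂ _∧_ (≤ᵇ-true (subst (λ u → 4 * u ≤ 3 * n) #U h₃)) (≤ᵇ-true (subst (λ u → n < u * Y) #U h₄)))
      not-all : all (not ∘ cross (lookup U′)) (select (map (inside (not ∘ lookup R′)) (take m₀ σ)) τ) ≡ false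
      not-all = ∧-false-right admits (any-false (separatedBy σ τ R′) (allVec n)
        (any-false (λ R → any (separatedBy σ τ R) (allVec n)) (allVec n) ¬separated (∈-allVec R′)) (∈-allVec U′))

    one-sided : rank (sel A σ) + rank (sel (∁ A) τ) < k → 2 * rank (sel A σ) ≤ n → ⊥
    one-sided = subst₂ (λ E F → rank E + rank F < k → 2 * rank E ≤ n → ⊥)
      (items-inA A σ τ M≤σ M≤τ) (items-∁A A σ τ M≤σ M≤τ)
      (Separation.no-obstruction typical 5≤Y mixing)

  good : ∀ {σ τ} → OneSided σ τ → OneSided τ σ → disconnected σ ≡ false → disconnected τ ≡ false →
    noIsolated σ ≡ false → goodEvent n σ τ ≡ true
  good {σ} {τ} S T dσ dτ iso = goodEvent-intro n σ τ m₀ m₁ m₁<N (not-disconnected σ dσ) (not-disconnected τ dτ)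
    (isolated-disconnected (s≤s 1≤k) σ iso) tree
    where
    tree : ∀ M → m₀ ≤ M → M ≤ m₁ → connected (take M σ) ≡ true → connected (take M τ) ≡ true →
      containsMT σ τ M ≡ true
    tree M m₀≤M M≤m₁ cσ cτ with multiTree-or-obstruction M σ τ
    ... | inj₁ (I , h) = containsMT-intro σ τ I h
    ... | inj₂ (A , h) with 2 * rank (sel A σ) ≤? n
    ...   | yes small = ⊥-elim (one-sided S m₀≤M M≤m₁ cτ A h small)
    ...   | no large = ⊥-elim (one-sided T m₀≤M M≤m₁ cσ (∁ A)
        (subst (λ B → rank (sel (∁ A) τ) + rank (sel B σ) < k) (sym (∁-involutive A))
          (subst (_< k) (+-comm (rank (sel A σ)) _) h))
        (+-cancelˡ-≤ (2 * rank (sel A σ)) _ _ (begin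
          2 * rank (sel A σ) + 2 * rank (sel (∁ A) τ) ≡⟨ *-distribˡ-+ 2 (rank (sel A σ)) _ ⟨
          2 * (rank (sel A σ) + rank (sel (∁ A) τ))   ≤⟨ *-monoʳ-≤ 2 (<⇒≤ h) ⟩
          k + (k + 0)                                 ≤⟨ +-mono-≤ (n≤1+n k) (≤-trans (≤-reflexive (+-identityʳ k)) (n≤1+n k)) ⟩
          n + n                                       ≤⟨ +-monoˡ-≤ n (<⇒≤ (≰⇒> large)) ⟩
          2 * rank (sel A σ) + n                      ∎)))
      where open ≤-Reasoning

-- Probabilities of the exceptional events

trues-full : ∀ m → trues (full m) ≡ m
trues-full zero    = refl
trues-full (suc m) = cong suc (trues-full m)

length-full : ∀ m → length (full m) ≡ m
length-full m = List.length-replicate m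

ratio-^ : ∀ X T N H p q m → 0 < N → X * N ^ m ≤ T * H ^ m → H * p ≤ N * q → X * p ^ m ≤ T * q ^ m
ratio-^ X T N H p q m N>0 bound h = *-cancelʳ-≤′ (N ^ m) (^>0 N m N>0) (begin
  X * p ^ m * N ^ m     ≡⟨ lemma₁ X (p ^ m) (N ^ m) ⟩
  X * N ^ m * p ^ m     ≤⟨ *-monoˡ-≤ (p ^ m) bound ⟩
  T * H ^ m * p ^ m     ≡⟨ trans (*-assoc T _ _) (cong (T *_) (sym ([m*n]^k H p m))) ⟩
  T * (H * p) ^ m       ≤⟨ *-monoʳ-≤ T (^-monoˡ-≤ m h) ⟩
  T * (N * q) ^ m       ≡⟨ cong (T *_) ([m*n]^k N q m) ⟩
  T * (N ^ m * q ^ m)   ≡⟨ lemma₂ T (N ^ m) (q ^ m) ⟩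
  T * q ^ m * N ^ m     ∎)
  where
  open ≤-Reasoning
  lemma₁ : ∀ a b c → a * b * c ≡ a * c * b
  lemma₁ = solve-∀
  lemma₂ : ∀ a b c → a * (b * c) ≡ a * c * b
  lemma₂ = solve-∀

-- With `n = w + u`: `1 - u/n ≤ (1 - 1/n)^u` by Bernoulli, and `(1 - 1/n)^n ≤ 1/2`.
w^n*2^u≤n^n : ∀ w u → 0 < w + u → w ^ (w + u) * 2 ^ u ≤ (w + u) ^ (w + u)
w^n*2^u≤n^n w u n>0 with w + u in eq
w^n*2^u≤n^n w u (s≤s _) | n@(suc k) = *-cancelʳ-≤′ ((n ^ u) ^ n) (^>0 (n ^ u) n (^>0 n u (s≤s z≤n))) (begin
  w ^ n * 2 ^ u * (n ^ u) ^ n       ≡⟨ lemma₁ (w ^ n) (2 ^ u) ((n ^ u) ^ n) ⟩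
  2 ^ u * (w ^ n * (n ^ u) ^ n)     ≡⟨ cong (2 ^ u *_) ([m*n]^k w (n ^ u) n) ⟨
  2 ^ u * (w * n ^ u) ^ n           ≤⟨ *-monoʳ-≤ (2 ^ u) (^-monoˡ-≤ n bern) ⟩
  2 ^ u * (k ^ u * n) ^ n           ≡⟨ cong (2 ^ u *_) (trans ([m*n]^k (k ^ u) n n) (cong (_* n ^ n) (^-comm k u n))) ⟩
  2 ^ u * ((k ^ n) ^ u * n ^ n)     ≡⟨ *-assoc (2 ^ u) _ _ ⟨
  2 ^ u * (k ^ n) ^ u * n ^ n       ≡⟨ cong (_* n ^ n) ([m*n]^k 2 (k ^ n) u) ⟨
  (2 * k ^ n) ^ u * n ^ n           ≤⟨ *-monoˡ-≤ (n ^ n) (^-monoˡ-≤ u (2*n^[1+n]≤[1+n]^[1+n] k)) ⟩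
  (n ^ n) ^ u * n ^ n               ≡⟨ trans (*-comm _ (n ^ n)) (cong (n ^ n *_) (^-comm n n u)) ⟩
  n ^ n * (n ^ u) ^ n               ∎)
  where
  open ≤-Reasoning
  lemma₁ : ∀ a b c → a * b * c ≡ b * (a * c)
  lemma₁ = solve-∀
  lemma₂ : ∀ p w u → p * (w + u) ≡ w * p + u * p
  lemma₂ = solve-∀
  bern : w * n ^ u ≤ k ^ u * n
  bern = +-cancelʳ-≤ (u * n ^ u) _ _ (begin
    w * n ^ u + u * n ^ u         ≡⟨ lemma₂ (n ^ u) w u ⟨
    n ^ u * (w + u)               ≡⟨ cong (n ^ u *_) eq ⟩
    n ^ u * n                     ≤⟨ bernoulli-suc k u ⟩
    k ^ u * n + u * n ^ u         ∎)

∑-any : ∀ {A B : Set} (xs : List A) (ys : List B) (p : A → B → Bool) →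
  ∑ xs (λ x → 𝟙 (any (p x) ys)) ≤ ∑ ys (λ y → ∑ xs (λ x → 𝟙 (p x y)))
∑-any xs ys p = ≤-trans (∑-mono xs (λ x → 𝟙-any (p x) ys)) (≤-reflexive (∑-swap xs ys _))

∑-guard-≤ : ∀ {A : Set} (xs : List A) b (p : A → Bool) c T → (b ≡ true → ∑ xs (𝟙 ∘ p) * c ≤ T) →
  ∑ xs (λ x → 𝟙 (b ∧ p x)) * c ≤ T
∑-guard-≤ xs true  p c T h = h refl
∑-guard-≤ xs false p c T h = ≤-trans (≤-reflexive (cong (_* c) (∑-zero xs))) z≤n

module Single (k m₀ m₁ K Y b Δ s : ℕ) (m₁≡ : m₁ ≡ suc k * s) (m₁≤N : m₁ ≤ length (edgesK (suc k)))
  (m₀≤m₁ : m₀ ≤ m₁) (1≤k : 1 ≤ k) where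

  open Events k m₀ m₁ K Y b Δ
  open ≤-Reasoning

  N : ℕ
  N = length (edgesK n)

  2N≡ : 2 * N ≡ n * k
  2N≡ = 2*edges k

  N>0 : 0 < N
  N>0 = *-cancelˡ-< 2 0 N (≤-trans (*-mono-≤ (s≤s (z≤n {k})) 1≤k) (≤-reflexive (sym 2N≡)))

  mask₁≤ : length (full m₁) ≤ N
  mask₁≤ = ≤-trans (≤-reflexive (length-full m₁)) m₁≤N

  mask₀≤ : length (full m₀) ≤ N
  mask₀≤ = ≤-trans (≤-reflexive (length-full m₀)) (≤-trans m₀≤m₁ m₁≤N)

  cross+uncross : ∀ χ → card χ * card (not ∘ χ) + ∑ (edgesK n) (𝟙 ∘ not ∘ cross χ) ≡ N
  cross+uncross χ = trans (cong (_+ ∑ (edgesK n) (𝟙 ∘ not ∘ cross χ)) (sym (cross-count χ))) (∑-not (cross χ) (edgesK n))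

  -- An edge crosses a cut around `u ≤ n/2` vertices with probability at least `u/n`, so `n s` edges
  -- all miss it with probability at most `2^(-s u)`. The union bound runs with weight `2^s` per
  -- vertex.
  disconnected-rare : suc s * n ≤ suc (2 ^ s) → s * ∑ (orderings n) (𝟙 ∘ disconnected) ≤ N !
  disconnected-rare small = ≤-trans (*-monoʳ-≤ s (∑-any (orderings n) (allVec n) disconnectedBy))
    (nonempty-subset-sum n (2 ^ s) (N !) s f small empty nonempty (^>0 2 s (s≤s z≤n)))
    where
    f : Vec Bool n → ℕ
    f S = ∑ (orderings n) (λ σ → 𝟙 (disconnectedBy σ S))
    empty : ∀ S → size S ≡ 0 → f S ≡ 0
    empty S h rewrite h = ∑-zero (orderings n)
    nonempty : ∀ S → 1 ≤ size S → f S * (2 ^ s) ^ size S ≤ N !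
    nonempty S _ = ∑-guard-≤ (orderings n) ((1 ≤ᵇ size S) ∧ (2 * size S ≤ᵇ n)) _ ((2 ^ s) ^ size S) (N !) (λ h →
      bound (≤ᵇ-true⁻ (2 * size S) n (proj₂ (∧-true {1 ≤ᵇ size S} h))))
      where
      u w H X : ℕ
      u = size S
      w = card (not ∘ lookup S)
      H = ∑ (edgesK n) (𝟙 ∘ not ∘ cross (lookup S))
      X = ∑ (orderings n) (λ σ → 𝟙 (all (not ∘ cross (lookup S)) (select (full m₁) σ)))
      w+u≡n : w + u ≡ n
      w+u≡n = trans (+-comm w u) (card-not (lookup S))
      bound : 2 * u ≤ n → X * (2 ^ s) ^ u ≤ N !
      bound 2u≤n = *-cancelʳ-≤′ (n ^ m₁) (^>0 n m₁ (s≤s z≤n)) (begin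
        X * (2 ^ s) ^ u * n ^ m₁       ≡⟨ lemma X ((2 ^ s) ^ u) (n ^ m₁) ⟩
        X * n ^ m₁ * (2 ^ s) ^ u       ≤⟨ *-monoˡ-≤ ((2 ^ s) ^ u) (ratio-^ X (N !) N H n w m₁ N>0 avoid H≤) ⟩
        N ! * w ^ m₁ * (2 ^ s) ^ u     ≡⟨ *-assoc (N !) _ _ ⟩
        N ! * (w ^ m₁ * (2 ^ s) ^ u)   ≤⟨ *-monoʳ-≤ (N !) shrink ⟩
        N ! * n ^ m₁                   ∎)
        where
        lemma : ∀ a b c → a * b * c ≡ a * c * b
        lemma = solve-∀
        avoid : X * N ^ m₁ ≤ N ! * H ^ m₁
        avoid = subst (λ j → X * N ^ j ≤ N ! * H ^ j) (trues-full m₁)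
          (avoid-count (edgesK n) (full m₁) mask₁≤ (not ∘ cross (lookup S)))
        n≤2w : n ≤ 2 * w
        n≤2w = +-cancelʳ-≤ (2 * u) _ _ (begin
          n + 2 * u       ≤⟨ +-monoʳ-≤ n 2u≤n ⟩
          n + n           ≡⟨ cong₂ _+_ (sym w+u≡n) (sym w+u≡n) ⟩
          w + u + (w + u) ≡⟨ lemma′ w u ⟩
          2 * w + 2 * u   ∎)
          where
          lemma′ : ∀ w u → w + u + (w + u) ≡ 2 * w + 2 * u
          lemma′ = solve-∀
        N≤nw : N ≤ n * w
        N≤nw = *-cancelˡ-≤ 2 (begin
          2 * N        ≡⟨ 2N≡ ⟩
          n * k        ≤⟨ *-monoʳ-≤ n (n≤1+n k) ⟩
          n * n        ≤⟨ *-monoʳ-≤ n n≤2w ⟩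
          n * (2 * w)  ≡⟨ lemma′ n w ⟩
          2 * (n * w)  ∎)
          where
          lemma′ : ∀ n w → n * (2 * w) ≡ 2 * (n * w)
          lemma′ = solve-∀
        H≤ : H * n ≤ N * w
        H≤ = +-cancelʳ-≤ (N * u) _ _ (begin
          H * n + N * u         ≤⟨ +-monoʳ-≤ (H * n) (*-monoˡ-≤ u N≤nw) ⟩
          H * n + n * w * u     ≡⟨ lemma′ H n w u ⟩
          (u * w + H) * n       ≡⟨ cong (_* n) (cross+uncross (lookup S)) ⟩
          N * n                 ≡⟨ cong (N *_) w+u≡n ⟨
          N * (w + u)           ≡⟨ *-distribˡ-+ N w u ⟩
          N * w + N * u         ∎)
          where
          lemma′ : ∀ H n w u → H * n + n * w * u ≡ (u * w + H) * n
          lemma′ = solve-∀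
        shrink : w ^ m₁ * (2 ^ s) ^ u ≤ n ^ m₁
        shrink = begin
          w ^ m₁ * (2 ^ s) ^ u          ≡⟨ cong₂ (λ m z → w ^ m * z) m₁≡ (^-comm 2 s u) ⟩
          w ^ (n * s) * (2 ^ u) ^ s     ≡⟨ cong (_* (2 ^ u) ^ s) (^-*-assoc w n s) ⟨
          (w ^ n) ^ s * (2 ^ u) ^ s     ≡⟨ [m*n]^k (w ^ n) (2 ^ u) s ⟨
          (w ^ n * 2 ^ u) ^ s           ≤⟨ ^-monoˡ-≤ s (subst (λ m → w ^ m * 2 ^ u ≤ m ^ m) w+u≡n
                                             (w^n*2^u≤n^n w u (≤-trans (s≤s z≤n) (≤-reflexive (sym w+u≡n))))) ⟩
          (n ^ n) ^ s                   ≡⟨ ^-*-assoc n n s ⟩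
          n ^ (n * s)                   ≡⟨ cong (n ^_) m₁≡ ⟨
          n ^ m₁                        ∎

  -- A set of `a ≤ 4n/Y` vertices expects at most `a/z` inner edges, by the choice of `Y`, so the
  -- exponential moment with tilt `z` is at most `4^a`. More than `K a` inner edges would weigh
  -- `z^(K a)`, which exceeds this by the weight `Z^a` of the union bound.
  dense-rare : ∀ z Z → 0 < s → Y ≡ z * s * s → 4 * n ≤ s * k → 4 * Z ≤ z ^ K → suc s * n ≤ suc Z → 0 < Z →
    s * ∑ (orderings n) (𝟙 ∘ dense) ≤ N !
  dense-rare z Z s>0 Y≡ 4n≤ Z≤ small Z>0 = ≤-trans (*-monoʳ-≤ s (∑-any (orderings n) (allVec n) denseOn))
    (nonempty-subset-sum n Z (N !) s f small empty nonempty Z>0)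
    where
    f : Vec Bool n → ℕ
    f S = ∑ (orderings n) (λ σ → 𝟙 (denseOn σ S))
    module _ (S : Vec Bool n) where
      a H X : ℕ
      a = size S
      H = ∑ (edgesK n) (𝟙 ∘ inside (lookup S))
      X = ∑ (orderings n) (λ σ → 𝟙 (suc (K * a) ≤ᵇ ∑ (select (full m₁) σ) (𝟙 ∘ inside (lookup S))))
      zH≤ : a * Y ≤ 4 * n → z * H * m₁ ≤ a * N
      zH≤ aY≤ = *-cancelˡ-≤ 2 (+-cancelʳ-≤ (z * a * m₁) _ _ (begin
        2 * (z * H * m₁) + z * a * m₁   ≡⟨ lemma₁ z H a m₁ ⟩
        z * (2 * H + a) * m₁            ≡⟨ cong (λ x → z * x * m₁) (inside-count (lookup S)) ⟩
        z * (a * a) * m₁                ≡⟨ cong (z * (a * a) *_) m₁≡ ⟩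
        z * (a * a) * (n * s)           ≡⟨ lemma₂ z a n s ⟩
        a * n * (a * z * s)             ≤⟨ *-monoʳ-≤ (a * n) azs≤k ⟩
        a * n * k                       ≡⟨ *-assoc a n k ⟩
        a * (n * k)                     ≡⟨ cong (a *_) 2N≡ ⟨
        a * (2 * N)                     ≡⟨ lemma₃ a N ⟩
        2 * (a * N)                     ≤⟨ m≤m+n _ _ ⟩
        2 * (a * N) + z * a * m₁        ∎))
        where
        lemma₁ : ∀ z H a m → 2 * (z * H * m) + z * a * m ≡ z * (2 * H + a) * m
        lemma₁ = solve-∀
        lemma₂ : ∀ z a n s → z * (a * a) * (n * s) ≡ a * n * (a * z * s)
        lemma₂ = solve-∀
        lemma₃ : ∀ a N → a * (2 * N) ≡ 2 * (a * N)
        lemma₃ = solve-∀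
        azs≤k : a * z * s ≤ k
        azs≤k = *-cancelʳ-≤′ s s>0 (begin
          a * z * s * s     ≡⟨ trans (*-assoc (a * z) s s) (trans (*-assoc a z (s * s)) (cong (a *_) (sym (*-assoc z s s)))) ⟩
          a * (z * s * s)   ≡⟨ cong (a *_) Y≡ ⟨
          a * Y             ≤⟨ aY≤ ⟩
          4 * n             ≤⟨ 4n≤ ⟩
          s * k             ≡⟨ *-comm s k ⟩
          k * s             ∎)
      bound : a * Y ≤ 4 * n → X * Z ^ a ≤ N !
      bound aY≤ = *-cancelʳ-≤′ (4 ^ a) (^>0 4 a (s≤s z≤n)) (*-cancelʳ-≤′ (N ^ m₁) (^>0 N m₁ N>0) (begin
        X * Z ^ a * 4 ^ a * N ^ m₁      ≡⟨ cong (_* N ^ m₁) (trans (*-assoc X _ _) (cong (X *_) (trans (*-comm (Z ^ a) _) (sym ([m*n]^k 4 Z a))))) ⟩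
        X * (4 * Z) ^ a * N ^ m₁        ≤⟨ *-monoˡ-≤ (N ^ m₁) (*-monoʳ-≤ X power) ⟩
        X * (1 + z) ^ suc (K * a) * N ^ m₁ ≡⟨ cong (_* N ^ m₁) (*-comm X _) ⟩
        (1 + z) ^ suc (K * a) * X * N ^ m₁ ≤⟨ subst (λ j → (1 + z) ^ suc (K * a) * X * N ^ j ≤ N ! * (N + z * H) ^ j) (trues-full m₁)
                                             (upper-tail (edgesK n) (full m₁) mask₁≤ (inside (lookup S)) z (suc (K * a))) ⟩
        N ! * (N + z * H) ^ m₁          ≤⟨ *-monoʳ-≤ (N !) (exp-bound N (z * H) m₁ a (zH≤ aY≤)) ⟩
        N ! * (4 ^ a * N ^ m₁)          ≡⟨ *-assoc (N !) _ _ ⟨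
        N ! * 4 ^ a * N ^ m₁            ∎))
        where
        power : (4 * Z) ^ a ≤ (1 + z) ^ suc (K * a)
        power = begin
          (4 * Z) ^ a          ≤⟨ ^-monoˡ-≤ a Z≤ ⟩
          (z ^ K) ^ a          ≡⟨ ^-*-assoc z K a ⟩
          z ^ (K * a)          ≤⟨ ^-monoˡ-≤ (K * a) (n≤1+n z) ⟩
          (1 + z) ^ (K * a)    ≤⟨ ^-monoʳ-≤ (1 + z) (n≤1+n (K * a)) ⟩
          (1 + z) ^ suc (K * a) ∎
    empty : ∀ S → size S ≡ 0 → f S ≡ 0
    empty S h = n≤0⇒n≡0 (≤-trans (∑-mono (orderings n) (λ σ → 𝟙-mono (λ q →
        ≤ᵇ-true (≤-trans (≤-trans (s≤s z≤n) (≤ᵇ-true⁻ (suc (K * size S)) _ (proj₂ (∧-true {size S * Y ≤ᵇ 4 * n} q))))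
          (none σ))))) (≤-reflexive (∑-zero (orderings n))))
      where
      card0 : ∀ i → lookup S i ≡ false
      card0 i = All.lookup (∑𝟙≤0 (lookup S) (allFin n) (≤-reflexive h)) (∈-allFin i)
      none : ∀ σ → ∑ (select (full m₁) σ) (𝟙 ∘ inside (lookup S)) ≤ 0
      none σ = ≤-reflexive (trans (∑-cong (select (full m₁) σ) (λ e → cong (λ b → 𝟙 (b ∧ lookup S (proj₂ e))) (card0 (proj₁ e))))
        (∑-zero (select (full m₁) σ)))
    nonempty : ∀ S → 1 ≤ size S → f S * Z ^ size S ≤ N !
    nonempty S _ = ∑-guard-≤ (orderings n) (size S * Y ≤ᵇ 4 * n) _ (Z ^ size S) (N !) (λ h →
      bound S (≤ᵇ-true⁻ (size S * Y) (4 * n) h))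

  star-count : ∀ (v : Fin n) → ∑ (edgesK n) (𝟙 ∘ cross (v ==_)) ≡ k
  star-count v = trans (cross-count (v ==_)) (trans (cong (_* w) (card-single v)) (trans (*-identityˡ w) w≡k))
    where
    w = card (not ∘ (v ==_))
    w≡k : w ≡ k
    w≡k = suc-injective (trans (cong (_+ w) (sym (card-single v))) (card-not (v ==_)))

  -- The mean degree is `2s`, so the moment of base 2 is at most `4^(2s) = 2^(4s)`. As `Δ` is `8s`,
  -- half of the exponent remains for the union bound over the vertices.
  high-rare : Δ ≡ 4 * s + 4 * s → s * n ≤ 2 ^ (4 * s) → s * ∑ (orderings n) (𝟙 ∘ high) ≤ N !
  high-rare Δ≡ small = *-cancelʳ-≤′ (2 ^ (4 * s)) (^>0 2 (4 * s) (s≤s z≤n)) (begin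
    s * ∑ (orderings n) (𝟙 ∘ high) * 2 ^ (4 * s)
      ≤⟨ *-monoˡ-≤ (2 ^ (4 * s)) (*-monoʳ-≤ s (∑-any (orderings n) (allFin n) highDegree)) ⟩
    s * ∑ (allFin n) X * 2 ^ (4 * s)
      ≡⟨ trans (*-assoc s _ _) (cong (s *_) (sym (∑-*ʳ (allFin n) (2 ^ (4 * s)) X))) ⟩
    s * ∑ (allFin n) (λ v → X v * 2 ^ (4 * s))
      ≤⟨ *-monoʳ-≤ s (∑-mono (allFin n) bound) ⟩
    s * ∑ (allFin n) (λ v → N !)
      ≡⟨ cong (s *_) (trans (∑-const (allFin n) (N !)) (cong (_* N !) (length-allFin n))) ⟩
    s * (n * N !)
      ≡⟨ trans (sym (*-assoc s n _)) (*-comm (s * n) (N !)) ⟩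
    N ! * (s * n)
      ≤⟨ *-monoʳ-≤ (N !) small ⟩
    N ! * 2 ^ (4 * s) ∎)
    where
    X : Fin n → ℕ
    X v = ∑ (orderings n) (λ σ → 𝟙 (highDegree σ v))
    bound : ∀ v → X v * 2 ^ (4 * s) ≤ N !
    bound v = *-cancelʳ-≤′ (2 ^ (4 * s)) (^>0 2 (4 * s) (s≤s z≤n)) (*-cancelʳ-≤′ (N ^ m₁) (^>0 N m₁ N>0) (begin
      X v * 2 ^ (4 * s) * 2 ^ (4 * s) * N ^ m₁
        ≡⟨ cong (_* N ^ m₁) (trans (*-assoc (X v) _ _) (trans (cong (X v *_) (trans (sym (^-distribˡ-+-* 2 (4 * s) (4 * s))) (cong (2 ^_) (sym Δ≡)))) (*-comm (X v) _))) ⟩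
      2 ^ Δ * X v * N ^ m₁
        ≤⟨ *-monoˡ-≤ (N ^ m₁) (*-monoˡ-≤ (X v) (^-monoʳ-≤ 2 (n≤1+n Δ))) ⟩
      2 ^ suc Δ * X v * N ^ m₁
        ≤⟨ subst (λ j → 2 ^ suc Δ * X v * N ^ j ≤ N ! * (N + 1 * H) ^ j) (trues-full m₁)
             (upper-tail (edgesK n) (full m₁) mask₁≤ (cross (v ==_)) 1 (suc Δ)) ⟩
      N ! * (N + 1 * H) ^ m₁
        ≤⟨ *-monoʳ-≤ (N !) (exp-bound N (1 * H) m₁ (2 * s) H≤) ⟩
      N ! * (4 ^ (2 * s) * N ^ m₁)
        ≡⟨ trans (sym (*-assoc (N !) _ _)) (cong (λ x → N ! * x * N ^ m₁) (trans (^-*-assoc 2 2 (2 * s)) (cong (2 ^_) (sym (*-assoc 2 2 s))))) ⟩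
      N ! * 2 ^ (4 * s) * N ^ m₁ ∎))
      where
      H = ∑ (edgesK n) (𝟙 ∘ cross (v ==_))
      lemma₁ : ∀ k n s → 1 * k * (n * s) ≡ s * (n * k)
      lemma₁ = solve-∀
      lemma₂ : ∀ s N → s * (2 * N) ≡ 2 * s * N
      lemma₂ = solve-∀
      H≤ : 1 * H * m₁ ≤ 2 * s * N
      H≤ = ≤-reflexive (trans (cong₂ (λ h m → 1 * h * m) (star-count v) m₁≡)
        (trans (lemma₁ k n s) (trans (cong (s *_) (sym 2N≡)) (lemma₂ s N))))

module Low (l m₀ m₁ K Y b Δ z : ℕ) (m₁≡ : m₁ ≡ suc (suc l) * suc z) (m₁≤N : m₁ ≤ length (edgesK (suc (suc l))))
  (m₀≤m₁ : m₀ ≤ m₁) (l>0 : 0 < l) where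

  k s : ℕ
  k = suc l
  s = suc z

  open Events k m₀ m₁ K Y b Δ
  open Single k m₀ m₁ K Y b Δ s m₁≡ m₁≤N m₀≤m₁ (s≤s z≤n) public
  open ≤-Reasoning

  -- A probability G/M is compared with (1 - 2/n)^j through (1 - 2/n)^j ≥ 1 - 2j/n.
  compare-power : ∀ G M j → G * n + 2 * j * M ≤ M * n → G * n ^ j ≤ M * l ^ j
  compare-power G M j h = *-cancelʳ-≤′ n (s≤s z≤n) (+-cancelʳ-≤ (2 * j * M * n ^ j) _ _ (begin
    G * n ^ j * n + 2 * j * M * n ^ j     ≡⟨ lemma₁ G (n ^ j) n (2 * j * M) ⟩
    (G * n + 2 * j * M) * n ^ j           ≤⟨ *-monoˡ-≤ (n ^ j) h ⟩
    M * n * n ^ j                         ≡⟨ trans (*-assoc M n (n ^ j)) (cong (M *_) (*-comm n (n ^ j))) ⟩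
    M * (n ^ j * n)                       ≤⟨ *-monoʳ-≤ M (subst (λ x → x ^ j * x ≤ l ^ j * x + j * 2 * x ^ j) (+-comm l 2) (bernoulli⁻ l 2 j)) ⟩
    M * (l ^ j * n + j * 2 * n ^ j)       ≡⟨ lemma₂ M (l ^ j) n j (n ^ j) ⟩
    M * l ^ j * n + 2 * j * M * n ^ j     ∎))
    where
    lemma₁ : ∀ G p n x → G * p * n + x * p ≡ (G * n + x) * p
    lemma₁ = solve-∀
    lemma₂ : ∀ M q n j p → M * (q * n + j * 2 * p) ≡ M * q * n + 2 * j * M * p
    lemma₂ = solve-∀

  -- `m₀` is late enough for `(l/n)^m₀ ≤ s^(-a)`, so a bound by `(l/n)^(j m₀)` becomes a bound by
  -- `s^(-a j)`.
  use-m₀ : ∀ X C a j → s ^ a * l ^ m₀ ≤ n ^ m₀ → X * (n ^ j) ^ m₀ ≤ C * (l ^ j) ^ m₀ → X * (s ^ a) ^ j ≤ C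
  use-m₀ X C a j h bound = *-cancelʳ-≤′ ((l ^ m₀) ^ j) (^>0 (l ^ m₀) j (^>0 l m₀ l>0)) (begin
    X * (s ^ a) ^ j * (l ^ m₀) ^ j        ≡⟨ trans (*-assoc X _ _) (cong (X *_) (sym ([m*n]^k (s ^ a) (l ^ m₀) j))) ⟩
    X * (s ^ a * l ^ m₀) ^ j              ≤⟨ *-monoʳ-≤ X (^-monoˡ-≤ j h) ⟩
    X * (n ^ m₀) ^ j                      ≡⟨ cong (X *_) (^-comm n m₀ j) ⟩
    X * (n ^ j) ^ m₀                      ≤⟨ bound ⟩
    C * (l ^ j) ^ m₀                      ≡⟨ cong (C *_) (^-comm l j m₀) ⟩
    C * (l ^ m₀) ^ j                      ∎)

  -- With tilt `z = s - 1` an edge that crosses the set has relative weight `1/s`. The mean weight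
  -- of an edge is at most `(1 - 2/n)^(7β)`, nearly the exponent `8β = b` that the size of the set
  -- suggests, so the moment is at most `s^(-7aβ)`. The threshold `10 K b` costs `s^(80Kβ)` and the
  -- union bound `4^β y^b`.
  low-rare : ∀ a β y → s ^ a * l ^ m₀ ≤ n ^ m₀ → b ≡ 8 * β → 1 ≤ β → n ≤ y * β → 16 * b ≤ n → 14 * s ≤ 15 * z →
    s * (4 * y ^ 8 * s ^ (80 * K)) ≤ s ^ (7 * a) → 0 < y →
    s * ∑ (orderings n) (𝟙 ∘ low) ≤ N !
  low-rare a β y m₀-power b≡ 1≤β n≤yβ 16b≤n s-large power y>0 =
    *-cancelʳ-≤′ (4 ^ β) (^>0 4 β (s≤s z≤n)) (*-cancelʳ-≤′ (y ^ n) (^>0 y n y>0) (begin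
      s * ∑ (orderings n) (𝟙 ∘ low) * 4 ^ β * y ^ n
        ≤⟨ *-monoˡ-≤ (y ^ n) (*-monoˡ-≤ (4 ^ β) (*-monoʳ-≤ s (∑-any (orderings n) (allVec n) lowOn))) ⟩
      s * ∑ (allVec n) f * 4 ^ β * y ^ n
        ≡⟨ cong (_* y ^ n) (trans (lemma s (∑ (allVec n) f) (4 ^ β)) (sym (∑-*ˡ (allVec n) (s * 4 ^ β) f))) ⟩
      ∑ (allVec n) (λ S → s * 4 ^ β * f S) * y ^ n
        ≤⟨ subset-sum n y (N !) (λ S → s * 4 ^ β * f S) each ⟩
      N ! * (1 + y) ^ n
        ≤⟨ *-monoʳ-≤ (N !) (exp-bound-suc y n β (≤-trans n≤yβ (≤-reflexive (*-comm y β)))) ⟩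
      N ! * (4 ^ β * y ^ n)
        ≡⟨ *-assoc (N !) _ _ ⟨
      N ! * 4 ^ β * y ^ n ∎))
    where
    lemma : ∀ s f x → s * f * x ≡ s * x * f
    lemma = solve-∀
    f : Vec Bool n → ℕ
    f S = ∑ (orderings n) (λ σ → 𝟙 (lowOn σ S))
    j : ℕ
    j = 7 * β
    module _ (S : Vec Bool n) (size≡ : size S ≡ b) where
      w H Hᶜ X : ℕ
      w = card (not ∘ lookup S)
      H = b * w
      Hᶜ = ∑ (edgesK n) (𝟙 ∘ not ∘ cross (lookup S))
      X = ∑ (orderings n) (λ σ → 𝟙 (∑ (select (full m₀) σ) (𝟙 ∘ cross (lookup S)) ≤ᵇ 10 * K * b))
      H+Hᶜ : H + Hᶜ ≡ N
      H+Hᶜ = subst (λ c → c * w + Hᶜ ≡ N) size≡ (cross+uncross (lookup S))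
      b+w : b + w ≡ n
      b+w = subst (λ c → c + w ≡ n) size≡ (card-not (lookup S))
      -- Here `7/8 = 14/15 · 15/16`, with the first factor for `z` against `s` and the second for
      -- `w = n - b` against `k`.
      7sk≤8zw : 7 * s * k ≤ 8 * z * w
      7sk≤8zw = *-cancelˡ-≤ 16 (begin
        16 * (7 * s * k)      ≡⟨ lemma₁ s k ⟩
        8 * k * (14 * s)      ≤⟨ *-monoʳ-≤ (8 * k) s-large ⟩
        8 * k * (15 * z)      ≡⟨ lemma₂ k z ⟩
        8 * z * (15 * k)      ≤⟨ *-monoʳ-≤ (8 * z) 15k≤16w ⟩
        8 * z * (16 * w)      ≡⟨ lemma₃ z w ⟩
        16 * (8 * z * w)      ∎)
        where
        lemma₁ : ∀ s k → 16 * (7 * s * k) ≡ 8 * k * (14 * s)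
        lemma₁ = solve-∀
        lemma₂ : ∀ k z → 8 * k * (15 * z) ≡ 8 * z * (15 * k)
        lemma₂ = solve-∀
        lemma₃ : ∀ z w → 8 * z * (16 * w) ≡ 16 * (8 * z * w)
        lemma₃ = solve-∀
        15k≤16w : 15 * k ≤ 16 * w
        15k≤16w = ≤-trans (*-monoʳ-≤ 15 (n≤1+n k)) (+-cancelˡ-≤ n _ _ (begin
          n + 15 * n       ≡⟨⟩
          16 * n           ≡⟨ cong (16 *_) b+w ⟨
          16 * (b + w)     ≡⟨ *-distribˡ-+ 16 b w ⟩
          16 * b + 16 * w  ≤⟨ +-monoˡ-≤ (16 * w) 16b≤n ⟩
          n + 16 * w       ∎))
      gap : 2 * j * (s * N) ≤ z * H * n
      gap = begin
        2 * j * (s * N)        ≡⟨ lemma₁ β s N ⟩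
        7 * β * s * (2 * N)    ≡⟨ cong (7 * β * s *_) 2N≡ ⟩
        7 * β * s * (n * k)    ≡⟨ lemma₂ β s n k ⟩
        β * n * (7 * s * k)    ≤⟨ *-monoʳ-≤ (β * n) 7sk≤8zw ⟩
        β * n * (8 * z * w)    ≡⟨ lemma₃ β n z w ⟩
        z * (8 * β * w) * n    ≡⟨ cong (λ c → z * (c * w) * n) b≡ ⟨
        z * H * n              ∎
        where
        lemma₁ : ∀ β s N → 2 * (7 * β) * (s * N) ≡ 7 * β * s * (2 * N)
        lemma₁ = solve-∀
        lemma₂ : ∀ β s n k → 7 * β * s * (n * k) ≡ β * n * (7 * s * k)
        lemma₂ = solve-∀
        lemma₃ : ∀ β n z w → β * n * (8 * z * w) ≡ z * (8 * β * w) * n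
        lemma₃ = solve-∀
      mean : (N + z * Hᶜ) * n + 2 * j * (s * N) ≤ s * N * n
      mean = begin
        (N + z * Hᶜ) * n + 2 * j * (s * N) ≤⟨ +-monoʳ-≤ ((N + z * Hᶜ) * n) gap ⟩
        (N + z * Hᶜ) * n + z * H * n       ≡⟨ lemma₁ N z Hᶜ H n ⟩
        (N + z * (H + Hᶜ)) * n             ≡⟨ cong (λ c → (N + z * c) * n) H+Hᶜ ⟩
        s * N * n                          ∎
        where
        lemma₁ : ∀ N z c h n → (N + z * c) * n + z * h * n ≡ (N + z * (h + c)) * n
        lemma₁ = solve-∀
      tail : X * (s * N) ^ m₀ ≤ s ^ (10 * K * b) * N ! * (N + z * Hᶜ) ^ m₀
      tail = begin
        X * (s * N) ^ m₀              ≡⟨ trans (cong (X *_) ([m*n]^k s N m₀)) (lemma₁ X (s ^ m₀) (N ^ m₀)) ⟩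
        s ^ m₀ * X * N ^ m₀           ≤⟨ subst (λ i → s ^ i * X * N ^ i ≤ s ^ (10 * K * b) * (N ! * (N + z * Hᶜ) ^ i)) (trues-full m₀)
                                           (lower-tail (edgesK n) (full m₀) mask₀≤ (cross (lookup S)) z (10 * K * b)) ⟩
        s ^ (10 * K * b) * (N ! * (N + z * Hᶜ) ^ m₀) ≡⟨ *-assoc (s ^ (10 * K * b)) _ _ ⟨
        s ^ (10 * K * b) * N ! * (N + z * Hᶜ) ^ m₀ ∎
        where
        lemma₁ : ∀ x a c → x * (a * c) ≡ a * x * c
        lemma₁ = solve-∀
      sN>0 : 0 < s * N
      sN>0 = *-mono-≤ (s≤s (z≤n {z})) N>0
      X-bound : X * (s ^ (7 * a)) ^ β ≤ (s ^ (80 * K)) ^ β * N !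
      X-bound = begin
        X * (s ^ (7 * a)) ^ β      ≡⟨ cong (X *_) powers₁ ⟩
        X * (s ^ a) ^ j            ≤⟨ use-m₀ X (s ^ (10 * K * b) * N !) a j m₀-power
                                        (ratio-^ X (s ^ (10 * K * b) * N !) (s * N) (N + z * Hᶜ) (n ^ j) (l ^ j) m₀ sN>0 tail
                                          (compare-power (N + z * Hᶜ) (s * N) j mean)) ⟩
        s ^ (10 * K * b) * N !     ≡⟨ cong (_* N !) powers₂ ⟩
        (s ^ (80 * K)) ^ β * N !   ∎
        where
        lemma₁ : ∀ a β → 7 * a * β ≡ a * (7 * β)
        lemma₁ = solve-∀
        lemma₂ : ∀ K β → 10 * K * (8 * β) ≡ 80 * K * β
        lemma₂ = solve-∀
        powers₁ : (s ^ (7 * a)) ^ β ≡ (s ^ a) ^ j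
        powers₁ = trans (^-*-assoc s (7 * a) β) (trans (cong (s ^_) (lemma₁ a β)) (sym (^-*-assoc s a j)))
        powers₂ : s ^ (10 * K * b) ≡ (s ^ (80 * K)) ^ β
        powers₂ = trans (cong (s ^_) (trans (cong (10 * K *_) b≡) (lemma₂ K β))) (sym (^-*-assoc s (80 * K) β))
      weighted : X * (s * 4 ^ β * y ^ b) ≤ N !
      weighted = *-cancelʳ-≤′ ((s ^ (80 * K)) ^ β) (^>0 _ β (^>0 s (80 * K) (s≤s z≤n))) (begin
        X * (s * 4 ^ β * y ^ b) * (s ^ (80 * K)) ^ β
          ≡⟨ *-assoc X _ _ ⟩
        X * (s * 4 ^ β * y ^ b * (s ^ (80 * K)) ^ β)
          ≡⟨ cong (λ c → X * (s * 4 ^ β * c * (s ^ (80 * K)) ^ β)) (trans (cong (y ^_) b≡) (sym (^-*-assoc y 8 β))) ⟩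
        X * (s * 4 ^ β * (y ^ 8) ^ β * (s ^ (80 * K)) ^ β)
          ≡⟨ cong (X *_) (lemma₁ s (4 ^ β) ((y ^ 8) ^ β) ((s ^ (80 * K)) ^ β)) ⟩
        X * (s * (4 ^ β * (y ^ 8) ^ β * (s ^ (80 * K)) ^ β))
          ≡⟨ cong (λ c → X * (s * c)) (trans ([m*n]^k (4 * y ^ 8) (s ^ (80 * K)) β)
               (cong (_* (s ^ (80 * K)) ^ β) ([m*n]^k 4 (y ^ 8) β))) ⟨
        X * (s * (4 * y ^ 8 * s ^ (80 * K)) ^ β)
          ≤⟨ *-monoʳ-≤ X (*-monoˡ-≤ _ (≤-trans (≤-reflexive (sym (*-identityʳ s))) (^-monoʳ-≤ s 1≤β))) ⟩
        X * (s ^ β * (4 * y ^ 8 * s ^ (80 * K)) ^ β)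
          ≡⟨ cong (X *_) ([m*n]^k s (4 * y ^ 8 * s ^ (80 * K)) β) ⟨
        X * (s * (4 * y ^ 8 * s ^ (80 * K))) ^ β
          ≤⟨ *-monoʳ-≤ X (^-monoˡ-≤ β power) ⟩
        X * (s ^ (7 * a)) ^ β
          ≤⟨ X-bound ⟩
        (s ^ (80 * K)) ^ β * N !
          ≡⟨ *-comm _ (N !) ⟩
        N ! * (s ^ (80 * K)) ^ β ∎)
        where
        lemma₁ : ∀ s a b c → s * a * b * c ≡ s * (a * b * c)
        lemma₁ = solve-∀
    each : ∀ S → s * 4 ^ β * f S * y ^ size S ≤ N !
    each S = ≤-trans (≤-reflexive (lemma₁ (s * 4 ^ β) (f S) (y ^ size S)))
      (∑-guard-≤ (orderings n) ((size S ≤ᵇ b) ∧ (b ≤ᵇ size S)) _ (s * 4 ^ β * y ^ size S) (N !) (λ h →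
        let p , q = ∧-true {size S ≤ᵇ b} h
            e = ≤-antisym (≤ᵇ-true⁻ (size S) b p) (≤ᵇ-true⁻ b (size S) q)
        in subst (λ c → X S e * (s * 4 ^ β * y ^ c) ≤ N !) (sym e) (weighted S e)))
      where
      lemma₁ : ∀ x g p → x * g * p ≡ g * (x * p)
      lemma₁ = solve-∀

  -- An edge meets `v` with probability `2/n`. So `ζ B ≤ n` bounds the moment with tilt `ζ` by
  -- `4² = 16`, and two hits have probability at most `16/ζ²`. Summing over the vertices, this
  -- birthday bound needs `ζ` above `√n` and therefore `B` below it.
  clash-rare : ∀ B ζ τ → trues (touchMask τ) ≤ B → length (touchMask τ) ≤ N → ζ * B ≤ n → 16 * s * n ≤ ζ * ζ →
    s * ∑ (orderings n) (λ σ → 𝟙 (clash σ τ)) ≤ N !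
  clash-rare B ζ τ ≤B mask≤ ζB≤n large = *-cancelʳ-≤′ (ζ * ζ) (≤-trans (*-mono-≤ {1} {16 * s} {1} {n} (s≤s z≤n) (s≤s z≤n)) large) (begin
    s * ∑ (orderings n) (λ σ → 𝟙 (clash σ τ)) * (ζ * ζ)
      ≤⟨ *-monoˡ-≤ (ζ * ζ) (*-monoʳ-≤ s (∑-any (orderings n) (allFin n) (λ σ → clashAt σ τ))) ⟩
    s * ∑ (allFin n) X * (ζ * ζ)
      ≡⟨ trans (*-assoc s (∑ (allFin n) X) (ζ * ζ)) (cong (s *_) (sym (∑-*ʳ (allFin n) (ζ * ζ) X))) ⟩
    s * ∑ (allFin n) (λ v → X v * (ζ * ζ))
      ≤⟨ *-monoʳ-≤ s (∑-mono (allFin n) bound) ⟩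
    s * ∑ (allFin n) (λ v → 16 * N !)
      ≡⟨ cong (s *_) (trans (∑-const (allFin n) (16 * N !)) (cong (_* (16 * N !)) (length-allFin n))) ⟩
    s * (n * (16 * N !))
      ≡⟨ lemma s n (N !) ⟩
    N ! * (16 * s * n)
      ≤⟨ *-monoʳ-≤ (N !) large ⟩
    N ! * (ζ * ζ) ∎)
    where
    lemma : ∀ s n T → s * (n * (16 * T)) ≡ T * (16 * s * n)
    lemma = solve-∀
    t = trues (touchMask τ)
    X : Fin n → ℕ
    X v = ∑ (orderings n) (λ σ → 𝟙 (clashAt σ τ v))
    bound : ∀ v → X v * (ζ * ζ) ≤ 16 * N !
    bound v = *-cancelʳ-≤′ (N ^ t) (^>0 N t N>0) (begin
      X v * (ζ * ζ) * N ^ t         ≤⟨ *-monoˡ-≤ (N ^ t) (≤-trans (≤-reflexive (*-comm (X v) _)) (*-monoˡ-≤ (X v)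
                                         (*-mono-≤ (n≤1+n ζ) (≤-trans (n≤1+n ζ) (≤-reflexive (sym (*-identityʳ (suc ζ)))))))) ⟩
      (1 + ζ) ^ 2 * X v * N ^ t     ≤⟨ upper-tail (edgesK n) (touchMask τ) mask≤ (cross (v ==_)) ζ 2 ⟩
      N ! * (N + ζ * H) ^ t         ≤⟨ *-monoʳ-≤ (N !) (exp-bound N (ζ * H) t 2 small) ⟩
      N ! * (16 * N ^ t)            ≡⟨ lemma₁ (N !) (N ^ t) ⟩
      16 * N ! * N ^ t              ∎)
      where
      H = ∑ (edgesK n) (𝟙 ∘ cross (v ==_))
      lemma₁ : ∀ T p → T * (16 * p) ≡ 16 * T * p
      lemma₁ = solve-∀
      lemma₂ : ∀ ζ k B → ζ * k * B ≡ ζ * B * k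
      lemma₂ = solve-∀
      small : ζ * H * t ≤ 2 * N
      small = begin
        ζ * H * t   ≤⟨ *-mono-≤ (≤-reflexive (cong (ζ *_) (star-count v))) ≤B ⟩
        ζ * k * B   ≡⟨ lemma₂ ζ k B ⟩
        ζ * B * k   ≤⟨ *-monoˡ-≤ k ζB≤n ⟩
        n * k       ≡⟨ 2N≡ ⟨
        2 * N       ∎

m<[1+m/n]*n : ∀ m n .{{_ : NonZero n}} → m < suc (m Div./ n) * n
m<[1+m/n]*n m n = ≤-trans (s≤s (≤-reflexive (Div.m≡m%n+[m/n]*n m n))) (+-monoˡ-≤ (m Div./ n * n) (Div.m%n<n m n))

module Separate (l m₀ m₁ K Y b Δ z : ℕ) (m₁≡ : m₁ ≡ suc (suc l) * suc z) (m₁≤N : m₁ ≤ length (edgesK (suc (suc l))))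
  (m₀≤m₁ : m₀ ≤ m₁) (l>0 : 0 < l) where

  open Low l m₀ m₁ K Y b Δ z m₁≡ m₁≤N m₀≤m₁ l>0 public
  open Events k m₀ m₁ K Y b Δ
  open ≤-Reasoning

  private
    pairs : (Ordering → Ordering → Bool) → ℕ
    pairs p = (orderings n ⟨×⟩ orderings n) (λ σ τ → 𝟙 (p σ τ))

  module _ (R U : Vec Bool n) where

    private
      r u g w X H : ℕ
      r = size R
      u = size U
      g = card (not ∘ lookup R)
      w = card (not ∘ lookup U)
      p q : Edge n → Bool
      p = inside (not ∘ lookup R)
      q = not ∘ cross (lookup U)
      X = ∑ (edgesK n) (𝟙 ∘ p)
      H = ∑ (edgesK n) (𝟙 ∘ q)
      -- For fixed `σ`, each position whose edge in `σ` avoids `R` costs a factor `H/N` in the bound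
      -- for `τ`. This bound is a product over the entries of `σ`, so `maclaurin` applies a second
      -- time, now to `γ`.
      γ : Edge n → ℕ
      γ e = if p e then H else N
      G : ℕ
      G = ∑ (edgesK n) γ
      f : ℕ
      f = pairs (λ σ τ → all q (select (map p (take m₀ σ)) τ))

      product : ∀ es → H ^ trues (map p es) * N ^ length es ≡ N ^ trues (map p es) * ∏ es γ
      product []       = refl
      product (e ∷ es) with p e
      ... | true  = trans (lemma₁ H (H ^ trues (map p es)) N (N ^ length es)) (trans
          (cong (λ x → H * N * x) (product es)) (lemma₂ H N (N ^ trues (map p es)) (∏ es γ)))
        where
        lemma₁ : ∀ h a n b → h * a * (n * b) ≡ h * n * (a * b)
        lemma₁ = solve-∀
        lemma₂ : ∀ h n a b → h * n * (a * b) ≡ n * a * (h * b)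
        lemma₂ = solve-∀
      ... | false = trans (lemma₁ (H ^ trues (map p es)) N (N ^ length es)) (trans
          (cong (N *_) (product es)) (lemma₁ N (N ^ trues (map p es)) (∏ es γ)))
        where
        lemma₁ : ∀ a n b → a * (n * b) ≡ n * (a * b)
        lemma₁ a n b = trans (sym (*-assoc a n b)) (trans (cong (_* b) (*-comm a n)) (*-assoc n a b))
      product′ : ∀ es x T → x * N ^ trues (map p es) ≤ T * H ^ trues (map p es) → x * N ^ length es ≤ T * ∏ es γ
      product′ es x T h = *-cancelʳ-≤′ (N ^ κ) (^>0 N κ N>0) (begin
        x * N ^ length es * N ^ κ     ≡⟨ lemma₁ x (N ^ length es) (N ^ κ) ⟩
        x * N ^ κ * N ^ length es     ≤⟨ *-monoˡ-≤ (N ^ length es) h ⟩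
        T * H ^ κ * N ^ length es     ≡⟨ trans (*-assoc T _ _) (cong (T *_) (product es)) ⟩
        T * (N ^ κ * ∏ es γ)          ≡⟨ lemma₂ T (N ^ κ) (∏ es γ) ⟩
        T * ∏ es γ * N ^ κ            ∎)
        where
        κ = trues (map p es)
        lemma₁ : ∀ a b c → a * b * c ≡ a * c * b
        lemma₁ = solve-∀
        lemma₂ : ∀ a b c → a * (b * c) ≡ a * c * b
        lemma₂ = solve-∀

      second : ∀ {σ} → length σ ≡ N →
        ∑ (orderings n) (λ τ → 𝟙 (all q (select (map p (take m₀ σ)) τ))) * N ^ m₀ ≤ N ! * ∏ (select (full m₀) σ) γ
      second {σ} len = subst₂ (λ i es → ∑ (orderings n) (λ τ → 𝟙 (all q (select (map p (take m₀ σ)) τ))) * N ^ i ≤ N ! * ∏ es γ)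
        len-take (sym (select-full m₀ σ))
        (product′ (take m₀ σ) (∑ (orderings n) (λ τ → 𝟙 (all q (select (map p (take m₀ σ)) τ)))) (N !) (avoid-count (edgesK n) (map p (take m₀ σ)) mask≤ q))
        where
        m₀≤N : m₀ ≤ N
        m₀≤N = ≤-trans m₀≤m₁ m₁≤N
        len-take : length (take m₀ σ) ≡ m₀
        len-take = trans (List.length-take m₀ σ) (m≤n⇒m⊓n≡m (≤-trans m₀≤N (≤-reflexive (sym len))))
        mask≤ : length (map p (take m₀ σ)) ≤ N
        mask≤ = ≤-trans (≤-reflexive (trans (List.length-map p (take m₀ σ)) len-take)) m₀≤N

      both : f * (N * N) ^ m₀ ≤ N ! * N ! * G ^ m₀
      both = begin
        f * (N * N) ^ m₀             ≡⟨ trans (cong (f *_) ([m*n]^k N N m₀)) (sym (*-assoc f _ _)) ⟩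
        f * N ^ m₀ * N ^ m₀          ≡⟨ cong (_* N ^ m₀) (∑-*ʳ (orderings n) (N ^ m₀) _) ⟨
        ∑ (orderings n) (λ σ → ∑ (orderings n) (λ τ → 𝟙 (all q (select (map p (take m₀ σ)) τ))) * N ^ m₀) * N ^ m₀
          ≤⟨ *-monoˡ-≤ (N ^ m₀) (∑-mono-All (All.map (λ {σ} len → second {σ} len) (perms-length (edgesK n)))) ⟩
        ∑ (orderings n) (λ σ → N ! * ∏ (select (full m₀) σ) γ) * N ^ m₀
          ≡⟨ trans (cong (_* N ^ m₀) (∑-*ˡ (orderings n) (N !) _)) (*-assoc (N !) _ _) ⟩
        N ! * (∑ (orderings n) (λ σ → ∏ (select (full m₀) σ) γ) * N ^ m₀)
          ≤⟨ *-monoʳ-≤ (N !) (subst (λ i → ∑ (orderings n) (λ σ → ∏ (select (full m₀) σ) γ) * N ^ i ≤ N ! * G ^ i) (trues-full m₀)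
               (maclaurin γ (full m₀) (edgesK n) mask₀≤)) ⟩
        N ! * (N ! * G ^ m₀)         ≡⟨ *-assoc (N !) _ _ ⟨
        N ! * N ! * G ^ m₀           ∎

      G+ : G + X * (u * w) ≡ N * N
      G+ = trans (cong (G +_) (sym (∑-*ʳ (edgesK n) (u * w) (𝟙 ∘ p))))
        (trans (sym (∑-+ (edgesK n) γ (λ e → 𝟙 (p e) * (u * w)))) (trans (∑-cong (edgesK n) each) (∑-const (edgesK n) N)))
        where
        each : ∀ e → γ e + 𝟙 (p e) * (u * w) ≡ N
        each e with p e
        ... | true  = trans (cong (H +_) (*-identityˡ (u * w))) (trans (+-comm H _) (cross+uncross (lookup U)))
        ... | false = +-identityʳ N

      module _ (2r≤n : 2 * r ≤ n) (4u≤3n : 4 * u ≤ 3 * n) where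

        n≤2g : n ≤ 2 * g
        n≤2g = +-cancelˡ-≤ (2 * r) _ _ (begin
          2 * r + n        ≤⟨ +-monoˡ-≤ n 2r≤n ⟩
          n + n            ≡⟨ cong (n +_) (sym (+-identityʳ n)) ⟩
          2 * n            ≡⟨ cong (2 *_) (card-not (lookup R)) ⟨
          2 * (r + g)      ≡⟨ *-distribˡ-+ 2 r g ⟩
          2 * r + 2 * g    ∎)

        n≤4w : n ≤ 4 * w
        n≤4w = +-cancelˡ-≤ (4 * u) _ _ (begin
          4 * u + n        ≤⟨ +-monoˡ-≤ n 4u≤3n ⟩
          3 * n + n        ≡⟨ +-comm (3 * n) n ⟩
          4 * n            ≡⟨ cong (4 *_) (card-not (lookup U)) ⟨
          4 * (u + w)      ≡⟨ *-distribˡ-+ 4 u w ⟩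
          4 * u + 4 * w    ∎)

        nl≤8X : n * l ≤ 8 * X
        nl≤8X with m≤n⇒∃[o]m+o≡n n≤2g
        ... | d , e = +-cancelʳ-≤ (4 * g) _ _ (begin
          n * l + 4 * g               ≡⟨ cong (n * l +_) (trans (lemma₁ g) (cong (2 *_) (sym e))) ⟩
          n * l + 2 * (n + d)         ≤⟨ m≤m+n _ (d * (l + d) + n * d) ⟩
          n * l + 2 * (n + d) + (d * (l + d) + n * d) ≡⟨ lemma₂ l d ⟩
          (n + d) * (n + d)           ≡⟨ cong (λ x → x * x) e ⟩
          2 * g * (2 * g)             ≡⟨ lemma₃ g ⟩
          4 * (g * g)                 ≡⟨ cong (4 *_) (inside-count (not ∘ lookup R)) ⟨
          4 * (2 * X + g)             ≡⟨ lemma₄ X g ⟩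
          8 * X + 4 * g               ∎)
          where
          lemma₁ : ∀ g → 4 * g ≡ 2 * (2 * g)
          lemma₁ = solve-∀
          lemma₂ : ∀ l d → suc (suc l) * l + 2 * (suc (suc l) + d) + (d * (l + d) + suc (suc l) * d)
            ≡ (suc (suc l) + d) * (suc (suc l) + d)
          lemma₂ = solve-∀
          lemma₃ : ∀ g → 2 * g * (2 * g) ≡ 4 * (g * g)
          lemma₃ = solve-∀
          lemma₄ : ∀ x g → 4 * (2 * x + g) ≡ 8 * x + 4 * g
          lemma₄ = solve-∀

        -- From `n ≤ 2g` and `n ≤ 4w`, a random pair of edges has the first avoiding `R` and the
        -- second crossing `U` with probability `X u w / N² ≥ u/(16n)`. This is at least `2j/n` when
        -- `32j ≤ u`.
        mean : ∀ j → 32 * j ≤ u → G * n + 2 * j * (N * N) ≤ N * N * n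
        mean j 32j≤u = begin
          G * n + 2 * j * (N * N)    ≤⟨ +-monoʳ-≤ (G * n) gap ⟩
          G * n + X * (u * w) * n    ≡⟨ *-distribʳ-+ n G _ ⟨
          (G + X * (u * w)) * n      ≡⟨ cong (_* n) G+ ⟩
          N * N * n                  ∎
          where
          k²≤2nl : k * k ≤ 2 * (n * l)
          k²≤2nl = square l l>0
            where
            lemma : ∀ x → suc (suc x) * suc (suc x) + (x * x + 4 * x + 2) ≡ 2 * (suc (suc (suc x)) * suc x)
            lemma = solve-∀
            square : ∀ l → 0 < l → suc l * suc l ≤ 2 * (suc (suc l) * l)
            square (suc x) _ = ≤-trans (m≤m+n _ (x * x + 4 * x + 2)) (≤-reflexive (lemma x))
          gap : 2 * j * (N * N) ≤ X * (u * w) * n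
          gap = *-cancelˡ-≤ 32 (begin
            32 * (2 * j * (N * N))         ≡⟨ lemma₁ j N ⟩
            16 * j * (2 * N * (2 * N))     ≡⟨ cong (λ x → 16 * j * (x * x)) 2N≡ ⟩
            16 * j * (n * k * (n * k))     ≡⟨ lemma₂ j n k ⟩
            16 * j * (n * n) * (k * k)     ≤⟨ *-monoʳ-≤ (16 * j * (n * n)) k²≤2nl ⟩
            16 * j * (n * n) * (2 * (n * l)) ≡⟨ lemma₃ j n l ⟩
            32 * j * (n * l * n * n)       ≤⟨ *-mono-≤ 32j≤u (*-monoˡ-≤ n (*-mono-≤ nl≤8X n≤4w)) ⟩
            u * (8 * X * (4 * w) * n)      ≡⟨ lemma₄ u X w n ⟩
            32 * (X * (u * w) * n)         ∎)
            where
            lemma₁ : ∀ j N → 32 * (2 * j * (N * N)) ≡ 16 * j * (2 * N * (2 * N))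
            lemma₁ = solve-∀
            lemma₂ : ∀ j n k → 16 * j * (n * k * (n * k)) ≡ 16 * j * (n * n) * (k * k)
            lemma₂ = solve-∀
            lemma₃ : ∀ j n l → 16 * j * (n * n) * (2 * (n * l)) ≡ 32 * j * (n * l * n * n)
            lemma₃ = solve-∀
            lemma₄ : ∀ u X w n → u * (8 * X * (4 * w) * n) ≡ 32 * (X * (u * w) * n)
            lemma₄ = solve-∀

    pair-bound : ∀ a′ → s ^ (64 * a′) * l ^ m₀ ≤ n ^ m₀ → 2 * r ≤ n → 4 * u ≤ 3 * n → 32 ≤ u →
      f * (s ^ a′) ^ u ≤ N ! * N !
    pair-bound a′ m₀-power 2r≤n 4u≤3n 32≤u = begin
      f * (s ^ a′) ^ u               ≤⟨ *-monoʳ-≤ f (^-monoʳ-≤ (s ^ a′) {{ℕ.>-nonZero (^>0 s a′ (s≤s z≤n))}} u≤64j) ⟩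
      f * (s ^ a′) ^ (64 * j)        ≡⟨ cong (f *_) (trans (^-*-assoc s a′ (64 * j)) (trans (cong (s ^_) (lemma a′ j)) (sym (^-*-assoc s (64 * a′) j)))) ⟩
      f * (s ^ (64 * a′)) ^ j        ≤⟨ use-m₀ f (N ! * N !) (64 * a′) j m₀-power
                                          (ratio-^ f (N ! * N !) (N * N) G (n ^ j) (l ^ j) m₀ (*-mono-≤ N>0 N>0) both
                                            (compare-power G (N * N) j (mean 2r≤n 4u≤3n j (m/n*n≤m′)))) ⟩
      N ! * N !                      ∎
      where
      -- Rounding down loses at most a factor 2 because `u ≥ 32`; so the 32 of `mean` becomes the 64
      -- in `m₀-power`.
      j = u Div./ 32
      lemma : ∀ a j → a * (64 * j) ≡ 64 * a * j
      lemma = solve-∀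
      m/n*n≤m′ : 32 * j ≤ u
      m/n*n≤m′ = ≤-trans (≤-reflexive (*-comm 32 j)) (Div.m/n*n≤m u 32)
      1≤j : 1 ≤ j
      1≤j = Div.m≥n⇒m/n>0 32≤u
      u≤64j : u ≤ 64 * j
      u≤64j = begin
        u                  ≤⟨ <⇒≤ (m<[1+m/n]*n u 32) ⟩
        suc j * 32         ≤⟨ *-monoˡ-≤ 32 (+-monoˡ-≤ j 1≤j) ⟩
        (j + j) * 32       ≡⟨ lemma′ j ⟩
        64 * j             ∎
        where
        lemma′ : ∀ j → (j + j) * 32 ≡ 64 * j
        lemma′ = solve-∀

  -- The union bound over `R` and `U` costs `Y^(|R| + |U|) ≤ Y^(3|U|)` and two factors
  -- `(1 + 1/Y)^n ≤ 4^v`. As `|U| > n/Y` gives `v ≤ |U|`, the total is at most `(16 Y³)^|U|`, and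
  -- the probability `s^(-a′|U|)` outweighs it.
  separated-rare : ∀ a′ → s ^ (64 * a′) * l ^ m₀ ≤ n ^ m₀ → 0 < Y → 32 * Y ≤ n → 16 * s * Y ^ 3 ≤ s ^ a′ →
    s * pairs separated ≤ N ! * N !
  separated-rare a′ m₀-power Y>0 32Y≤n power = *-cancelʳ-≤′ (16 ^ v) (^>0 16 v (s≤s z≤n))
    (*-cancelʳ-≤′ (Y ^ n * Y ^ n) (*-mono-≤ (^>0 Y n Y>0) (^>0 Y n Y>0)) (begin
      s * pairs separated * 16 ^ v * (Y ^ n * Y ^ n)
        ≤⟨ *-monoˡ-≤ (Y ^ n * Y ^ n) (*-monoˡ-≤ (16 ^ v) (*-monoʳ-≤ s union)) ⟩
      s * ∑ (allVec n) F * 16 ^ v * (Y ^ n * Y ^ n)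
        ≡⟨ cong (_* (Y ^ n * Y ^ n)) (trans (lemma₁ s (∑ (allVec n) F) (16 ^ v)) (sym (∑-*ˡ (allVec n) C F))) ⟩
      ∑ (allVec n) (λ R → C * F R) * (Y ^ n * Y ^ n)
        ≡⟨ trans (sym (*-assoc (∑ (allVec n) (λ R → C * F R)) (Y ^ n) (Y ^ n))) (cong (_* Y ^ n) (sym (∑-*ʳ (allVec n) (Y ^ n) (λ R → C * F R)))) ⟩
      ∑ (allVec n) (λ R → C * F R * Y ^ n) * Y ^ n
        ≤⟨ subset-sum n Y (N ! * N ! * (1 + Y) ^ n) (λ R → C * F R * Y ^ n) inner ⟩
      N ! * N ! * (1 + Y) ^ n * (1 + Y) ^ n
        ≤⟨ *-mono-≤ (*-monoʳ-≤ (N ! * N !) grow) grow ⟩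
      N ! * N ! * (4 ^ v * Y ^ n) * (4 ^ v * Y ^ n)
        ≡⟨ lemma₂ (N ! * N !) (4 ^ v) (Y ^ n) ⟩
      N ! * N ! * (4 ^ v * 4 ^ v) * (Y ^ n * Y ^ n)
        ≡⟨ cong (λ x → N ! * N ! * x * (Y ^ n * Y ^ n)) ([m*n]^k 4 4 v) ⟨
      N ! * N ! * 16 ^ v * (Y ^ n * Y ^ n) ∎))
    where
    instance
      Y≢0 : NonZero Y
      Y≢0 = ℕ.>-nonZero Y>0
    v : ℕ
    v = suc (n Div./ Y)
    C : ℕ
    C = s * 16 ^ v
    lemma₁ : ∀ s f x → s * f * x ≡ s * x * f
    lemma₁ = solve-∀
    lemma₂ : ∀ t x y → t * (x * y) * (x * y) ≡ t * (x * x) * (y * y)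
    lemma₂ = solve-∀
    f : Vec Bool n → Vec Bool n → ℕ
    f R U = pairs (λ σ τ → separatedBy σ τ R U)
    F : Vec Bool n → ℕ
    F R = ∑ (allVec n) (f R)
    union : pairs separated ≤ ∑ (allVec n) F
    union = begin
      pairs separated
        ≤⟨ ∑-mono (orderings n) (λ σ → ∑-any (orderings n) (allVec n) (λ τ R → any (separatedBy σ τ R) (allVec n))) ⟩
      ∑ (orderings n) (λ σ → ∑ (allVec n) (λ R → ∑ (orderings n) (λ τ → 𝟙 (any (separatedBy σ τ R) (allVec n)))))
        ≤⟨ ∑-mono (orderings n) (λ σ → ∑-mono (allVec n) (λ R → ∑-any (orderings n) (allVec n) (λ τ U → separatedBy σ τ R U))) ⟩
      ∑ (orderings n) (λ σ → ∑ (allVec n) (λ R → ∑ (allVec n) (λ U → ∑ (orderings n) (λ τ → 𝟙 (separatedBy σ τ R U)))))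
        ≡⟨ ∑-swap (orderings n) (allVec n) _ ⟩
      ∑ (allVec n) (λ R → ∑ (orderings n) (λ σ → ∑ (allVec n) (λ U → ∑ (orderings n) (λ τ → 𝟙 (separatedBy σ τ R U)))))
        ≡⟨ ∑-cong (allVec n) (λ R → ∑-swap (orderings n) (allVec n) _) ⟩
      ∑ (allVec n) F ∎
    grow : (1 + Y) ^ n ≤ 4 ^ v * Y ^ n
    grow = exp-bound-suc Y n v (<⇒≤ (m<[1+m/n]*n n Y))
    each : ∀ R U → C * f R U * Y ^ size R * Y ^ size U ≤ N ! * N !
    each R U with admissible R U in adm
    ... | false = ≤-trans (≤-reflexive (cong (λ x → C * x * Y ^ size R * Y ^ size U)
        (trans (∑-cong (orderings n) (λ σ → ∑-zero (orderings n))) (∑-zero (orderings n)))))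
        (≤-trans (≤-reflexive (cong (λ x → x * Y ^ size R * Y ^ size U) (*-zeroʳ C))) z≤n)
    ... | true with ∧-true {(size R ≤ᵇ 2 * size U) ∧ (2 * size R ≤ᵇ n)} adm
    ...   | p , q with ∧-true {size R ≤ᵇ 2 * size U} p | ∧-true {4 * size U ≤ᵇ 3 * n} q
    ...     | p₁ , p₂ | q₁ , q₂ = begin
      C * φ * Y ^ r * Y ^ u                 ≡⟨ lemma₃ s (16 ^ v) φ (Y ^ r) (Y ^ u) ⟩
      φ * (s * 16 ^ v * (Y ^ r * Y ^ u))    ≤⟨ *-monoʳ-≤ φ (*-mono-≤
                                                (*-mono-≤ (≤-trans (≤-reflexive (sym (*-identityʳ s))) (^-monoʳ-≤ s 1≤u))
                                                          (^-monoʳ-≤ 16 v≤u))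
                                                (*-monoˡ-≤ (Y ^ u) (^-monoʳ-≤ Y r≤2u))) ⟩
      φ * (s ^ u * 16 ^ u * (Y ^ (2 * u) * Y ^ u))
        ≡⟨ cong (λ x → φ * (s ^ u * 16 ^ u * x)) (trans (sym (^-distribˡ-+-* Y (2 * u) u)) (trans (cong (Y ^_) (lemma₄ u)) (sym (^-*-assoc Y 3 u)))) ⟩
      φ * (s ^ u * 16 ^ u * (Y ^ 3) ^ u)
        ≡⟨ cong (φ *_) (trans (cong (_* (Y ^ 3) ^ u) (trans (*-comm (s ^ u) _) (sym ([m*n]^k 16 s u)))) (sym ([m*n]^k (16 * s) (Y ^ 3) u))) ⟩
      φ * (16 * s * Y ^ 3) ^ u              ≤⟨ *-monoʳ-≤ φ (^-monoˡ-≤ u power) ⟩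
      φ * (s ^ a′) ^ u                      ≤⟨ pair-bound R U a′ m₀-power (≤ᵇ-true⁻ (2 * r) n p₂) (≤ᵇ-true⁻ (4 * u) (3 * n) q₁) 32≤u ⟩
      N ! * N !                             ∎
      where
      r = size R
      u = size U
      φ = pairs (λ σ τ → all (not ∘ cross (lookup U)) (select (map (inside (not ∘ lookup R)) (take m₀ σ)) τ))
      n<uY : n < u * Y
      n<uY = ≤ᵇ-true⁻ (suc n) (u * Y) q₂
      r≤2u : r ≤ 2 * u
      r≤2u = ≤ᵇ-true⁻ r (2 * u) p₁
      32≤u : 32 ≤ u
      32≤u = *-cancelʳ-≤′ Y Y>0 (≤-trans 32Y≤n (<⇒≤ n<uY))
      1≤u : 1 ≤ u
      1≤u = ≤-trans (s≤s z≤n) 32≤u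
      v≤u : v ≤ u
      v≤u = Div.m<n*o⇒m/o<n n<uY
      lemma₃ : ∀ s x φ p q → s * x * φ * p * q ≡ φ * (s * x * (p * q))
      lemma₃ = solve-∀
      lemma₄ : ∀ u → 2 * u + u ≡ 3 * u
      lemma₄ = solve-∀
    inner : ∀ R → C * F R * Y ^ n * Y ^ size R ≤ N ! * N ! * (1 + Y) ^ n
    inner R = begin
      C * F R * Y ^ n * Y ^ size R
        ≡⟨ lemma₃ C (F R) (Y ^ n) (Y ^ size R) ⟩
      C * Y ^ size R * F R * Y ^ n
        ≡⟨ cong (_* Y ^ n) (∑-*ˡ (allVec n) (C * Y ^ size R) (f R)) ⟨
      ∑ (allVec n) (λ U → C * Y ^ size R * f R U) * Y ^ n
        ≤⟨ subset-sum n Y (N ! * N !) _ (λ U → ≤-trans (≤-reflexive (cong (_* Y ^ size U) (lemma₁ C (Y ^ size R) (f R U)))) (each R U)) ⟩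
      N ! * N ! * (1 + Y) ^ n ∎
      where
      lemma₃ : ∀ c f p q → c * f * p * q ≡ c * q * f * p
      lemma₃ = solve-∀

-- Falling factorials and the second moment of the number of isolated vertices

fallingFact : ℕ → ℕ → ℕ
fallingFact x       zero    = 1
fallingFact zero    (suc m) = 0
fallingFact (suc x) (suc m) = suc x * fallingFact x m

fallingFact-! : ∀ x m → m ≤ x → fallingFact x m * (x ∸ m) ! ≡ x !
fallingFact-! x       zero    _       = +-identityʳ _
fallingFact-! (suc x) (suc m) (s≤s h) = trans (*-assoc (suc x) (fallingFact x m) ((x ∸ m) !)) (cong (suc x *_) (fallingFact-! x m h))

fallingFact>0 : ∀ x m → m ≤ x → 0 < fallingFact x m
fallingFact>0 x       zero    _       = s≤s z≤n
fallingFact>0 (suc x) (suc m) (s≤s h) = *-mono-≤ (s≤s (z≤n {x})) (fallingFact>0 x m h)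

falling∑-𝟙 : ∀ {A : Set} (h : A → Bool) m xs → falling∑ (𝟙 ∘ h) m xs ≡ fallingFact (∑ xs (𝟙 ∘ h)) m
falling∑-𝟙 h zero    xs = refl
falling∑-𝟙 h (suc m) xs = trans
  (∑-cong-All (All.map (λ {p} e → step (proj₁ p) (proj₂ p) e) (picks-∑ xs (𝟙 ∘ h))))
  (trans (∑-*ʳ (picks xs) (fallingFact (S ∸ 1) m) (𝟙 ∘ h ∘ proj₁))
    (trans (cong (_* fallingFact (S ∸ 1) m) (∑-picks-proj₁ xs (𝟙 ∘ h))) (unfold S)))
  where
  S = ∑ xs (𝟙 ∘ h)
  unfold : ∀ S → S * fallingFact (S ∸ 1) m ≡ fallingFact S (suc m)
  unfold zero    = refl
  unfold (suc S) = refl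
  step : ∀ y ys → S ≡ 𝟙 (h y) + ∑ ys (𝟙 ∘ h) →
    𝟙 (h y) * falling∑ (𝟙 ∘ h) m ys ≡ 𝟙 (h y) * fallingFact (S ∸ 1) m
  step y ys e with h y
  ... | false = refl
  ... | true  = cong (1 *_) (trans (falling∑-𝟙 h m ys) (cong (λ S → fallingFact (S ∸ 1) m) (sym e)))

-- Maclaurin's inequality bounds from above only, while the second moment method also needs the
-- probability of isolation from below. So the count is exact here.
all-count : ∀ {A : Set} (h : A → Bool) m (xs : List A) → m ≤ length xs →
  ∑ (perms xs) (λ σ → 𝟙 (all h (select (full m) σ))) ≡ fallingFact (∑ xs (𝟙 ∘ h)) m * (length xs ∸ m) !
all-count h m xs m≤ = trans (∑-cong (perms xs) (λ σ → sym (∏-𝟙 h (select (full m) σ))))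
  (trans (∑-perms-select (𝟙 ∘ h) (full m) xs (≤-trans (≤-reflexive (length-full m)) m≤))
    (trans (cong (λ j → falling∑ (𝟙 ∘ h) j xs * (length xs ∸ j) !) (trues-full m))
      (cong (_* (length xs ∸ m) !) (falling∑-𝟙 h m xs))))

-- With x = C(n-1,2) this compares Pr[u and v isolated] with Pr[v isolated]²: each factor of
-- the quotient is at most (x+1)/x, and the product telescopes.
fallingFact-square : ∀ l x m → fallingFact (x + suc l) m * fallingFact (x ∸ l) m * (suc x ∸ m)
  ≤ fallingFact x m * fallingFact x m * suc x
fallingFact-square l x zero = ≤-refl
fallingFact-square l zero (suc m) = ≤-trans (≤-reflexive (trans
  (cong (fallingFact (suc l) (suc m) * fallingFact (0 ∸ l) (suc m) *_) (0∸n≡0 m)) (*-zeroʳ (fallingFact (suc l) (suc m) * fallingFact (0 ∸ l) (suc m))))) z≤n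
fallingFact-square l (suc x) (suc m) with l ≤? x
... | no l≰x = ≤-trans (≤-reflexive (cong (λ y → fallingFact (suc x + suc l) (suc m) * fallingFact y (suc m) * (suc (suc x) ∸ suc m))
      (m≤n⇒m∸n≡0 (≰⇒> l≰x)))) (≤-trans (≤-reflexive (cong (_* (suc x ∸ m)) (*-zeroʳ (fallingFact (suc x + suc l) (suc m))))) z≤n)
... | yes l≤x = begin
  (suc x + suc l) * P * fallingFact (suc x ∸ l) (suc m) * (suc x ∸ m)
    ≡⟨ cong (λ y → (suc x + suc l) * P * fallingFact y (suc m) * (suc x ∸ m)) (+-∸-assoc 1 l≤x) ⟩
  (suc x + suc l) * P * (suc y * Q) * (suc x ∸ m)
    ≡⟨ lemma₁ (suc x + suc l) P (suc y) Q (suc x ∸ m) ⟩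
  (suc x + suc l) * suc y * (P * Q * (suc x ∸ m))
    ≤⟨ *-mono-≤ factor (fallingFact-square l x m) ⟩
  suc x * suc (suc x) * (F * F * suc x)
    ≡⟨ lemma₂ (suc x) (suc (suc x)) F ⟩
  suc x * F * (suc x * F) * suc (suc x) ∎
  where
  open ≤-Reasoning
  y P Q F : ℕ
  y = x ∸ l
  P = fallingFact (x + suc l) m
  Q = fallingFact y m
  F = fallingFact x m
  lemma₁ : ∀ a p b q r → a * p * (b * q) * r ≡ a * b * (p * q * r)
  lemma₁ = solve-∀
  lemma₂ : ∀ a b f → a * b * (f * f * a) ≡ a * f * (a * f) * b
  lemma₂ = solve-∀
  lemma₃ : ∀ y l → (suc (y + l) + suc l) * suc y + (l * l + l) ≡ suc (y + l) * suc (suc (y + l))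
  lemma₃ = solve-∀
  factor : (suc x + suc l) * suc y ≤ suc x * suc (suc x)
  factor = subst (λ x → (suc x + suc l) * suc y ≤ suc x * suc (suc x)) (m∸n+n≡m l≤x)
    (≤-trans (m≤m+n _ (l * l + l)) (≤-reflexive (lemma₃ y l)))

-- For the probability that a vertex is isolated, the factors are `y/x`, with `y` and `x` descending
-- from C(n-1,2) and C(n,2) in step. After `i` of them `n y = l x - 2i`, and as long as
-- `2i (Z + 1) ≤ l x` the next factor is at least `(l/n) · Z/(Z+1)`.
fallingFact-ratio : ∀ l Z m i x y → suc (suc l) * y + 2 * i ≡ l * x → 2 * (i + m) * suc Z ≤ l * (x ∸ m) →
  fallingFact x m * (l * Z) ^ m ≤ fallingFact y m * (suc (suc l) * suc Z) ^ m
fallingFact-ratio l Z zero    i x       y       e B = ≤-refl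
fallingFact-ratio l Z (suc m) i zero    y       e B = z≤n
fallingFact-ratio l Z (suc m) i (suc x) zero    e B = contradiction (begin-strict
    l * suc x                       ≡⟨ trans (sym e) (cong (_+ 2 * i) (*-zeroʳ l)) ⟩
    2 * i                           <⟨ *-monoʳ-< 2 (m<m+n i (s≤s z≤n)) ⟩
    2 * (i + suc m)                 ≤⟨ m≤m*n (2 * (i + suc m)) (suc Z) ⟩
    2 * (i + suc m) * suc Z         ≤⟨ B ⟩
    l * (x ∸ m)                     ≤⟨ *-monoʳ-≤ l (≤-trans (m∸n≤m x m) (n≤1+n x)) ⟩
    l * suc x                       ∎) (<-irrefl refl)
  where open ≤-Reasoning
fallingFact-ratio l Z (suc m) i (suc x) (suc y) e B = begin
  suc x * fallingFact x m * (l * Z * (l * Z) ^ m)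
    ≡⟨ lemma₁ (suc x) (fallingFact x m) (l * Z) ((l * Z) ^ m) ⟩
  suc x * (l * Z) * (fallingFact x m * (l * Z) ^ m)
    ≤⟨ *-mono-≤ factor (fallingFact-ratio l Z m (suc i) x y e′ (≤-trans (≤-reflexive (cong (λ j → 2 * j * suc Z) (sym (+-suc i m)))) B)) ⟩
  suc y * (n * suc Z) * (fallingFact y m * (n * suc Z) ^ m)
    ≡⟨ lemma₁ (suc y) (fallingFact y m) (n * suc Z) ((n * suc Z) ^ m) ⟨
  suc y * fallingFact y m * (n * suc Z * (n * suc Z) ^ m) ∎
  where
  open ≤-Reasoning
  n = suc (suc l)
  lemma₁ : ∀ a f b p → a * f * (b * p) ≡ a * b * (f * p)
  lemma₁ = solve-∀
  e′ : n * y + 2 * suc i ≡ l * x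
  e′ = +-cancelʳ-≡ l _ _ (trans (lemma₂ l y i) (trans e (lemma₃ l x)))
    where
    lemma₂ : ∀ l y i → suc (suc l) * y + 2 * suc i + l ≡ suc (suc l) * suc y + 2 * i
    lemma₂ = solve-∀
    lemma₃ : ∀ l x → l * suc x ≡ l * x + l
    lemma₃ = solve-∀
  2iZ≤ : 2 * i * suc Z ≤ l * suc x
  2iZ≤ = ≤-trans (*-monoˡ-≤ (suc Z) (*-monoʳ-≤ 2 (m≤m+n i (suc m)))) (≤-trans B (*-monoʳ-≤ l (≤-trans (m∸n≤m x m) (n≤1+n x))))
  factor : suc x * (l * Z) ≤ suc y * (n * suc Z)
  factor = +-cancelʳ-≤ (2 * i) _ _ (begin
    suc x * (l * Z) + 2 * i           ≡⟨ cong (_+ 2 * i) (lemma₂ (suc x) l Z) ⟩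
    l * suc x * Z + 2 * i             ≡⟨ cong (λ c → c * Z + 2 * i) e ⟨
    (n * suc y + 2 * i) * Z + 2 * i   ≡⟨ lemma₃ (n * suc y) i Z ⟩
    n * suc y * Z + 2 * i * suc Z     ≤⟨ +-monoʳ-≤ (n * suc y * Z) 2iZ≤ ⟩
    n * suc y * Z + l * suc x         ≡⟨ cong (n * suc y * Z +_) e ⟨
    n * suc y * Z + (n * suc y + 2 * i) ≡⟨ lemma₄ n (suc y) Z (2 * i) ⟩
    suc y * (n * suc Z) + 2 * i       ∎)
    where
    lemma₂ : ∀ x l Z → x * (l * Z) ≡ l * x * Z
    lemma₂ = solve-∀
    lemma₃ : ∀ a i Z → (a + 2 * i) * Z + 2 * i ≡ a * Z + 2 * i * suc Z
    lemma₃ = solve-∀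
    lemma₄ : ∀ n y Z c → n * y * Z + (n * y + c) ≡ y * (n * suc Z) + c
    lemma₄ = solve-∀

-- With `b` true wherever `f` is nonzero, this is `Pr[X > 0] ≥ (E X)² / E X²` cleared of
-- denominators.
cauchy-schwarz : ∀ {A : Set} (xs : List A) (b : A → Bool) (f : A → ℕ) → (∀ x → b x ≡ false → f x ≡ 0) →
  ∑ xs f * ∑ xs f ≤ ∑ xs (𝟙 ∘ b) * ∑ xs (λ x → f x * f x)
cauchy-schwarz xs b f support = *-cancelˡ-≤ 2 (begin
  2 * (∑ xs f * ∑ xs f)
    ≡⟨ trans (cong (2 *_) (sym (∑-product xs xs f f))) (sym (trans (∑-cong xs (λ x → ∑-*ˡ xs 2 _)) (∑-*ˡ xs 2 _))) ⟩
  ∑ xs (λ x → ∑ xs (λ y → 2 * (f x * f y)))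
    ≤⟨ ∑-mono xs (λ x → ∑-mono xs (λ y → point x y)) ⟩
  ∑ xs (λ x → ∑ xs (λ y → sq x * 𝟙 (b y) + 𝟙 (b x) * sq y))
    ≡⟨ trans (∑-cong xs (λ x → ∑-+ xs _ _)) (∑-+ xs _ _) ⟩
  ∑ xs (λ x → ∑ xs (λ y → sq x * 𝟙 (b y))) + ∑ xs (λ x → ∑ xs (λ y → 𝟙 (b x) * sq y))
    ≡⟨ cong₂ _+_ (∑-product xs xs sq (𝟙 ∘ b)) (∑-product xs xs (𝟙 ∘ b) sq) ⟩
  ∑ xs sq * ∑ xs (𝟙 ∘ b) + ∑ xs (𝟙 ∘ b) * ∑ xs sq
    ≡⟨ lemma (∑ xs sq) (∑ xs (𝟙 ∘ b)) ⟩
  2 * (∑ xs (𝟙 ∘ b) * ∑ xs sq) ∎)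
  where
  open ≤-Reasoning
  sq = λ x → f x * f x
  lemma : ∀ p q → p * q + q * p ≡ 2 * (q * p)
  lemma = solve-∀
  lemma₁ : ∀ p q → 2 * (p * q) ≡ p * q + p * q
  lemma₁ = solve-∀
  point : ∀ x y → 2 * (f x * f y) ≤ sq x * 𝟙 (b y) + 𝟙 (b x) * sq y
  point x y with b x in bx | b y in by
  ... | false | _     rewrite support x bx = z≤n
  ... | true  | false rewrite support y by = ≤-trans (≤-reflexive (cong (2 *_) (*-zeroʳ (f x)))) z≤n
  ... | true  | true  = ≤-trans (≤-reflexive (lemma₁ (f x) (f y))) (≤-trans (2ab≤a²+b² (f x) (f y))
      (≤-reflexive (cong₂ _+_ (sym (*-identityʳ (sq x))) (sym (*-identityˡ (sq y))))))

module Isolated (l m₀ m₁ K Y b Δ z : ℕ) (m₁≡ : m₁ ≡ suc (suc l) * suc z) (m₁≤N : m₁ ≤ length (edgesK (suc (suc l))))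
  (m₀≤m₁ : m₀ ≤ m₁) (l>0 : 0 < l) where

  open Separate l m₀ m₁ K Y b Δ z m₁≡ m₁≤N m₀≤m₁ l>0 public
  open Events k m₀ m₁ K Y b Δ
  open ≤-Reasoning

  private
    m : ℕ
    m = m₀

    alone : Fin n → Edge n → Bool
    alone v = inside (not ∘ (v ==_))

    -- The numbers of edges avoiding one and two given vertices. That `N` is `G₁ + suc l` and `G₂`
    -- is `G₁ ∸ l` explains the form of `fallingFact-square`.
    G₁ G₂ : ℕ
    G₁ = ∑ (edgesK n) (𝟙 ∘ alone Fin.zero)
    G₂ = G₁ ∸ l

    card-others : ∀ (v : Fin n) → card (not ∘ (v ==_)) ≡ k
    card-others v = suc-injective (trans (cong (_+ card (not ∘ (v ==_))) (sym (card-single v))) (card-not (v ==_)))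

    2G₁ : ∀ v → 2 * ∑ (edgesK n) (𝟙 ∘ alone v) + k ≡ k * k
    2G₁ v = subst (λ c → 2 * ∑ (edgesK n) (𝟙 ∘ alone v) + c ≡ c * c) (card-others v) (inside-count (not ∘ (v ==_)))

    G₁≡ : ∀ v → ∑ (edgesK n) (𝟙 ∘ alone v) ≡ G₁
    G₁≡ v = *-cancelˡ-≡ _ _ 2 (+-cancelʳ-≡ k _ _ (trans (2G₁ v) (sym (2G₁ Fin.zero))))

    2G₁≡ : 2 * G₁ ≡ l * k
    2G₁≡ = +-cancelʳ-≡ k _ _ (trans (2G₁ Fin.zero) (lemma l))
      where
      lemma : ∀ l → suc l * suc l ≡ l * suc l + suc l
      lemma = solve-∀

    N≡ : N ≡ G₁ + k
    N≡ = *-cancelˡ-≡ _ _ 2 (trans 2N≡ (trans (lemma l) (trans (cong (_+ 2 * k) (sym 2G₁≡)) (sym (*-distribˡ-+ 2 G₁ k)))))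
      where
      lemma : ∀ l → suc (suc l) * suc l ≡ l * suc l + 2 * suc l
      lemma = solve-∀

    not-pair : ∀ (v w : Fin n) → ¬ v ≡ w → card (not ∘ pair v w) ≡ l
    not-pair v w v≢w = +-cancelˡ-≡ 2 _ _ (trans (cong (_+ card (not ∘ pair v w)) (sym two)) (card-not (pair v w)))
      where
      two : card (pair v w) ≡ 2
      two = ≤-antisym (card-pair≤2 v w) (≤-trans (≤-reflexive (cong suc (sym (card-single v))))
        (card-insert {χ = v ==_} {pair v w} {w} (==-false v≢w) (∨-introʳ (v == w) (==-true refl)) (λ j h → ∨-introˡ _ h)))

    G₂≡ : ∀ v w → ¬ v ≡ w → ∑ (edgesK n) (𝟙 ∘ inside (not ∘ pair v w)) ≡ G₂
    G₂≡ v w v≢w = trans (sym (m+n∸n≡m x l)) (cong (_∸ l) (*-cancelˡ-≡ _ _ 2 (begin-equality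
      2 * (x + l)       ≡⟨ lemma₁ x l ⟩
      2 * x + l + l     ≡⟨ cong (_+ l) (subst (λ c → 2 * x + c ≡ c * c) (not-pair v w v≢w) (inside-count (not ∘ pair v w))) ⟩
      l * l + l         ≡⟨ lemma₂ l ⟩
      l * k             ≡⟨ 2G₁≡ ⟨
      2 * G₁            ∎)))
      where
      x = ∑ (edgesK n) (𝟙 ∘ inside (not ∘ pair v w))
      lemma₁ : ∀ x l → 2 * (x + l) ≡ 2 * x + l + l
      lemma₁ = solve-∀
      lemma₂ : ∀ l → l * l + l ≡ l * suc l
      lemma₂ = solve-∀

    m≤N : m ≤ N
    m≤N = ≤-trans m₀≤m₁ m₁≤N

    A A₂ F h : ℕ
    A  = fallingFact G₁ m
    A₂ = fallingFact G₂ m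
    F  = fallingFact N m
    h  = (N ∸ m) !

    T≡ : F * h ≡ N !
    T≡ = fallingFact-! N m m≤N

    X : Ordering → ℕ
    X σ = ∑ (allFin n) (λ v → 𝟙 (isolatedIn σ v))

    one : ∀ v → ∑ (orderings n) (λ σ → 𝟙 (isolatedIn σ v)) ≡ A * h
    one v = trans (all-count (alone v) m (edgesK n) m≤N) (cong (λ g → fallingFact g m * h) (G₁≡ v))

    two : ∀ v w → ¬ v ≡ w → ∑ (orderings n) (λ σ → 𝟙 (isolatedIn σ v) * 𝟙 (isolatedIn σ w)) ≡ A₂ * h
    two v w v≢w = trans (∑-cong (orderings n) (λ σ → merge (select (full m) σ)))
      (trans (all-count (inside (not ∘ pair v w)) m (edgesK n) m≤N) (cong (λ g → fallingFact g m * h) (G₂≡ v w v≢w)))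
      where
      bools : ∀ p q r t → 𝟙 ((not p ∧ not q)) * 𝟙 (not r ∧ not t) ≡ 𝟙 (not (p ∨ r) ∧ not (q ∨ t))
      bools true  q     r     t     = refl
      bools false true  true  t     = refl
      bools false true  false t     = refl
      bools false false true  t     = refl
      bools false false false true  = refl
      bools false false false false = refl
      swap4 : ∀ a b c d → a * b * (c * d) ≡ a * c * (b * d)
      swap4 = solve-∀
      merge : ∀ es → 𝟙 (all (alone v) es) * 𝟙 (all (alone w) es) ≡ 𝟙 (all (inside (not ∘ pair v w)) es)
      merge []             = refl
      merge ((i , j) ∷ es) = trans (cong₂ _*_ (𝟙-∧ (alone v (i , j)) _) (𝟙-∧ (alone w (i , j)) _))
        (trans (swap4 (𝟙 (alone v (i , j))) _ _ _) (trans (cong₂ _*_ (bools (v == i) (v == j) (w == i) (w == j)) (merge es))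
          (sym (𝟙-∧ (inside (not ∘ pair v w) (i , j)) _))))

    first-moment : ∑ (orderings n) X ≡ n * (A * h)
    first-moment = trans (∑-swap (orderings n) (allFin n) _) (trans (∑-cong (allFin n) one)
      (trans (∑-const (allFin n) (A * h)) (cong (_* (A * h)) (length-allFin n))))

    second-moment : ∑ (orderings n) (λ σ → X σ * X σ) ≤ n * (A * h) + n * (n * (A₂ * h))
    second-moment = begin
      ∑ (orderings n) (λ σ → X σ * X σ)
        ≡⟨ ∑-cong (orderings n) (λ σ → sym (∑-product (allFin n) (allFin n) (𝟙 ∘ isolatedIn σ) (𝟙 ∘ isolatedIn σ))) ⟩
      ∑ (orderings n) (λ σ → ∑ (allFin n) (λ v → ∑ (allFin n) (λ w → 𝟙 (isolatedIn σ v) * 𝟙 (isolatedIn σ w))))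
        ≡⟨ trans (∑-swap (orderings n) (allFin n) (λ σ v → ∑ (allFin n) (λ w → 𝟙 (isolatedIn σ v) * 𝟙 (isolatedIn σ w))))
             (∑-cong (allFin n) (λ v → ∑-swap (orderings n) (allFin n) (λ σ w → 𝟙 (isolatedIn σ v) * 𝟙 (isolatedIn σ w)))) ⟩
      ∑ (allFin n) (λ v → ∑ (allFin n) (λ w → ∑ (orderings n) (λ σ → 𝟙 (isolatedIn σ v) * 𝟙 (isolatedIn σ w))))
        ≤⟨ ∑-mono (allFin n) (λ v → ∑-mono (allFin n) (λ w → each v w)) ⟩
      ∑ (allFin n) (λ v → ∑ (allFin n) (λ w → 𝟙 (v == w) * (A * h) + A₂ * h))
        ≡⟨ ∑-cong (allFin n) (λ v → trans (∑-+ (allFin n) (λ w → 𝟙 (v == w) * (A * h)) (λ _ → A₂ * h)) (cong₂ _+_ (∑-single v (λ _ → A * h))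
             (trans (∑-const (allFin n) (A₂ * h)) (cong (_* (A₂ * h)) (length-allFin n))))) ⟩
      ∑ (allFin n) (λ v → A * h + n * (A₂ * h))
        ≡⟨ trans (∑-const (allFin n) (A * h + n * (A₂ * h))) (cong (_* (A * h + n * (A₂ * h))) (length-allFin n)) ⟩
      n * (A * h + n * (A₂ * h))
        ≡⟨ *-distribˡ-+ n (A * h) _ ⟩
      n * (A * h) + n * (n * (A₂ * h)) ∎
      where
      each : ∀ v w → ∑ (orderings n) (λ σ → 𝟙 (isolatedIn σ v) * 𝟙 (isolatedIn σ w)) ≤ 𝟙 (v == w) * (A * h) + A₂ * h
      each v w with v ≟F w
      ... | no v≢w = ≤-reflexive (two v w v≢w)
      ... | yes refl = ≤-trans (∑-mono (orderings n) (λ σ → idem (isolatedIn σ v)))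
          (≤-trans (≤-reflexive (trans (one v) (sym (*-identityˡ (A * h))))) (m≤m+n _ (A₂ * h)))
        where
        idem : ∀ c → 𝟙 c * 𝟙 c ≤ 𝟙 c
        idem true  = ≤-refl
        idem false = z≤n

  -- The mean number of isolated vertices is at least `2s` by `single`, and a pair of vertices is
  -- isolated with at most `1 + 1/(2s)` times the squared probability by `double`. Each contributes
  -- `1/(2s)` to `E X² ≤ (1 + 1/s) (E X)²`.
  noIsolated-rare : ∀ a → n ^ m₀ ≤ 2 * s ^ a * l ^ m₀ → 8 * s * s ^ a ≤ n → suc (2 * s) * m₀ ≤ suc G₁ →
    2 * m₀ * suc (suc (2 * m₀)) ≤ l * (N ∸ m₀) → m₀ ≤ G₁ →
    s * ∑ (orderings n) (𝟙 ∘ noIsolated) ≤ N !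
  noIsolated-rare a m₀-power 8≤n G₁-large ratio-ok m≤G₁ = *-cancelʳ-≤′ S₂ S₂>0 (≤-trans
    (+-cancelʳ-≤ (s * (S₁ * S₁)) _ _ (begin
      s * c₀ * S₂ + s * (S₁ * S₁)        ≤⟨ +-monoʳ-≤ (s * c₀ * S₂) (*-monoʳ-≤ s cs) ⟩
      s * c₀ * S₂ + s * (c₁ * S₂)        ≡⟨ lemma₁ s c₀ c₁ S₂ ⟩
      s * ((c₁ + c₀) * S₂)               ≡⟨ cong (λ t → s * (t * S₂)) total ⟩
      s * (N ! * S₂)                     ≤⟨ variance ⟩
      suc s * (S₁ * S₁)                  ∎))
    (≤-trans cs (*-monoˡ-≤ S₂ (≤-trans (m≤m+n c₁ c₀) (≤-reflexive total)))))
    where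
    S₁ S₂ c₀ c₁ Z : ℕ
    S₁ = ∑ (orderings n) X
    S₂ = ∑ (orderings n) (λ σ → X σ * X σ)
    c₀ = ∑ (orderings n) (𝟙 ∘ noIsolated)
    c₁ = ∑ (orderings n) (λ σ → 𝟙 (any (isolatedIn σ) (allFin n)))
    -- Large enough that the `m` factors `(Z+1)/Z` lost in `fallingFact-ratio` multiply to at most
    -- 2, by `^-half`.
    Z = suc (2 * m)
    lemma₁ : ∀ s c₀ c₁ x → s * c₀ * x + s * (c₁ * x) ≡ s * ((c₁ + c₀) * x)
    lemma₁ = solve-∀
    total : c₁ + c₀ ≡ N !
    total = trans (∑-not (λ σ → any (isolatedIn σ) (allFin n)) (orderings n)) (length-perms (edgesK n))
    cs : S₁ * S₁ ≤ c₁ * S₂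
    cs = cauchy-schwarz (orderings n) (λ σ → any (isolatedIn σ) (allFin n)) X
      (λ σ none → trans (∑-cong (allFin n) (λ v → cong 𝟙 (any-false (isolatedIn σ) (allFin n) none (∈-allFin v)))) (∑-zero (allFin n)))
    S₁>0 : 0 < S₁
    S₁>0 = ≤-trans (*-mono-≤ {1} {n} (s≤s z≤n) (*-mono-≤ (fallingFact>0 G₁ m m≤G₁) (!>0 (N ∸ m)))) (≤-reflexive (sym first-moment))
      where
      !>0 : ∀ j → 0 < j !
      !>0 zero    = s≤s z≤n
      !>0 (suc j) = *-mono-≤ (s≤s (z≤n {j})) (!>0 j)
    S₂>0 : 0 < S₂
    S₂>0 = positive S₂ (≤-trans (*-mono-≤ S₁>0 S₁>0) cs)
      where
      positive : ∀ x → 1 ≤ c₁ * x → 0 < x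
      positive zero    q = contradiction (≤-trans q (≤-reflexive (*-zeroʳ c₁))) (λ ())
      positive (suc x) q = s≤s z≤n
    single : 2 * s * F ≤ n * A
    single = *-cancelʳ-≤′ (l ^ m) (^>0 l m l>0) (begin
      2 * s * F * l ^ m                 ≤⟨ *-cancelʳ-≤′ (Z ^ m) (^>0 Z m (s≤s z≤n)) scaled ⟩
      4 * s * (A * n ^ m)               ≤⟨ *-monoʳ-≤ (4 * s) (*-monoʳ-≤ A m₀-power) ⟩
      4 * s * (A * (2 * s ^ a * l ^ m)) ≡⟨ lemma₃ s A (s ^ a) (l ^ m) ⟩
      8 * s * s ^ a * A * l ^ m         ≤⟨ *-monoˡ-≤ (l ^ m) (*-monoˡ-≤ A 8≤n) ⟩
      n * A * l ^ m                     ∎)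
      where
      lemma₃ : ∀ s A p q → 4 * s * (A * (2 * p * q)) ≡ 8 * s * p * A * q
      lemma₃ = solve-∀
      lemma₄ : ∀ s F p q → 2 * s * F * p * q ≡ 2 * s * (F * (p * q))
      lemma₄ = solve-∀
      lemma₅ : ∀ s A p q → 2 * s * (A * (p * (2 * q))) ≡ 4 * s * (A * p) * q
      lemma₅ = solve-∀
      lemma₆ : ∀ G n → 2 * (n * G) ≡ n * (2 * G)
      lemma₆ = solve-∀
      lemma₇ : ∀ l → suc (suc l) * (l * suc l) ≡ l * (suc (suc l) * suc l)
      lemma₇ = solve-∀
      lemma₈ : ∀ l N → l * (2 * N) ≡ 2 * (l * N)
      lemma₈ = solve-∀
      nG≡lN : n * G₁ ≡ l * N
      nG≡lN = *-cancelˡ-≡ _ _ 2 (trans (lemma₆ G₁ n) (trans (cong (n *_) 2G₁≡)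
        (trans (lemma₇ l) (trans (cong (l *_) (sym 2N≡)) (lemma₈ l N)))))
      halve : suc Z ^ m ≤ 2 * Z ^ m
      halve = ^-half Z m (≤-trans (≤-reflexive (cong (m +_) (sym (+-identityʳ m)))) (≤-trans (n≤1+n _) (n≤1+n _)))
      scaled : 2 * s * F * l ^ m * Z ^ m ≤ 4 * s * (A * n ^ m) * Z ^ m
      scaled = begin
        2 * s * F * l ^ m * Z ^ m             ≡⟨ lemma₄ s F (l ^ m) (Z ^ m) ⟩
        2 * s * (F * (l ^ m * Z ^ m))         ≡⟨ cong (λ x → 2 * s * (F * x)) ([m*n]^k l Z m) ⟨
        2 * s * (F * (l * Z) ^ m)             ≤⟨ *-monoʳ-≤ (2 * s) (fallingFact-ratio l Z m 0 N G₁ (trans (+-identityʳ _) nG≡lN) ratio-ok) ⟩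
        2 * s * (A * (n * suc Z) ^ m)         ≡⟨ cong (λ x → 2 * s * (A * x)) ([m*n]^k n (suc Z) m) ⟩
        2 * s * (A * (n ^ m * suc Z ^ m))     ≤⟨ *-monoʳ-≤ (2 * s) (*-monoʳ-≤ A (*-monoʳ-≤ (n ^ m) halve)) ⟩
        2 * s * (A * (n ^ m * (2 * Z ^ m)))   ≡⟨ lemma₅ s A (n ^ m) (Z ^ m) ⟩
        4 * s * (A * n ^ m) * Z ^ m           ∎
    double : 2 * s * F * A₂ ≤ suc (2 * s) * (A * A)
    double = *-cancelʳ-≤′ (suc G₁) (s≤s z≤n) (begin
      2 * s * F * A₂ * suc G₁                      ≡⟨ lemma₃ s F A₂ (suc G₁) ⟩
      F * A₂ * (2 * s * suc G₁)                    ≤⟨ *-monoʳ-≤ (F * A₂) room ⟩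
      F * A₂ * (suc (2 * s) * (suc G₁ ∸ m))        ≡⟨ lemma₄ (F * A₂) (suc (2 * s)) (suc G₁ ∸ m) ⟩
      suc (2 * s) * (F * A₂ * (suc G₁ ∸ m))        ≤⟨ *-monoʳ-≤ (suc (2 * s)) (subst (λ x → fallingFact x m * A₂ * (suc G₁ ∸ m) ≤ A * A * suc G₁)
                                                        (sym N≡) (fallingFact-square l G₁ m)) ⟩
      suc (2 * s) * (A * A * suc G₁)               ≡⟨ *-assoc (suc (2 * s)) (A * A) (suc G₁) ⟨
      suc (2 * s) * (A * A) * suc G₁               ∎)
      where
      lemma₃ : ∀ s F A g → 2 * s * F * A * g ≡ F * A * (2 * s * g)
      lemma₃ = solve-∀
      lemma₄ : ∀ p q r → p * (q * r) ≡ q * (p * r)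
      lemma₄ = solve-∀
      room : 2 * s * suc G₁ ≤ suc (2 * s) * (suc G₁ ∸ m)
      room = +-cancelʳ-≤ (suc (2 * s) * m) _ _ (begin
        2 * s * suc G₁ + suc (2 * s) * m                   ≤⟨ +-monoʳ-≤ (2 * s * suc G₁) G₁-large ⟩
        2 * s * suc G₁ + suc G₁                            ≡⟨ +-comm _ (suc G₁) ⟩
        suc (2 * s) * suc G₁                               ≡⟨ cong (suc (2 * s) *_) (m∸n+n≡m (≤-trans m≤G₁ (n≤1+n G₁))) ⟨
        suc (2 * s) * (suc G₁ ∸ m + m)                     ≡⟨ *-distribˡ-+ (suc (2 * s)) (suc G₁ ∸ m) m ⟩
        suc (2 * s) * (suc G₁ ∸ m) + suc (2 * s) * m       ∎)
    variance : s * (N ! * S₂) ≤ suc s * (S₁ * S₁)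
    variance = *-cancelˡ-≤ 2 (begin
      2 * (s * (N ! * S₂))
        ≤⟨ *-monoʳ-≤ 2 (*-monoʳ-≤ s (*-monoʳ-≤ (N !) second-moment)) ⟩
      2 * (s * (N ! * (n * (A * h) + n * (n * (A₂ * h)))))
        ≡⟨ cong (λ t → 2 * (s * (t * (n * (A * h) + n * (n * (A₂ * h)))))) T≡ ⟨
      2 * (s * (F * h * (n * (A * h) + n * (n * (A₂ * h)))))
        ≡⟨ lemma₃ s F h n A A₂ ⟩
      h * h * (2 * s * F * (n * A) + n * n * (2 * s * F * A₂))
        ≤⟨ *-monoʳ-≤ (h * h) (+-mono-≤ (*-monoˡ-≤ (n * A) single) (*-monoʳ-≤ (n * n) double)) ⟩
      h * h * (n * A * (n * A) + n * n * (suc (2 * s) * (A * A)))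
        ≡⟨ lemma₄ s h n A ⟩
      2 * (suc s * (n * (A * h) * (n * (A * h))))
        ≡⟨ cong (λ x → 2 * (suc s * (x * x))) first-moment ⟨
      2 * (suc s * (S₁ * S₁)) ∎)
      where
      lemma₃ : ∀ s F h n A A₂ → 2 * (s * (F * h * (n * (A * h) + n * (n * (A₂ * h)))))
        ≡ h * h * (2 * s * F * (n * A) + n * n * (2 * s * F * A₂))
      lemma₃ = solve-∀
      lemma₄ : ∀ s h n A → h * h * (n * A * (n * A) + n * n * (suc (2 * s) * (A * A)))
        ≡ 2 * (suc s * (n * (A * h) * (n * (A * h))))
      lemma₄ = solve-∀

  2*G₁≡ : 2 * ∑ (edgesK n) (𝟙 ∘ inside (not ∘ (Fin.zero ==_))) ≡ l * k
  2*G₁≡ = 2G₁≡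

-- Asymptotics

module Union (l m₀ m₁ K Y b Δ z : ℕ) (m₁≡ : m₁ ≡ suc (suc l) * suc z) (m₁<N : m₁ < length (edgesK (suc (suc l))))
  (m₀≤m₁ : m₀ ≤ m₁) (l>0 : 0 < l) (K>0 : 0 < K) (5≤Y : 5 ≤ Y) where

  open Isolated l m₀ m₁ K Y b Δ z m₁≡ (<⇒≤ m₁<N) m₀≤m₁ l>0
  open Events k m₀ m₁ K Y b Δ
  open Deterministic k m₀ m₁ K Y b Δ K>0 5≤Y (subst (m₁ <_) (length-edgesK (suc k)) m₁<N) (s≤s z≤n)
  open ≤-Reasoning

  private
    Event : Set
    Event = Ordering → Ordering → Bool

    pairs : Event → ℕ
    pairs p = (orderings n ⟨×⟩ orderings n) (λ σ τ → 𝟙 (p σ τ))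

    Rare : Event → Set
    Rare p = s * pairs p ≤ N ! * N !

    -- The bound on `clash` is proved for each fixed second ordering and needs its mask to be short.
    -- Second orderings for which this is not assured are left out here and charged to `low` and
    -- `high`.
    visibleClash : Event
    visibleClash σ τ = (not (low τ) ∧ not (high τ)) ∧ clash σ τ

    events : List Event
    events =
      (λ σ τ → disconnected σ) ∷ (λ σ τ → disconnected τ) ∷ (λ σ τ → noIsolated σ) ∷
      (λ σ τ → dense σ) ∷ (λ σ τ → dense τ) ∷ (λ σ τ → low σ) ∷ (λ σ τ → low τ) ∷
      (λ σ τ → high σ) ∷ (λ σ τ → high τ) ∷ visibleClash ∷ (λ σ τ → visibleClash τ σ) ∷
      separated ∷ (λ σ τ → separated τ σ) ∷ []

    bad-event : ∀ {σ τ} → σ ∈ orderings n → τ ∈ orderings n → goodEvent n σ τ ≡ false →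
      any (λ p → p σ τ) events ≡ true
    bad-event {σ} {τ} σ∈ τ∈ bad with any (λ p → p σ τ) events in none
    ... | true  = refl
    ... | false = true≢false (good σ-side τ-side (avoids (here refl)) (avoids (there (here refl))) (avoids (there (there (here refl))))) bad
      where
      avoids : ∀ {p} → p ∈ events → p σ τ ≡ false
      avoids m = any-false (λ p → p σ τ) events none m
      unclash : ∀ {a b c} → a ≡ false → b ≡ false → (not a ∧ not b) ∧ c ≡ false → c ≡ false
      unclash refl refl h = h
      ¬dσ = avoids (there (there (there (here refl))))
      ¬dτ = avoids (there (there (there (there (here refl)))))
      ¬lσ = avoids (there (there (there (there (there (here refl))))))
      ¬lτ = avoids (there (there (there (there (there (there (here refl)))))))
      ¬hσ = avoids (there (there (there (there (there (there (there (here refl))))))))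
      ¬hτ = avoids (there (there (there (there (there (there (there (there (here refl)))))))))
      ¬c  = avoids (there (there (there (there (there (there (there (there (there (here refl))))))))))
      ¬c′ = avoids (there (there (there (there (there (there (there (there (there (there (here refl)))))))))))
      ¬s  = avoids (there (there (there (there (there (there (there (there (there (there (there (here refl))))))))))))
      ¬s′ = avoids (there (there (there (there (there (there (there (there (there (there (there (there (here refl)))))))))))))
      σ-side : OneSided σ τ
      σ-side = record { σ∈ = σ∈ ; τ∈ = τ∈ ; ¬dense = ¬dσ ; ¬dense′ = ¬dτ ; ¬low = ¬lτ
                      ; ¬clash = unclash ¬lτ ¬hτ ¬c ; ¬separated = ¬s }
      τ-side : OneSided τ σ
      τ-side = record { σ∈ = τ∈ ; τ∈ = σ∈ ; ¬dense = ¬dτ ; ¬dense′ = ¬dσ ; ¬low = ¬lσ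
                      ; ¬clash = unclash ¬lσ ¬hσ ¬c′ ; ¬separated = ¬s′ }

    count : length (orderings n) ≡ N !
    count = length-perms (edgesK n)

    flip-pairs : ∀ p → pairs (λ σ τ → p τ σ) ≡ pairs p
    flip-pairs p = ∑-swap (orderings n) (orderings n) _

    rare-flip : ∀ {p} → Rare p → Rare (λ σ τ → p τ σ)
    rare-flip {p} h = ≤-trans (≤-reflexive (cong (s *_) (flip-pairs p))) h

    rare-single : ∀ (p : Ordering → Bool) → s * ∑ (orderings n) (𝟙 ∘ p) ≤ N ! → Rare (λ σ τ → p σ)
    rare-single p h = begin
      s * ∑ (orderings n) (λ σ → ∑ (orderings n) (λ _ → 𝟙 (p σ)))
        ≡⟨ cong (s *_) (trans (∑-cong (orderings n) (λ σ → trans (∑-const (orderings n) (𝟙 (p σ))) (cong (_* 𝟙 (p σ)) count)))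
             (∑-*ˡ (orderings n) (N !) (𝟙 ∘ p))) ⟩
      s * (N ! * ∑ (orderings n) (𝟙 ∘ p))
        ≡⟨ lemma s (N !) (∑ (orderings n) (𝟙 ∘ p)) ⟩
      N ! * (s * ∑ (orderings n) (𝟙 ∘ p))
        ≤⟨ *-monoʳ-≤ (N !) h ⟩
      N ! * N ! ∎
      where
      lemma : ∀ s t x → s * (t * x) ≡ t * (s * x)
      lemma = solve-∀

    rare-clash : (∀ {τ} → τ ∈ orderings n → low τ ≡ false → high τ ≡ false →
      s * ∑ (orderings n) (λ σ → 𝟙 (clash σ τ)) ≤ N !) → Rare visibleClash
    rare-clash h = begin
      s * pairs visibleClash
        ≡⟨ cong (s *_) (sym (flip-pairs visibleClash)) ⟩
      s * ∑ (orderings n) (λ τ → ∑ (orderings n) (λ σ → 𝟙 (visibleClash σ τ)))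
        ≡⟨ ∑-*ˡ (orderings n) s _ ⟨
      ∑ (orderings n) (λ τ → s * ∑ (orderings n) (λ σ → 𝟙 (visibleClash σ τ)))
        ≤⟨ ∑-mono-All (All.tabulate each) ⟩
      ∑ (orderings n) (λ _ → N !)
        ≡⟨ trans (∑-const (orderings n) (N !)) (cong (_* N !) count) ⟩
      N ! * N ! ∎
      where
      each : ∀ {τ} → τ ∈ orderings n → s * ∑ (orderings n) (λ σ → 𝟙 (visibleClash σ τ)) ≤ N !
      each {τ} τ∈ with low τ in ¬low | high τ in ¬high
      ... | false | false = h τ∈ ¬low ¬high
      ... | true  | _     = ≤-trans (≤-reflexive (trans (cong (s *_) (∑-zero (orderings n))) (*-zeroʳ s))) z≤n
      ... | false | true  = ≤-trans (≤-reflexive (trans (cong (s *_) (∑-zero (orderings n))) (*-zeroʳ s))) z≤n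

  bad-rare : s * ∑ (orderings n) (𝟙 ∘ disconnected) ≤ N ! → s * ∑ (orderings n) (𝟙 ∘ noIsolated) ≤ N ! →
    s * ∑ (orderings n) (𝟙 ∘ dense) ≤ N ! → s * ∑ (orderings n) (𝟙 ∘ low) ≤ N ! →
    s * ∑ (orderings n) (𝟙 ∘ high) ≤ N ! →
    (∀ τ → trues (touchMask τ) ≤ b * Δ → length (touchMask τ) ≤ N → s * ∑ (orderings n) (λ σ → 𝟙 (clash σ τ)) ≤ N !) →
    s * pairs separated ≤ N ! * N ! →
    s * badCount n ≤ 13 * totalCount n
  bad-rare d i de lo hi cl sep = begin
    s * badCount n
      ≡⟨ cong (s *_) (trans (filterᵇ-∑ _ (samples n)) (∑-cartesianProduct (orderings n) (orderings n) _)) ⟩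
    s * pairs (λ σ τ → not (goodEvent n σ τ))
      ≤⟨ *-monoʳ-≤ s (∑-mono-All (All.tabulate (λ {σ} σ∈ → ∑-mono-All (All.tabulate (λ {τ} τ∈ → bound σ∈ τ∈))))) ⟩
    s * (orderings n ⟨×⟩ orderings n) (λ σ τ → ∑ events (λ p → 𝟙 (p σ τ)))
      ≡⟨ cong (s *_) (trans (∑-cong (orderings n) (λ σ → ∑-swap (orderings n) events (λ τ p → 𝟙 (p σ τ))))
             (∑-swap (orderings n) events (λ σ p → ∑ (orderings n) (λ τ → 𝟙 (p σ τ))))) ⟩
    s * ∑ events pairs
      ≡⟨ ∑-*ˡ events s pairs ⟨
    ∑ events (λ p → s * pairs p)
      ≤⟨ ∑-mono-All rare ⟩
    ∑ events (λ _ → N ! * N !)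
      ≡⟨ ∑-const events (N ! * N !) ⟩
    13 * (N ! * N !)
      ≡⟨ cong (13 *_) total ⟨
    13 * totalCount n ∎
    where
    total : totalCount n ≡ N ! * N !
    total = trans (length≡∑ (samples n)) (trans (∑-cartesianProduct (orderings n) (orderings n) (λ _ → 1))
      (trans (∑-cong (orderings n) (λ _ → sym (length≡∑ (orderings n))))
        (trans (∑-const (orderings n) (length (orderings n))) (cong₂ _*_ count count))))
    bound : ∀ {σ τ} → σ ∈ orderings n → τ ∈ orderings n →
      𝟙 (not (goodEvent n σ τ)) ≤ ∑ events (λ p → 𝟙 (p σ τ))
    bound {σ} {τ} σ∈ τ∈ = ≤-trans (𝟙-mono (λ h → bad-event σ∈ τ∈ (not-true⁻ h))) (𝟙-any (λ p → p σ τ) events)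
    clash-bound = rare-clash (λ {τ} τ∈ ¬low ¬high → cl τ (trues-touchMask τ∈ ¬low ¬high)
      (≤-trans (≤-reflexive (List.length-map (touch (lows τ)) (take m₁ τ))) (≤-trans (≤-reflexive (List.length-take m₁ τ))
        (≤-trans (m⊓n≤m m₁ (length τ)) (<⇒≤ m₁<N)))))
    rare : All Rare events
    rare = rare-single disconnected d ∷ rare-flip {λ σ τ → disconnected σ} (rare-single disconnected d) ∷
      rare-single noIsolated i ∷ rare-single dense de ∷ rare-flip {λ σ τ → dense σ} (rare-single dense de) ∷
      rare-single low lo ∷ rare-flip {λ σ τ → low σ} (rare-single low lo) ∷
      rare-single high hi ∷ rare-flip {λ σ τ → high σ} (rare-single high hi) ∷
      clash-bound ∷ rare-flip {visibleClash} clash-bound ∷ sep ∷ rare-flip {separated} sep ∷ []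

integer-root : ∀ P n → 0 < P → ∃[ s ] s ^ P ≤ n × n < suc s ^ P
integer-root P@(suc p) n _ = search (suc n) (m<m^P (suc n))
  where
  m<m^P : ∀ m → m ≤ m ^ P
  m<m^P zero    = z≤n
  m<m^P (suc m) = ≤-trans (≤-reflexive (sym (*-identityʳ (suc m)))) (*-monoʳ-≤ (suc m) (^>0 (suc m) p (s≤s z≤n)))
  search : ∀ j → n < j ^ P → ∃[ s ] s ^ P ≤ n × n < suc s ^ P
  search (suc j) h with j ^ P ≤? n
  ... | yes q = j , q , h
  ... | no ¬q = search j (≰⇒> ¬q)

-- At the scale s with s^(β+ω) ≤ n ≤ 4s^(β+ω) the parameters are m₁ = ns, Y = s^(e+2), |L| ≤ 8s^β,
-- and m₀ is the first m with (1 - 2/n)^m ≤ s^(-64a′).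
module Asymptotics (β ω K e a′ ζ : ℕ)
  (dense-ok : β + ω + 2 ≤ e * K) (low-ok : 10 + ω * 8 + 80 * K ≤ 7 * (64 * a′)) (touch-ok : 1 ≤ ω)
  (clash-ok : ζ + 2 ≤ ω) (clash-ok′ : β + ω + 2 ≤ ζ + ζ) (Y-ok : e + 3 ≤ β + ω) (separated-ok : 8 + 3 * e ≤ a′)
  (isolated-ok : 64 * a′ + 2 ≤ β + ω) (P-ok : 3 ≤ β + ω) (K>0 : 0 < K) where

  private
    P a : ℕ
    P = β + ω
    a = 64 * a′

  module AtScale (z l : ℕ) (128≤s : 128 ≤ suc z) (s^P≤n : suc z ^ P ≤ suc (suc l)) (n≤4s^P : suc (suc l) ≤ 4 * suc z ^ P)
    (8s^[P+1]≤2^s : 8 * suc z ^ (P + 1) ≤ 2 ^ suc z) where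

    open ≤-Reasoning

    s k n m₁ : ℕ
    s = suc z
    k = suc l
    n = suc k
    m₁ = n * s

    s^-mono : ∀ {i j} → i ≤ j → s ^ i ≤ s ^ j
    s^-mono = ^-monoʳ-≤ s

    -- One power of `s` pays for a numerical constant; the slack in the inequalities between the
    -- exponents is there for this.
    absorb : ∀ c i q → c ≤ s → suc i ≤ q → c * s ^ i ≤ s ^ q
    absorb c i q c≤s i<q = ≤-trans (*-monoˡ-≤ (s ^ i) c≤s) (s^-mono i<q)

    small : ∀ {c} → c ≤ 128 → c ≤ s
    small h = ≤-trans h 128≤s

    s^[1+i] : ∀ i → s ^ (i + 1) ≡ s * s ^ i
    s^[1+i] i = cong (s ^_) (+-comm i 1)

    128s²≤n : 128 * (s * s) ≤ n
    128s²≤n = ≤-trans (≤-reflexive (cong (λ x → 128 * (s * x)) (sym (*-identityʳ s)))) (≤-trans (absorb 128 2 P 128≤s P-ok) s^P≤n)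

    128s≤n : 128 * s ≤ n
    128s≤n = ≤-trans (*-monoʳ-≤ 128 (≤-trans (≤-reflexive (sym (*-identityʳ s))) (*-monoʳ-≤ s (s≤s z≤n)))) 128s²≤n

    128≤n : 128 ≤ n
    128≤n = ≤-trans (≤-reflexive (sym (*-identityʳ 128))) (≤-trans (*-monoʳ-≤ 128 (s≤s (z≤n {z}))) 128s≤n)

    2≤l : 2 ≤ l
    2≤l = ≤-pred (≤-pred (≤-trans (≤ᵇ⇒≤ 4 128 tt) 128≤n))

    n≤2l : n ≤ 2 * l
    n≤2l = ≤-trans (+-monoˡ-≤ l 2≤l) (≤-reflexive (cong (l +_) (sym (+-identityʳ l))))

    n≤2k : n ≤ 2 * k
    n≤2k = ≤-trans n≤2l (*-monoʳ-≤ 2 (n≤1+n l))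

    N : ℕ
    N = length (edgesK n)

    2N≡ : 2 * N ≡ n * k
    2N≡ = 2*edges k

    m₁<N : m₁ < N
    m₁<N = *-cancelˡ-≤ 2 (begin
      2 * suc (n * s)       ≡⟨ lemma n s ⟩
      n * (2 * s) + 2       ≤⟨ +-monoʳ-≤ (n * (2 * s)) (s≤s (s≤s (z≤n {l}))) ⟩
      n * (2 * s) + n       ≡⟨ lemma′ n s ⟩
      n * suc (2 * s)       ≤⟨ *-monoʳ-≤ n (≤-pred 2s+2≤n) ⟩
      n * k                 ≡⟨ 2N≡ ⟨
      2 * N                 ∎)
      where
      lemma : ∀ n s → 2 * suc (n * s) ≡ n * (2 * s) + 2
      lemma = solve-∀
      lemma′ : ∀ n s → n * (2 * s) + n ≡ n * suc (2 * s)
      lemma′ = solve-∀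
      2s+2≤n : suc (suc (2 * s)) ≤ n
      2s+2≤n = begin
        2 + 2 * s       ≤⟨ +-monoˡ-≤ (2 * s) (≤-trans (small (≤ᵇ⇒≤ 2 128 tt)) (≤-reflexive (sym (*-identityˡ s)))) ⟩
        1 * s + 2 * s   ≡⟨ *-distribʳ-+ s 1 2 ⟨
        3 * s           ≤⟨ *-monoˡ-≤ s (≤ᵇ⇒≤ 3 128 tt) ⟩
        128 * s         ≤⟨ 128s≤n ⟩
        n               ∎

    s^a≤2^s : s ^ a ≤ 2 ^ s
    s^a≤2^s = ≤-trans (s^-mono (≤-trans (m≤m+n a 2) (≤-trans isolated-ok (m≤m+n P 1))))
      (≤-trans (m≤m+n _ (7 * s ^ (P + 1))) 8s^[P+1]≤2^s)

    [1+s]n≤2^s : suc s * n ≤ 2 ^ s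
    [1+s]n≤2^s = begin
      suc s * n             ≤⟨ *-mono-≤ (+-monoˡ-≤ s (s≤s (z≤n {z}))) n≤4s^P ⟩
      (s + s) * (4 * s ^ P) ≡⟨ lemma s (s ^ P) ⟩
      8 * (s * s ^ P)       ≡⟨ cong (8 *_) (s^[1+i] P) ⟨
      8 * s ^ (P + 1)       ≤⟨ 8s^[P+1]≤2^s ⟩
      2 ^ s                 ∎
      where
      lemma : ∀ s p → (s + s) * (4 * p) ≡ 8 * (s * p)
      lemma = solve-∀

    early : ℕ → Bool
    early m = s ^ a * l ^ m ≤ᵇ n ^ m

    -- `(1 - 2/n)^n ≤ 1/4`, so at time `n s` the power is at most `4^(-s)`, which is below `s^(-a)`.
    early-m₁ : early m₁ ≡ true
    early-m₁ = ≤ᵇ-true (begin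
      s ^ a * l ^ (n * s)          ≤⟨ *-monoˡ-≤ (l ^ (n * s)) (≤-trans s^a≤2^s (^-monoˡ-≤ s (≤ᵇ⇒≤ 2 4 tt))) ⟩
      4 ^ s * l ^ (n * s)          ≡⟨ trans (*-comm (4 ^ s) _) (cong (_* 4 ^ s) (sym (^-*-assoc l n s))) ⟩
      (l ^ n) ^ s * 4 ^ s          ≡⟨ [m*n]^k (l ^ n) 4 s ⟨
      (l ^ n * 4) ^ s              ≤⟨ ^-monoˡ-≤ s (subst (λ j → l ^ j * 4 ≤ j ^ j) (+-comm l 2)
                                        (w^n*2^u≤n^n l 2 (≤-trans (s≤s z≤n) (m≤n+m 2 l)))) ⟩
      (n ^ n) ^ s                  ≡⟨ ^-*-assoc n n s ⟩
      n ^ (n * s)                  ∎)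

    first-early : ∃[ m ] minM (suc m₁) early ≡ just m × early m ≡ true × m ≤ m₁ × (∀ i → early i ≡ true → m ≤ i)
    first-early = minM-spec (suc m₁) early (n<1+n m₁) early-m₁

    m₀ : ℕ
    m₀ = proj₁ first-early

    m₀-power : s ^ a * l ^ m₀ ≤ n ^ m₀
    m₀-power = ≤ᵇ-true⁻ (s ^ a * l ^ m₀) (n ^ m₀) (proj₁ (proj₂ (proj₂ first-early)))

    m₀≤m₁ : m₀ ≤ m₁
    m₀≤m₁ = proj₁ (proj₂ (proj₂ (proj₂ first-early)))

    -- One step before `m₀` the power `(l/n)^m` is still above `s^(-a)`, and a single step divides
    -- it by `n/l ≤ 2`. This keeps isolated vertices numerous at `m₀`.
    m₀-tight : n ^ m₀ ≤ 2 * s ^ a * l ^ m₀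
    m₀-tight = tight m₀ (proj₂ (proj₂ (proj₂ (proj₂ first-early))))
      where
      tight : ∀ m → (∀ i → early i ≡ true → m ≤ i) → n ^ m ≤ 2 * s ^ a * l ^ m
      tight zero    _     = ≤-trans (*-mono-≤ {1} {2} (s≤s z≤n) (^>0 s a (s≤s z≤n))) (≤-reflexive (sym (*-identityʳ _)))
      tight (suc m) least with early m in eq
      ... | true  = contradiction (least m eq) (<-irrefl refl)
      ... | false = begin
        n * n ^ m                  ≤⟨ *-mono-≤ n≤2l (<⇒≤ (≤ᵇ-false⁻ (s ^ a * l ^ m) (n ^ m) eq)) ⟩
        2 * l * (s ^ a * l ^ m)    ≡⟨ lemma l (s ^ a) (l ^ m) ⟩
        2 * s ^ a * (l * l ^ m)    ∎
        where
        lemma : ∀ l p q → 2 * l * (p * q) ≡ 2 * p * (l * q)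
        lemma = solve-∀

    -- `zz` is the tilt of `dense-rare`. In `Y` one factor `s` accounts for the `n s` edges of the
    -- prefix, the other for the constant in `4 n ≤ s k`. `Δ` is four times the mean degree `2s`.
    zz Y b Δ : ℕ
    zz = s ^ e
    Y = zz * s * s
    b = 8 * s ^ β
    Δ = 4 * s + 4 * s

    Y≡ : Y ≡ s ^ (e + 2)
    Y≡ = trans (*-assoc zz s s) (trans (cong (λ x → zz * (s * x)) (sym (*-identityʳ s))) (sym (^-distribˡ-+-* s e 2)))

    5≤Y : 5 ≤ Y
    5≤Y = ≤-trans (≤-trans (small (≤ᵇ⇒≤ 5 128 tt)) (m≤n*m s (zz * s) {{ℕ.>-nonZero (*-mono-≤ (^>0 s e (s≤s z≤n)) (s≤s (z≤n {z})))}})) ≤-refl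

    open Union l m₀ m₁ K Y b Δ z refl m₁<N m₀≤m₁ (≤-trans (s≤s z≤n) 2≤l) K>0 5≤Y using (bad-rare)
    open Isolated l m₀ m₁ K Y b Δ z refl (<⇒≤ m₁<N) m₀≤m₁ (≤-trans (s≤s z≤n) 2≤l)
      using (disconnected-rare; dense-rare; high-rare; low-rare; clash-rare; separated-rare; noIsolated-rare; 2*G₁≡)

    G₁ : ℕ
    G₁ = ∑ (edgesK n) (𝟙 ∘ inside (not ∘ (Fin.zero ==_)))

    nn≤4lk : n * n ≤ 4 * (l * k)
    nn≤4lk = ≤-trans (*-mono-≤ n≤2l n≤2k) (≤-reflexive (lemma l k))
      where
      lemma : ∀ l k → 2 * l * (2 * k) ≡ 4 * (l * k)
      lemma = solve-∀

    3nss≤G₁ : 3 * s * (n * s) ≤ G₁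
    3nss≤G₁ = *-cancelˡ-≤ 8 (begin
      8 * (3 * s * (n * s))       ≡⟨ lemma s n ⟩
      n * (24 * (s * s))          ≤⟨ *-monoʳ-≤ n (≤-trans (*-monoˡ-≤ (s * s) (≤ᵇ⇒≤ 24 128 tt)) 128s²≤n) ⟩
      n * n                       ≤⟨ nn≤4lk ⟩
      4 * (l * k)                 ≡⟨ cong (4 *_) 2*G₁≡ ⟨
      4 * (2 * G₁)                ≡⟨ *-assoc 4 2 G₁ ⟨
      8 * G₁                      ∎)
      where
      lemma : ∀ s n → 8 * (3 * s * (n * s)) ≡ n * (24 * (s * s))
      lemma = solve-∀

    1≤s : 1 ≤ s
    1≤s = s≤s z≤n

    [1+2s]m₀≤G₁ : suc (2 * s) * m₀ ≤ G₁
    [1+2s]m₀≤G₁ = ≤-trans (*-mono-≤ (+-monoˡ-≤ (2 * s) 1≤s) m₀≤m₁) 3nss≤G₁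

    m₀≤G₁ : m₀ ≤ G₁
    m₀≤G₁ = ≤-trans (m≤m+n m₀ _) [1+2s]m₀≤G₁

    ratio-ok : 2 * m₀ * suc (suc (2 * m₀)) ≤ l * (N ∸ m₀)
    ratio-ok = *-cancelˡ-≤ 16 (begin
      16 * (2 * m₀ * suc (suc (2 * m₀)))   ≤⟨ *-monoʳ-≤ 16 (*-mono-≤ (*-monoʳ-≤ 2 m₀≤m₁) (s≤s (s≤s (*-monoʳ-≤ 2 m₀≤m₁)))) ⟩
      16 * (2 * (n * s) * (2 + 2 * (n * s))) ≤⟨ *-monoʳ-≤ 16 (*-monoʳ-≤ (2 * (n * s)) (+-monoˡ-≤ (2 * (n * s)) (*-monoʳ-≤ 2 (*-mono-≤ {1} {n} (s≤s z≤n) 1≤s)))) ⟩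
      16 * (2 * (n * s) * (2 * (n * s) + 2 * (n * s))) ≡⟨ lemma n s ⟩
      n * (n * (128 * (s * s)))            ≤⟨ *-monoʳ-≤ n (*-monoʳ-≤ n 128s²≤n) ⟩
      n * (n * n)                          ≤⟨ *-mono-≤ n≤2l nn≤ ⟩
      2 * l * (8 * (N ∸ m₀))               ≡⟨ lemma′ l (N ∸ m₀) ⟩
      16 * (l * (N ∸ m₀))                  ∎)
      where
      lemma : ∀ n s → 16 * (2 * (n * s) * (2 * (n * s) + 2 * (n * s))) ≡ n * (n * (128 * (s * s)))
      lemma = solve-∀
      lemma′ : ∀ l x → 2 * l * (8 * x) ≡ 16 * (l * x)
      lemma′ = solve-∀
      lemma″ : ∀ n k → 2 * (n * (2 * k)) ≡ 4 * (n * k)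
      lemma″ = solve-∀
      lemma‴ : ∀ n s → 8 * (n * s) ≡ n * (8 * s)
      lemma‴ = solve-∀
      nn≤ : n * n ≤ 8 * (N ∸ m₀)
      nn≤ = ≤-trans (m+n≤o⇒m≤o∸n (n * n) (begin
        n * n + 8 * m₀           ≤⟨ +-monoʳ-≤ (n * n) (*-monoʳ-≤ 8 m₀≤m₁) ⟩
        n * n + 8 * (n * s)      ≡⟨ cong (n * n +_) (lemma‴ n s) ⟩
        n * n + n * (8 * s)      ≤⟨ +-monoʳ-≤ (n * n) (*-monoʳ-≤ n (≤-trans (*-monoˡ-≤ s (≤ᵇ⇒≤ 8 128 tt)) 128s≤n)) ⟩
        n * n + n * n            ≡⟨ cong (n * n +_) (+-identityʳ (n * n)) ⟨
        2 * (n * n)              ≤⟨ *-monoʳ-≤ 2 (*-monoʳ-≤ n n≤2k) ⟩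
        2 * (n * (2 * k))        ≡⟨ lemma″ n k ⟩
        4 * (n * k)              ≡⟨ cong (4 *_) 2N≡ ⟨
        4 * (2 * N)              ≡⟨ *-assoc 4 2 N ⟨
        8 * N                    ∎)) (≤-reflexive (sym (*-distribˡ-∸ 8 N m₀)))

    Z-power : 4 * (suc s * n) ≤ zz ^ K
    Z-power = begin
      4 * (suc s * n)               ≤⟨ *-monoʳ-≤ 4 (*-mono-≤ (+-monoˡ-≤ s 1≤s) n≤4s^P) ⟩
      4 * ((s + s) * (4 * s ^ P))   ≡⟨ lemma s (s ^ P) ⟩
      32 * (s * s ^ P)              ≤⟨ absorb 32 (suc P) (e * K) (small (≤ᵇ⇒≤ 32 128 tt)) (≤-trans (≤-reflexive (+-comm 2 P)) dense-ok) ⟩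
      s ^ (e * K)                   ≡⟨ ^-*-assoc s e K ⟨
      zz ^ K                        ∎
      where
      lemma : ∀ s p → 4 * ((s + s) * (4 * p)) ≡ 32 * (s * p)
      lemma = solve-∀

    4n≤sk : 4 * n ≤ s * k
    4n≤sk = ≤-trans (*-monoʳ-≤ 4 n≤2k) (≤-trans (≤-reflexive (sym (*-assoc 4 2 k))) (*-monoˡ-≤ k (small (≤ᵇ⇒≤ 8 128 tt))))

    sn≤2^4s : s * n ≤ 2 ^ (4 * s)
    sn≤2^4s = ≤-trans (*-monoˡ-≤ n (n≤1+n s)) (≤-trans [1+s]n≤2^s (^-monoʳ-≤ 2 (m≤m+n s _)))

    16b≤n : 16 * b ≤ n
    16b≤n = begin
      16 * (8 * s ^ β)   ≡⟨ *-assoc 16 8 (s ^ β) ⟨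
      128 * s ^ β        ≤⟨ absorb 128 β P 128≤s (≤-trans (≤-reflexive (+-comm 1 β)) (+-monoʳ-≤ β touch-ok)) ⟩
      s ^ P              ≤⟨ s^P≤n ⟩
      n                  ∎

    14s≤15z : 14 * s ≤ 15 * z
    14s≤15z = begin
      14 * suc z     ≡⟨ *-suc 14 z ⟩
      14 + 14 * z    ≤⟨ +-monoˡ-≤ (14 * z) (≤-pred (≤-trans (≤ᵇ⇒≤ 15 128 tt) 128≤s)) ⟩
      z + 14 * z     ≡⟨⟩
      15 * z         ∎

    low-power : s * (4 * (4 * s ^ ω) ^ 8 * s ^ (80 * K)) ≤ s ^ (7 * a)
    low-power = begin
      s * (4 * (4 * s ^ ω) ^ 8 * s ^ (80 * K))
        ≡⟨ cong (λ x → s * (4 * x * s ^ (80 * K))) (trans ([m*n]^k 4 (s ^ ω) 8) (cong (4 ^ 8 *_) (^-*-assoc s ω 8))) ⟩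
      s * (4 * (4 ^ 8 * s ^ (ω * 8)) * s ^ (80 * K))
        ≡⟨ lemma s (4 ^ 8) (s ^ (ω * 8)) (s ^ (80 * K)) ⟩
      4 * 4 ^ 8 * s * s ^ (ω * 8) * s ^ (80 * K)
        ≤⟨ *-monoˡ-≤ (s ^ (80 * K)) (*-monoˡ-≤ (s ^ (ω * 8)) (*-monoˡ-≤ s (^-monoˡ-≤ 9 (small (≤ᵇ⇒≤ 4 128 tt))))) ⟩
      s ^ 9 * s * s ^ (ω * 8) * s ^ (80 * K)
        ≡⟨ cong (λ x → x * s ^ (ω * 8) * s ^ (80 * K)) (*-comm (s ^ 9) s) ⟩
      s ^ 10 * s ^ (ω * 8) * s ^ (80 * K)
        ≡⟨ cong (_* s ^ (80 * K)) (^-distribˡ-+-* s 10 (ω * 8)) ⟨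
      s ^ (10 + ω * 8) * s ^ (80 * K)
        ≡⟨ ^-distribˡ-+-* s (10 + ω * 8) (80 * K) ⟨
      s ^ (10 + ω * 8 + 80 * K)
        ≤⟨ s^-mono low-ok ⟩
      s ^ (7 * a) ∎
      where
      lemma : ∀ s c p q → s * (4 * (c * p) * q) ≡ 4 * c * s * p * q
      lemma = solve-∀

    n≤yβ : n ≤ 4 * s ^ ω * s ^ β
    n≤yβ = ≤-trans n≤4s^P (≤-reflexive (trans (cong (4 *_) (trans (^-distribˡ-+-* s β ω) (*-comm (s ^ β) _))) (sym (*-assoc 4 (s ^ ω) (s ^ β)))))

    ζB≤n : s ^ ζ * (b * Δ) ≤ n
    ζB≤n = begin
      s ^ ζ * (8 * s ^ β * (4 * s + 4 * s))   ≡⟨ lemma (s ^ ζ) (s ^ β) s ⟩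
      64 * (s * (s ^ ζ * s ^ β))              ≡⟨ cong (λ x → 64 * (s * x)) (^-distribˡ-+-* s ζ β) ⟨
      64 * s ^ suc (ζ + β)                    ≤⟨ absorb 64 (suc (ζ + β)) P (small (≤ᵇ⇒≤ 64 128 tt)) (≤-trans (≤-reflexive (lemma′ ζ β)) (+-monoʳ-≤ β clash-ok)) ⟩
      s ^ P                                   ≤⟨ s^P≤n ⟩
      n                                       ∎
      where
      lemma : ∀ x y s → x * (8 * y * (4 * s + 4 * s)) ≡ 64 * (s * (x * y))
      lemma = solve-∀
      lemma′ : ∀ ζ β → 2 + (ζ + β) ≡ β + (ζ + 2)
      lemma′ = solve-∀

    16sn≤ζ² : 16 * s * n ≤ s ^ ζ * s ^ ζ
    16sn≤ζ² = begin
      16 * s * n              ≤⟨ *-monoʳ-≤ (16 * s) n≤4s^P ⟩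
      16 * s * (4 * s ^ P)    ≡⟨ lemma s (s ^ P) ⟩
      64 * s ^ suc P          ≤⟨ absorb 64 (suc P) (ζ + ζ) (small (≤ᵇ⇒≤ 64 128 tt)) (≤-trans (≤-reflexive (+-comm 2 P)) clash-ok′) ⟩
      s ^ (ζ + ζ)             ≡⟨ ^-distribˡ-+-* s ζ ζ ⟩
      s ^ ζ * s ^ ζ           ∎
      where
      lemma : ∀ s p → 16 * s * (4 * p) ≡ 64 * (s * p)
      lemma = solve-∀

    32Y≤n : 32 * Y ≤ n
    32Y≤n = ≤-trans (≤-reflexive (cong (32 *_) Y≡)) (≤-trans
      (absorb 32 (e + 2) P (small (≤ᵇ⇒≤ 32 128 tt)) (≤-trans (≤-reflexive (sym (+-suc e 2))) Y-ok)) s^P≤n)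

    Y³-power : 16 * s * Y ^ 3 ≤ s ^ a′
    Y³-power = begin
      16 * s * Y ^ 3                ≡⟨ cong (λ y → 16 * s * y ^ 3) Y≡ ⟩
      16 * s * (s ^ (e + 2)) ^ 3    ≡⟨ trans (*-assoc 16 s _) (cong (λ x → 16 * (s * x)) (^-*-assoc s (e + 2) 3)) ⟩
      16 * s ^ suc ((e + 2) * 3)    ≤⟨ absorb 16 (suc ((e + 2) * 3)) a′ (small (≤ᵇ⇒≤ 16 128 tt)) (≤-trans (≤-reflexive (lemma e)) separated-ok) ⟩
      s ^ a′                        ∎
      where
      lemma : ∀ e → suc (suc ((e + 2) * 3)) ≡ 8 + 3 * e
      lemma = solve-∀

    8ss^a≤n : 8 * s * s ^ a ≤ n
    8ss^a≤n = ≤-trans (≤-reflexive (*-assoc 8 s (s ^ a))) (≤-trans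
      (absorb 8 (suc a) P (small (≤ᵇ⇒≤ 8 128 tt)) (≤-trans (≤-reflexive (+-comm 2 a)) isolated-ok)) s^P≤n)

    conclusion : s * badCount n ≤ 13 * totalCount n
    conclusion = bad-rare
      (disconnected-rare (m≤n⇒m≤1+n [1+s]n≤2^s))
      (noIsolated-rare a m₀-tight 8ss^a≤n (m≤n⇒m≤1+n [1+2s]m₀≤G₁) ratio-ok m₀≤G₁)
      (dense-rare zz (suc s * n) 1≤s refl 4n≤sk Z-power (n≤1+n _) (s≤s z≤n))
      (low-rare a (s ^ β) (4 * s ^ ω) m₀-power refl (^>0 s β 1≤s) n≤yβ 16b≤n 14s≤15z low-power
        (*-mono-≤ {1} {4} (s≤s z≤n) (^>0 s ω 1≤s)))
      (high-rare refl sn≤2^4s)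
      (λ τ ≤B mask≤ → clash-rare (b * Δ) (s ^ ζ) τ ≤B mask≤ ζB≤n 16sn≤ζ²)
      (separated-rare a′ m₀-power (≤-trans (s≤s z≤n) 5≤Y) 32Y≤n Y³-power)

  asymptotic : ∀ c → ∃[ n₀ ] (∀ n → n₀ ≤ n → c * badCount n ≤ totalCount n)
  asymptotic c with poly≤2^ 8 (P + 1)
  ... | s₀ , H = s₁ ^ P , bound
    where
    open ≤-Reasoning
    s₁ : ℕ
    -- The summands serve `poly≤2^`, the bound `(s+1)^P ≤ 4 s^P`, the 13 exceptional events together
    -- with the given factor `c`, and the numerical constants absorbed by `s`.
    s₁ = s₀ + P + 13 * c + 128
    P>0 : 0 < P
    P>0 = ≤-trans (s≤s z≤n) P-ok
    bound : ∀ n → s₁ ^ P ≤ n → c * badCount n ≤ totalCount n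
    bound n h with integer-root P n P>0
    ... | s , s^P≤n , n< = at-scale s n s^P≤n n< s₁≤s
      where
      s₁≤s : s₁ ≤ s
      s₁≤s with s₁ ≤? s
      ... | yes q = q
      ... | no ¬q = contradiction (≤-trans n< (^-monoˡ-≤ P (≰⇒> ¬q))) (≤⇒≯ h)
      at-scale : ∀ s n → s ^ P ≤ n → n < suc s ^ P → s₁ ≤ s → c * badCount n ≤ totalCount n
      at-scale zero n _ _ s₁≤s = contradiction (≤-trans (m≤n+m 128 (s₀ + P + 13 * c)) s₁≤s) (λ ())
      at-scale s@(suc z) n s^P≤n n< s₁≤s with n
      ... | zero = contradiction (≤-trans (^>0 s P (s≤s z≤n)) s^P≤n) (λ ())
      ... | suc zero = contradiction (≤-trans (≤-trans (s≤s (s≤s z≤n)) (≤-trans (m≤n+m 128 (s₀ + P + 13 * c)) s₁≤s))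
          (≤-trans (≤-reflexive (sym (*-identityʳ s))) (≤-trans (^-monoʳ-≤ s P>0) s^P≤n))) (λ { (s≤s ()) })
      ... | n@(suc (suc l)) = *-cancelˡ-≤ 13 (begin
          13 * (c * badCount n)   ≡⟨ *-assoc 13 c (badCount n) ⟨
          13 * c * badCount n     ≤⟨ *-monoˡ-≤ (badCount n) (≤-trans (m≤n+m (13 * c) (s₀ + P)) (≤-trans (m≤m+n _ 128) s₁≤s)) ⟩
          s * badCount n          ≤⟨ AtScale.conclusion z l (≤-trans (m≤n+m 128 (s₀ + P + 13 * c)) s₁≤s) s^P≤n n≤4s^P
                                       (H s (≤-trans (m≤m+n s₀ P) (≤-trans (m≤m+n (s₀ + P) (13 * c)) (≤-trans (m≤m+n (s₀ + P + 13 * c) 128) s₁≤s)))) ⟩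
          13 * totalCount n       ∎)
        where
        P≤s : P ≤ s
        P≤s = ≤-trans (m≤n+m P s₀) (≤-trans (m≤m+n (s₀ + P) (13 * c)) (≤-trans (m≤m+n _ 128) s₁≤s))
        n≤4s^P : n ≤ 4 * s ^ P
        n≤4s^P = ≤-trans (<⇒≤ n<) (exp-bound-suc s P 1 (≤-trans P≤s (≤-reflexive (sym (*-identityˡ s)))))

-- The constants are one solution of the ten inequalities.
theorem2 : (k : ℕ) → ∃[ n₀ ] ((n : ℕ) → n₀ ≤ n → k * badCount n ≤ totalCount n)
theorem2 = Asymptotics.asymptotic 11442 14158 264 97 300 14156
  (≤ᵇ⇒≤ (11442 + 14158 + 2) (97 * 264) tt) (≤ᵇ⇒≤ (10 + 14158 * 8 + 80 * 264) (7 * (64 * 300)) tt) (≤ᵇ⇒≤ 1 14158 tt)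
  (≤ᵇ⇒≤ (14156 + 2) 14158 tt) (≤ᵇ⇒≤ (11442 + 14158 + 2) (14156 + 14156) tt) (≤ᵇ⇒≤ (97 + 3) (11442 + 14158) tt)
  (≤ᵇ⇒≤ (8 + 3 * 97) 300 tt) (≤ᵇ⇒≤ (64 * 300 + 2) (11442 + 14158) tt) (≤ᵇ⇒≤ 3 (11442 + 14158) tt) (≤ᵇ⇒≤ 1 264 tt)
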